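{- For every constant $\varepsilon>0$ and every integer $m_0=m_0(n)$ with $\frac{1+\varepsilon}{6}\,n\log n\le m_0\le\binom n2$, the random graph process $\{G_i\}_{i=0}^{\binom n2}$ on $n$ vertices with high probability (as $n\to\infty$) has the following property: for every integer $m$ with $m_0\le m\le(1+\varepsilon/6)m_0$ (and $m\le\binom n2$), the giant (largest connected component) of $G_m$ is not $(1/2+\varepsilon)$-resilient with respect to connectivity.
   Context: Random graph process: $G_0$ is the empty graph on $n$ vertices; for each $i\in\{1,\dots,\binom n2\}$, $G_i$ is obtained from $G_{i-1}$ by adding an edge $e\notin E(G_{i-1})$ chosen uniformly at random among the missing edges. With high probability: with probability tending to $1$ as $n\to\infty$. $\log$ is the natural logarithm. The giant of a graph is its largest connected component (regarded as a graph on its own vertex set). $\alpha$-resilience: Let $G=(V,E)$ be a graph, $\mathcal P$ a monotone increasing graph property, and $\alpha$ a real constant. $G$ is $\alpha$-resilient with respect to $\mathcal P$ if for every spanning subgraph $H\subseteq G$ satisfying $\deg_H(v)\le \alpha\deg_G(v)$ for all $v\in V$, we have $G-H\in\mathcal P$, where $G-H$ is the graph on $V$ with edge set $E(G)\setminus E(H)$. -}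

module Defs where

open import Data.Empty using (⊥-elim-irr)
open import Data.Fin.Base as Fin using (Fin)
import Data.Fin.Properties as Fin
open import Data.Fin.Subset using (Subset; _∈_; ∣_∣; ⊤)
open import Data.Fin.Subset.Properties using (_∈?_; ∈⊤)
open import Data.Integer.Base as ℤ using (+_; +[1+_])
import Data.Integer.Properties as ℤ
open import Data.List.Base using (List; []; _∷_; _∷ʳ_; map; concatMap; mapMaybe; filter; foldr; length; allFin; cartesianProduct; take)
open import Data.List.Relation.Unary.Any as Any using (Any)
open import Data.Maybe.Base using (Maybe; just; nothing)
open import Data.Nat.Base as ℕ using (ℕ; zero; suc)
open import Data.Nat.Combinatorics using (_C_)
import Data.Nat.Properties as ℕ
import Data.Nat.Solver as ℕSolver
open import Data.Product.Base using (Σ; ∃; _×_; _,_; proj₁; proj₂)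
open import Data.Rational.Base as ℚ using (ℚ; mkℚ; 0ℚ; 1ℚ; ½; _/_; toℚᵘ)
import Data.Rational.Properties as ℚ
open import Data.Rational.Solver using (module +-*-Solver)
open import Data.Rational.Unnormalised.Base as ℚᵘ using (mkℚᵘ; *≡*; *≤*)
import Data.Rational.Unnormalised.Properties as ℚᵘ
open import Data.Sum.Base as Sum using (_⊎_; inj₁; inj₂)
open import Function.Base using (_∘_)
open import Function.Bundles using (_⇔_)
open import Level using (Level; 0ℓ)
open import Relation.Binary.Construct.Closure.ReflexiveTransitive as Star using (Star)
open import Relation.Binary.Core using (Rel; _⇒_)
import Relation.Binary.Definitions as Binary
open import Relation.Binary.PropositionalEquality using (_≡_; refl; sym; trans; cong; cong₂; subst)
open import Relation.Nullary.Decidable using (yes; no; _×-dec_; _⊎-dec_; ¬?)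
open import Relation.Nullary.Negation using (¬_)
open import Relation.Unary using (Pred; Decidable)

private
  variable
    ℓ : Level
    A B : Set ℓ

Eventually : (ℕ → Set ℓ) → Set ℓ
Eventually P = ∃ λ N → ∀ n → N ℕ.≤ n → P n

------------------------------------------------------------------------
-- Real numbers, as Cauchy sequences of rationals

IsCauchy : (ℕ → ℚ) → Set
IsCauchy x = ∀ δ → 0ℚ ℚ.< δ →
  ∃ λ N → ∀ i j → N ℕ.≤ i → N ℕ.≤ j → ℚ.∣ x i ℚ.- x j ∣ ℚ.≤ δ

record ℝ : Set where
  constructor mkℝ
  field
    approx : ℕ → ℚ
    cauchy : IsCauchy approx

open ℝ public

infix 4 _≤ᴿ_ _<ᴿ_

_≤ᴿ_ : Rel ℝ 0ℓ
x ≤ᴿ y = ∀ δ → 0ℚ ℚ.< δ → Eventually λ i → approx x i ℚ.≤ approx y i ℚ.+ δ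

_<ᴿ_ : Rel ℝ 0ℓ
x <ᴿ y = ∃ λ δ → 0ℚ ℚ.< δ × Eventually λ i → approx x i ℚ.+ δ ℚ.≤ approx y i

fromℚ : ℚ → ℝ
fromℚ q = mkℝ (λ _ → q) λ δ 0<δ →
  0 , λ _ _ _ _ → subst (ℚ._≤ δ) (cong ℚ.∣_∣ (sym (ℚ.+-inverseʳ q))) (ℚ.<⇒≤ 0<δ)

fromℕ : ℕ → ℝ
fromℕ n = fromℚ (+ n / 1)

private
  half-pos : ∀ {δ} → 0ℚ ℚ.< δ → 0ℚ ℚ.< ½ ℚ.* δ
  half-pos {δ} 0<δ = subst (ℚ._< ½ ℚ.* δ) (ℚ.*-zeroʳ ½) (ℚ.*-monoʳ-<-pos ½ 0<δ)

  halves : ∀ δ → ½ ℚ.* δ ℚ.+ ½ ℚ.* δ ≡ δ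
  halves δ = trans (sym (ℚ.*-distribʳ-+ δ ½ ½)) (ℚ.*-identityˡ δ)

  +-cauchy : ∀ x y → IsCauchy x → IsCauchy y → IsCauchy λ i → x i ℚ.+ y i
  +-cauchy x y cx cy δ 0<δ =
    let M , p = cx (½ ℚ.* δ) (half-pos 0<δ)
        N , q = cy (½ ℚ.* δ) (half-pos 0<δ)
    in M ℕ.⊔ N , λ i j i≥ j≥ → begin
      ℚ.∣ (x i ℚ.+ y i) ℚ.- (x j ℚ.+ y j) ∣   ≡⟨ cong ℚ.∣_∣ (regroup (x i) (y i) (x j) (y j)) ⟩
      ℚ.∣ (x i ℚ.- x j) ℚ.+ (y i ℚ.- y j) ∣   ≤⟨ ℚ.∣p+q∣≤∣p∣+∣q∣ (x i ℚ.- x j) (y i ℚ.- y j) ⟩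
      ℚ.∣ x i ℚ.- x j ∣ ℚ.+ ℚ.∣ y i ℚ.- y j ∣ ≤⟨ ℚ.+-mono-≤
        (p i j (ℕ.m⊔n≤o⇒m≤o M N i≥) (ℕ.m⊔n≤o⇒m≤o M N j≥))
        (q i j (ℕ.m⊔n≤o⇒n≤o M N i≥) (ℕ.m⊔n≤o⇒n≤o M N j≥)) ⟩
      ½ ℚ.* δ ℚ.+ ½ ℚ.* δ                     ≡⟨ halves δ ⟩
      δ ∎
    where
    open ℚ.≤-Reasoning
    regroup : ∀ a b c d → (a ℚ.+ b) ℚ.- (c ℚ.+ d) ≡ (a ℚ.- c) ℚ.+ (b ℚ.- d)
    regroup = solve 4 (λ a b c d → (a :+ b) :- (c :+ d) := (a :- c) :+ (b :- d)) refl
      where open +-*-Solver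

  bounded : ∀ x → IsCauchy x →
    ∃ λ b → 0ℚ ℚ.< b × Eventually λ i → ℚ.∣ x i ∣ ℚ.≤ b
  bounded x cx =
    let N , p = cx 1ℚ (ℚ.positive⁻¹ 1ℚ)
    in 1ℚ ℚ.+ ℚ.∣ x N ∣
     , ℚ.<-≤-trans (ℚ.positive⁻¹ 1ℚ)
         (subst (ℚ._≤ 1ℚ ℚ.+ ℚ.∣ x N ∣) (ℚ.+-identityʳ 1ℚ) (ℚ.+-monoʳ-≤ 1ℚ (ℚ.0≤∣p∣ (x N))))
     , N , λ i i≥ → begin
       ℚ.∣ x i ∣                          ≡⟨ cong ℚ.∣_∣ (split (x i) (x N)) ⟩
       ℚ.∣ (x i ℚ.- x N) ℚ.+ x N ∣        ≤⟨ ℚ.∣p+q∣≤∣p∣+∣q∣ (x i ℚ.- x N) (x N) ⟩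
       ℚ.∣ x i ℚ.- x N ∣ ℚ.+ ℚ.∣ x N ∣    ≤⟨ ℚ.+-monoˡ-≤ ℚ.∣ x N ∣ (p i N i≥ ℕ.≤-refl) ⟩
       1ℚ ℚ.+ ℚ.∣ x N ∣ ∎
    where
    open ℚ.≤-Reasoning
    split : ∀ a b → a ≡ (a ℚ.- b) ℚ.+ b
    split = solve 2 (λ a b → a := (a :- b) :+ b) refl
      where open +-*-Solver

  -- For b, δ > 0 there is η > 0 with b η = δ / 2.
  share : ∀ {b δ} → 0ℚ ℚ.< b → 0ℚ ℚ.< δ → ∃ λ η → 0ℚ ℚ.< η × b ℚ.* η ≡ ½ ℚ.* δ
  share {b} {δ} 0<b 0<δ = ℚ.1/ b ℚ.* (½ ℚ.* δ)
    , subst (ℚ._< ℚ.1/ b ℚ.* (½ ℚ.* δ)) (ℚ.*-zeroʳ (ℚ.1/ b))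
        (ℚ.*-monoʳ-<-pos (ℚ.1/ b) {{ℚ.1/pos⇒pos b}} (half-pos 0<δ))
    , trans (sym (ℚ.*-assoc b (ℚ.1/ b) (½ ℚ.* δ)))
        (trans (cong (ℚ._* (½ ℚ.* δ)) (ℚ.*-inverseʳ b)) (ℚ.*-identityˡ (½ ℚ.* δ)))
    where instance
      b-pos = ℚ.positive 0<b
      b-nz  = ℚ.pos⇒nonZero b

  ∣*∣-mono : ∀ p q {b c} → ℚ.∣ p ∣ ℚ.≤ b → ℚ.∣ q ∣ ℚ.≤ c → 0ℚ ℚ.< b →
    ℚ.∣ p ℚ.* q ∣ ℚ.≤ b ℚ.* c
  ∣*∣-mono p q {b} {c} p≤b q≤c 0<b = begin
    ℚ.∣ p ℚ.* q ∣         ≡⟨ ℚ.∣p*q∣≡∣p∣*∣q∣ p q ⟩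
    ℚ.∣ p ∣ ℚ.* ℚ.∣ q ∣   ≤⟨ ℚ.*-monoʳ-≤-nonNeg ℚ.∣ q ∣ {{ℚ.∣-∣-nonNeg q}} p≤b ⟩
    b ℚ.* ℚ.∣ q ∣         ≤⟨ ℚ.*-monoˡ-≤-nonNeg b {{ℚ.nonNegative (ℚ.<⇒≤ 0<b)}} q≤c ⟩
    b ℚ.* c ∎
    where open ℚ.≤-Reasoning

  *-cauchy : ∀ x y → IsCauchy x → IsCauchy y → IsCauchy λ i → x i ℚ.* y i
  *-cauchy x y cx cy δ 0<δ =
    let b , 0<b , K , bx = bounded x cx
        c , 0<c , L , by = bounded y cy
        η , 0<η , bη = share 0<b 0<δ
        θ , 0<θ , cθ = share 0<c 0<δ
        M , p = cx θ 0<θ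
        N , q = cy η 0<η
        K≤ = ℕ.≤-trans (ℕ.m≤m⊔n K L) (ℕ.m≤m⊔n (K ℕ.⊔ L) (M ℕ.⊔ N))
        L≤ = ℕ.≤-trans (ℕ.m≤n⊔m K L) (ℕ.m≤m⊔n (K ℕ.⊔ L) (M ℕ.⊔ N))
        M≤ = ℕ.≤-trans (ℕ.m≤m⊔n M N) (ℕ.m≤n⊔m (K ℕ.⊔ L) (M ℕ.⊔ N))
        N≤ = ℕ.≤-trans (ℕ.m≤n⊔m M N) (ℕ.m≤n⊔m (K ℕ.⊔ L) (M ℕ.⊔ N))
    in (K ℕ.⊔ L) ℕ.⊔ (M ℕ.⊔ N) , λ i j i≥ j≥ → begin
      ℚ.∣ x i ℚ.* y i ℚ.- x j ℚ.* y j ∣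
        ≡⟨ cong ℚ.∣_∣ (regroup (x i) (y i) (x j) (y j)) ⟩
      ℚ.∣ x i ℚ.* (y i ℚ.- y j) ℚ.+ y j ℚ.* (x i ℚ.- x j) ∣
        ≤⟨ ℚ.∣p+q∣≤∣p∣+∣q∣ (x i ℚ.* (y i ℚ.- y j)) (y j ℚ.* (x i ℚ.- x j)) ⟩
      ℚ.∣ x i ℚ.* (y i ℚ.- y j) ∣ ℚ.+ ℚ.∣ y j ℚ.* (x i ℚ.- x j) ∣
        ≤⟨ ℚ.+-mono-≤
          (∣*∣-mono (x i) (y i ℚ.- y j) (bx i (ℕ.≤-trans K≤ i≥)) (q i j (ℕ.≤-trans N≤ i≥) (ℕ.≤-trans N≤ j≥)) 0<b)
          (∣*∣-mono (y j) (x i ℚ.- x j) (by j (ℕ.≤-trans L≤ j≥)) (p i j (ℕ.≤-trans M≤ i≥) (ℕ.≤-trans M≤ j≥)) 0<c) ⟩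
      b ℚ.* η ℚ.+ c ℚ.* θ
        ≡⟨ cong₂ ℚ._+_ bη cθ ⟩
      ½ ℚ.* δ ℚ.+ ½ ℚ.* δ
        ≡⟨ halves δ ⟩
      δ ∎
    where
    open ℚ.≤-Reasoning
    regroup : ∀ a b c d → a ℚ.* b ℚ.- c ℚ.* d ≡ a ℚ.* (b ℚ.- d) ℚ.+ d ℚ.* (a ℚ.- c)
    regroup = solve 4 (λ a b c d → a :* b :- c :* d := a :* (b :- d) :+ d :* (a :- c)) refl
      where open +-*-Solver

infixl 6 _+ᴿ_
infixl 7 _*ᴿ_

_+ᴿ_ : ℝ → ℝ → ℝ
x +ᴿ y = mkℝ (λ i → approx x i ℚ.+ approx y i) (+-cauchy (approx x) (approx y) (cauchy x) (cauchy y))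

_*ᴿ_ : ℝ → ℝ → ℝ
x *ᴿ y = mkℝ (λ i → approx x i ℚ.* approx y i) (*-cauchy (approx x) (approx y) (cauchy x) (cauchy y))

------------------------------------------------------------------------
-- The natural logarithm of a positive integer

-- reciprocals a l = 1/(a+1) + 1/(a+2) + ⋯ + 1/(a+l)
reciprocals : ℕ → ℕ → ℚ
reciprocals a zero    = 0ℚ
reciprocals a (suc l) = + 1 / suc a ℚ.+ reciprocals (suc a) l

-- With k = i + 1, this is the Riemann sum of ∫₁ⁿ dt/t over steps of
-- length 1/k with left endpoints:  ∑_{j=k}^{nk-1} (1/k) · 1/(j/k) = ∑_{j=k}^{nk-1} 1/j.
logApprox : ℕ → ℕ → ℚ
logApprox n i = reciprocals i ((n ℕ.∸ 1) ℕ.* suc i)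

private
  inv : ℕ → ℚ
  inv a = + 1 / suc a

  inv≥0 : ∀ a → 0ℚ ℚ.≤ inv a
  inv≥0 a = ℚ.nonNegative⁻¹ (inv a) {{ℚ.normalize-nonNeg 1 (suc a)}}

  inv-antimono : ∀ {a b} → a ℕ.≤ b → inv b ℚ.≤ inv a
  inv-antimono {a} {b} a≤b = ℚ.toℚᵘ-cancel-≤
    (ℚᵘ.≤-trans (ℚᵘ.≤-reflexive (ℚ.toℚᵘ-fromℚᵘ (mkℚᵘ (+ 1) b)))
    (ℚᵘ.≤-trans (*≤* (ℤ.*-monoˡ-≤-nonNeg (+ 1) (ℤ.+≤+ (ℕ.s≤s a≤b))))
    (ℚᵘ.≤-reflexive (ℚᵘ.≃-sym (ℚ.toℚᵘ-fromℚᵘ (mkℚᵘ (+ 1) a))))))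

  inv-small : ∀ δ → 0ℚ ℚ.< δ → Eventually λ i → inv i ℚ.≤ δ
  inv-small (mkℚ +[1+ n ] d c) _ = d , λ i d≤i → ℚ.≤-trans (inv-antimono d≤i)
    (ℚ.toℚᵘ-cancel-≤
      (ℚᵘ.≤-trans (ℚᵘ.≤-reflexive (ℚ.toℚᵘ-fromℚᵘ (mkℚᵘ (+ 1) d)))
        (*≤* (ℤ.*-monoʳ-≤-nonNeg (+ suc d) {+ 1} {+ suc n} (ℤ.+≤+ (ℕ.s≤s ℕ.z≤n))))))
  inv-small (mkℚ (+ 0) d c) (ℚ.*<* (ℤ.+<+ ()))
  inv-small (mkℚ (ℤ.-[1+ n ]) d c) (ℚ.*<* ())

  -- c copies of 1/(ac) add up to 1/a, where a = a' + 1 and c = c' + 1.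
  copies : ∀ a′ c′ → (+ suc c′ / 1) ℚ.* inv (c′ ℕ.+ a′ ℕ.* suc c′) ≡ inv a′
  copies a′ c′ = ℚ.toℚᵘ-injective
    (ℚᵘ.≃-trans (ℚ.toℚᵘ-homo-* (+ suc c′ / 1) (inv (c′ ℕ.+ a′ ℕ.* suc c′)))
    (ℚᵘ.≃-trans (ℚᵘ.*-cong (ℚ.toℚᵘ-fromℚᵘ (mkℚᵘ (+ suc c′) 0))
                           (ℚ.toℚᵘ-fromℚᵘ (mkℚᵘ (+ 1) (c′ ℕ.+ a′ ℕ.* suc c′))))
    (ℚᵘ.≃-trans (*≡* (cong +_ (lemma a′ c′)))
    (ℚᵘ.≃-sym (ℚ.toℚᵘ-fromℚᵘ (mkℚᵘ (+ 1) a′))))))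
    where
    lemma : ∀ a c → suc c ℕ.* 1 ℕ.* suc a ≡ 1 ℕ.* (1 ℕ.* suc (c ℕ.+ a ℕ.* suc c))
    lemma = solve 2 (λ a c → (con 1 :+ c) :* con 1 :* (con 1 :+ a)
        := con 1 :* (con 1 :* (con 1 :+ (c :+ a :* (con 1 :+ c))))) refl
      where open ℕSolver.+-*-Solver

  suc-* : ∀ c q → (+ suc c / 1) ℚ.* q ≡ q ℚ.+ (+ c / 1) ℚ.* q
  suc-* c q = trans (cong (ℚ._* q) (ℚ.toℚᵘ-injective
      (ℚᵘ.≃-trans (ℚ.toℚᵘ-fromℚᵘ (mkℚᵘ (+ suc c) 0))
      (ℚᵘ.≃-trans (*≡* (lemma c))
      (ℚᵘ.≃-sym (ℚᵘ.≃-trans (ℚ.toℚᵘ-homo-+ 1ℚ (+ c / 1))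
        (ℚᵘ.+-congʳ (toℚᵘ 1ℚ) (ℚ.toℚᵘ-fromℚᵘ (mkℚᵘ (+ c) 0)))))))))
    (trans (ℚ.*-distribʳ-+ q 1ℚ (+ c / 1))
      (cong (ℚ._+ (+ c / 1) ℚ.* q) (ℚ.*-identityˡ q)))
    where
    lemma : ∀ c → + suc c ℤ.* + 1 ≡ (+ 1 ℤ.+ + c ℤ.* + 1) ℤ.* + 1
    lemma c = trans (ℤ.*-identityʳ (+ suc c)) (sym
      (trans (ℤ.*-identityʳ (+ 1 ℤ.+ + c ℤ.* + 1)) (cong (λ z → + 1 ℤ.+ z) (ℤ.*-identityʳ (+ c)))))

  split : ∀ a l m → reciprocals a (l ℕ.+ m) ≡ reciprocals a l ℚ.+ reciprocals (l ℕ.+ a) m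
  split a zero    m = sym (ℚ.+-identityˡ (reciprocals a m))
  split a (suc l) m = trans
    (cong (inv a ℚ.+_) (trans (split (suc a) l m)
      (cong (λ z → reciprocals (suc a) l ℚ.+ reciprocals z m) (ℕ.+-suc l a))))
    (sym (ℚ.+-assoc (inv a) (reciprocals (suc a) l) (reciprocals (suc l ℕ.+ a) m)))

  upper : ∀ {b} a c → b ℕ.≤ a → reciprocals a c ℚ.≤ (+ c / 1) ℚ.* inv b
  upper {b} a zero    _   = ℚ.≤-reflexive (sym (ℚ.*-zeroˡ (inv b)))
  upper {b} a (suc c) b≤a = ℚ.≤-trans
    (ℚ.+-mono-≤ (inv-antimono b≤a) (upper (suc a) c (ℕ.m≤n⇒m≤1+n b≤a)))
    (ℚ.≤-reflexive (sym (suc-* c (inv b))))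

  lower : ∀ {b} a c → c ℕ.+ a ℕ.≤ b → (+ c / 1) ℚ.* inv b ℚ.≤ reciprocals a c
  lower {b} a zero    _ = ℚ.≤-reflexive (ℚ.*-zeroˡ (inv b))
  lower {b} a (suc c) h = ℚ.≤-trans
    (ℚ.≤-reflexive (suc-* c (inv b)))
    (ℚ.+-mono-≤ (inv-antimono (ℕ.≤-trans (ℕ.m≤n+m a (suc c)) h))
      (lower (suc a) c (subst (ℕ._≤ b) (sym (ℕ.+-suc c a)) h)))

  next : ∀ a c′ → suc c′ ℕ.+ (c′ ℕ.+ a ℕ.* suc c′) ≡ c′ ℕ.+ suc a ℕ.* suc c′
  next = solve 2 (λ a c → (con 1 :+ c) :+ (c :+ a :* (con 1 :+ c))
      := c :+ (con 1 :+ a) :* (con 1 :+ c)) refl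
    where open ℕSolver.+-*-Solver

  refine-upper : ∀ a c′ l → reciprocals (c′ ℕ.+ a ℕ.* suc c′) (l ℕ.* suc c′) ℚ.≤ reciprocals a l
  refine-upper a c′ zero    = ℚ.≤-refl
  refine-upper a c′ (suc l) = begin
    reciprocals s (suc c′ ℕ.+ l ℕ.* suc c′)
      ≡⟨ split s (suc c′) (l ℕ.* suc c′) ⟩
    reciprocals s (suc c′) ℚ.+ reciprocals (suc c′ ℕ.+ s) (l ℕ.* suc c′)
      ≡⟨ cong (λ z → reciprocals s (suc c′) ℚ.+ reciprocals z (l ℕ.* suc c′)) (next a c′) ⟩
    reciprocals s (suc c′) ℚ.+ reciprocals (c′ ℕ.+ suc a ℕ.* suc c′) (l ℕ.* suc c′)
      ≤⟨ ℚ.+-mono-≤ (upper s (suc c′) ℕ.≤-refl) (refine-upper (suc a) c′ l) ⟩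
    (+ suc c′ / 1) ℚ.* inv s ℚ.+ reciprocals (suc a) l
      ≡⟨ cong (ℚ._+ reciprocals (suc a) l) (copies a c′) ⟩
    inv a ℚ.+ reciprocals (suc a) l ∎
    where
    open ℚ.≤-Reasoning
    s = c′ ℕ.+ a ℕ.* suc c′

  refine-lower : ∀ a c′ l → reciprocals (suc a) l ℚ.≤ reciprocals (c′ ℕ.+ a ℕ.* suc c′) (l ℕ.* suc c′)
  refine-lower a c′ zero    = ℚ.≤-refl
  refine-lower a c′ (suc l) = begin
    inv (suc a) ℚ.+ reciprocals (2 ℕ.+ a) l
      ≡⟨ cong (ℚ._+ reciprocals (2 ℕ.+ a) l) (sym (copies (suc a) c′)) ⟩
    (+ suc c′ / 1) ℚ.* inv t ℚ.+ reciprocals (2 ℕ.+ a) l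
      ≤⟨ ℚ.+-mono-≤ (lower s (suc c′) (ℕ.≤-reflexive (next a c′))) (refine-lower (suc a) c′ l) ⟩
    reciprocals s (suc c′) ℚ.+ reciprocals t (l ℕ.* suc c′)
      ≡⟨ cong (λ z → reciprocals s (suc c′) ℚ.+ reciprocals z (l ℕ.* suc c′)) (sym (next a c′)) ⟩
    reciprocals s (suc c′) ℚ.+ reciprocals (suc c′ ℕ.+ s) (l ℕ.* suc c′)
      ≡⟨ sym (split s (suc c′) (l ℕ.* suc c′)) ⟩
    reciprocals s (suc c′ ℕ.+ l ℕ.* suc c′) ∎
    where
    open ℚ.≤-Reasoning
    s = c′ ℕ.+ a ℕ.* suc c′
    t = c′ ℕ.+ suc a ℕ.* suc c′

  shift : ∀ a l → reciprocals a l ℚ.≤ inv a ℚ.+ reciprocals (suc a) l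
  shift a zero    = ℚ.≤-trans (inv≥0 a) (ℚ.≤-reflexive (sym (ℚ.+-identityʳ (inv a))))
  shift a (suc l) = ℚ.+-monoʳ-≤ (inv a) (shift (suc a) l)

  -- Compare the subdivisions with k and l steps per unit through their common
  -- refinement with kl steps, where k = i + 1 and l = j + 1.
  compare : ∀ n i j → logApprox n i ℚ.≤ inv i ℚ.+ logApprox n j
  compare n i j = ℚ.≤-trans (shift i (M ℕ.* suc i)) (ℚ.+-monoʳ-≤ (inv i)
    (ℚ.≤-trans (refine-lower i j (M ℕ.* suc i))
    (ℚ.≤-trans (ℚ.≤-reflexive (cong₂ reciprocals (start i j) (len M i j)))
    (refine-upper j i (M ℕ.* suc j)))))
    where
    M = n ℕ.∸ 1
    start : ∀ i j → j ℕ.+ i ℕ.* suc j ≡ i ℕ.+ j ℕ.* suc i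
    start = solve 2 (λ i j → j :+ i :* (con 1 :+ j) := i :+ j :* (con 1 :+ i)) refl
      where open ℕSolver.+-*-Solver
    len : ∀ M i j → M ℕ.* suc i ℕ.* suc j ≡ M ℕ.* suc j ℕ.* suc i
    len = solve 3 (λ M i j → M :* (con 1 :+ i) :* (con 1 :+ j)
        := M :* (con 1 :+ j) :* (con 1 :+ i)) refl
      where open ℕSolver.+-*-Solver

  move : ∀ {p q r} → p ℚ.≤ r ℚ.+ q → p ℚ.- q ℚ.≤ r
  move {p} {q} {r} h = ℚ.≤-trans (ℚ.+-monoˡ-≤ (ℚ.- q) h) (ℚ.≤-reflexive (cancel r q))
    where
    cancel : ∀ r q → r ℚ.+ q ℚ.- q ≡ r
    cancel = solve 2 (λ r q → r :+ q :- q := r) refl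
      where open +-*-Solver

  distance : ∀ {p q r} → p ℚ.≤ r ℚ.+ q → q ℚ.≤ r ℚ.+ p → ℚ.∣ p ℚ.- q ∣ ℚ.≤ r
  distance {p} {q} {r} h k with ℚ.∣p∣≡p∨∣p∣≡-p (p ℚ.- q)
  ... | inj₁ e = ℚ.≤-trans (ℚ.≤-reflexive e) (move h)
  ... | inj₂ e = ℚ.≤-trans (ℚ.≤-reflexive (trans e (flip p q))) (move k)
    where
    flip : ∀ p q → ℚ.- (p ℚ.- q) ≡ q ℚ.- p
    flip = solve 2 (λ p q → :- (p :- q) := q :- p) refl
      where open +-*-Solver

  log-cauchy : ∀ n → IsCauchy (logApprox n)
  log-cauchy n δ 0<δ =
    let N , h = inv-small δ 0<δ
    in N , λ i j i≥ j≥ → distance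
      (ℚ.≤-trans (compare n i j) (ℚ.+-monoˡ-≤ (logApprox n j) (h i i≥)))
      (ℚ.≤-trans (compare n j i) (ℚ.+-monoˡ-≤ (logApprox n i) (h j j≥)))

-- log n = ∫₁ⁿ dt/t for n ≥ 1;  log 0 is the junk value 0.
log : ℕ → ℝ
log n = mkℝ (logApprox n) (log-cauchy n)

------------------------------------------------------------------------
-- Finite probability distributions

-- A finite list of outcomes with their weights; an outcome may be listed
-- several times, its probability being the sum of the weights.
Dist : Set ℓ → Set ℓ
Dist A = List (A × ℚ)

always : A → Dist A
always x = (x , 1ℚ) ∷ []

infixl 1 _>>=_

_>>=_ : Dist A → (A → Dist B) → Dist B
d >>= f = concatMap (λ (x , p) → map (λ (y , q) → y , p ℚ.* q) (f x)) d

-- The uniform choice of an entry of a nonempty list.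
uniform : List A → Dist A
uniform []         = []
uniform xs@(_ ∷ _) = map (λ x → x , + 1 / length xs) xs

Pr : Dist A → {E : Pred A 0ℓ} → Decidable E → ℚ
Pr d E? = foldr ℚ._+_ 0ℚ (map proj₂ (filter (E? ∘ proj₁) d))

-- Probability tending to 1.  A property P of the outcomes need not be
-- decidable, so "P holds with probability at least q" is rendered as: some
-- decidable event of probability at least q implies P.
WithHighProbability : {Ω : ℕ → Set} → (∀ n → Dist (Ω n)) → (∀ n → Ω n → Set ℓ) → Set _
WithHighProbability {Ω = Ω} d P = ∀ δ → 0ℚ ℚ.< δ → Eventually λ n →
  Σ (Pred (Ω n) 0ℓ) λ E → Σ (Decidable E) λ E? →
    (∀ ω → E ω → P n ω) × 1ℚ ℚ.- δ ℚ.≤ Pr (d n) E?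

------------------------------------------------------------------------
-- Graphs

-- Finite simple graphs whose vertex set is a subset of Fin n.
record Graph (n : ℕ) : Set₁ where
  field
    vertices : Subset n
    Adj      : Rel (Fin n) 0ℓ
    adj?     : Binary.Decidable Adj
    adj-sym  : Binary.Symmetric Adj
    adj-irr  : ∀ {v} → ¬ Adj v v
    adj-∈    : ∀ {u v} → Adj u v → u ∈ vertices

open Graph public

module _ {n : ℕ} where

  deg : Graph n → Fin n → ℕ
  deg G v = length (filter (adj? G v) (allFin n))

  SpanningSubgraph : Graph n → Graph n → Set
  SpanningSubgraph H G = vertices H ≡ vertices G × Adj H ⇒ Adj G

  _─_ : Graph n → Graph n → Graph n
  G ─ H = record
    { vertices = vertices G
    ; Adj      = λ u v → Adj G u v × ¬ Adj H u v
    ; adj?     = λ u v → adj? G u v ×-dec ¬? (adj? H u v)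
    ; adj-sym  = λ (g , h) → adj-sym G g , h ∘ adj-sym H
    ; adj-irr  = adj-irr G ∘ proj₁
    ; adj-∈    = adj-∈ G ∘ proj₁
    }

  induced : (G : Graph n) (C : Subset n) → Graph n
  induced G C = record
    { vertices = C
    ; Adj      = λ u v → Adj G u v × u ∈ C × v ∈ C
    ; adj?     = λ u v → adj? G u v ×-dec (u ∈? C) ×-dec (v ∈? C)
    ; adj-sym  = λ (g , u∈ , v∈) → adj-sym G g , v∈ , u∈
    ; adj-irr  = adj-irr G ∘ proj₁
    ; adj-∈    = proj₁ ∘ proj₂
    }

  Reachable : Graph n → Rel (Fin n) 0ℓ
  Reachable G = Star (Adj G)

  Connected : Graph n → Set
  Connected G = ∀ {u v} → u ∈ vertices G → v ∈ vertices G → Reachable G u v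

  IsComponent : Graph n → Subset n → Set
  IsComponent G C = ∃ λ u → u ∈ vertices G × (∀ v → v ∈ C ⇔ Reachable G u v)

  -- The giant of G is induced G C for such a C (which C is unspecified if
  -- several components tie for the largest size).
  IsLargestComponent : Graph n → Subset n → Set
  IsLargestComponent G C =
    IsComponent G C × (∀ D → IsComponent G D → ∣ D ∣ ℕ.≤ ∣ C ∣)

  record MonotoneProperty : Set₁ where
    field
      Holds : Graph n → Set
      mono  : ∀ {G G′} → SpanningSubgraph G G′ → Holds G → Holds G′

  open MonotoneProperty public

  connectivity : MonotoneProperty
  connectivity = record
    { Holds = Connected
    ; mono  = λ {_} {_} (V≡ , G⊆) conn u∈ v∈ →
        Star.map G⊆ (conn (subst (_ ∈_) (sym V≡) u∈) (subst (_ ∈_) (sym V≡) v∈))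
    }

  Resilient : ℝ → MonotoneProperty → Graph n → Set₁
  Resilient α P G = ∀ H → SpanningSubgraph H G →
    (∀ v → v ∈ vertices G → fromℕ (deg H v) ≤ᴿ α *ᴿ fromℕ (deg G v)) →
    Holds P (G ─ H)

------------------------------------------------------------------------
-- The random graph process

-- An unordered pair of distinct vertices, listed in increasing order.
record Edge (n : ℕ) : Set where
  constructor edge
  field
    lo hi  : Fin n
    .lo<hi : lo Fin.< hi

open Edge public

module _ {n : ℕ} where

  Joins : Edge n → Rel (Fin n) 0ℓ
  Joins e u v = (lo e ≡ u × hi e ≡ v) ⊎ (lo e ≡ v × hi e ≡ u)

  joins? : ∀ e → Binary.Decidable (Joins e)
  joins? e u v =
    ((lo e Fin.≟ u) ×-dec (hi e Fin.≟ v)) ⊎-dec ((lo e Fin.≟ v) ×-dec (hi e Fin.≟ u))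

  private
    joins-irr : ∀ e {v} → ¬ Joins e v v
    joins-irr (edge u _ u<u) (inj₁ (refl , refl)) = ⊥-elim-irr (Fin.<-irrefl refl u<u)
    joins-irr (edge u _ u<u) (inj₂ (refl , refl)) = ⊥-elim-irr (Fin.<-irrefl refl u<u)

  graphOf : List (Edge n) → Graph n
  graphOf es = record
    { vertices = ⊤
    ; Adj      = λ u v → Any (λ e → Joins e u v) es
    ; adj?     = λ u v → Any.any? (λ e → joins? e u v) es
    ; adj-sym  = Any.map Sum.swap
    ; adj-irr  = λ p → let e , j = Any.satisfied p in joins-irr e j
    ; adj-∈    = λ _ → ∈⊤
    }

allEdges : ∀ n → List (Edge n)
allEdges n = mapMaybe toEdge (cartesianProduct (allFin n) (allFin n))
  where
  toEdge : Fin n × Fin n → Maybe (Edge n)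
  toEdge (u , v) with u Fin.<? v
  ... | yes u<v = just (edge u v u<v)
  ... | no  _   = nothing

missing : ∀ {n} → List (Edge n) → List (Edge n)
missing es = filter (λ e → ¬? (adj? (graphOf es) (lo e) (hi e))) (allEdges _)

-- The first i edges of the process, in order of arrival.
processUpTo : ∀ n → ℕ → Dist (List (Edge n))
processUpTo n zero    = always []
processUpTo n (suc i) =
  processUpTo n i >>= λ es → uniform (missing es) >>= λ e → always (es ∷ʳ e)

-- An outcome lists all n C 2 edges in order of arrival, and so determines
-- the whole sequence of graphs.
randomGraphProcess : ∀ n → Dist (List (Edge n))
randomGraphProcess n = processUpTo n (n C 2)

-- Gₘ
graphAt : ∀ {n} → List (Edge n) → ℕ → Graph n
graphAt ω m = graphOf (take m ω)

{-# OPTIONS --safe #-}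
module Submission where

-- Call a vertex low if its degree is at most a constant D, and high otherwise. If no vertex has k low
-- neighbours, Stiebitz’ theorem on the high vertices of the giant splits them into two nonempty sides
-- such that each keeps nearly half of its degree on its own side; the low vertices are then placed so
-- as to minimise the cut, hence keep half of theirs. Deleting the edges across the cut disconnects
-- the giant. The only obstruction is a tree all of whose vertices but the root are low, with k of
-- them: a star for the condition on neighbours, and an arbitrary tree if the giant has no high vertex.
--
-- A given tree with k low children occurs in Gₘ with probability at most K n^(-k) (1 - Ω(k / n))^m,
-- by an exponentially tilted count of edge sequences. There are at most n (kn)^k trees and n² values of
-- m, so for a large constant k the bound m ≥ m₀ ≥ (n log n) / 6 beats the union bound.

open import Defs
open import Data.Empty using (⊥; ⊥-elim; ⊥-elim-irr)
open import Data.Fin.Base as Fin using (Fin)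
open import Data.Fin.Properties as Fin using (_≟_)
open import Data.Fin.Subset using (Subset; Nonempty; inside; outside; ∣_∣; _⊂_; _⊃_) renaming (_∈_ to _∈ˢ_; _∉_ to _∉ˢ_; _⊆_ to _⊆ˢ_)
open import Data.Fin.Subset.Induction using (⊂-wellFounded; ⊃-wellFounded; Acc; acc)
open import Data.Fin.Subset.Properties using (_∈?_; _⊆?_; nonempty?; anySubset?; ∈⊤)
import Data.Integer.Base as ℤ
import Data.Integer.Properties as ℤ
open import Data.List.Base using (List; []; _∷_; _++_; _∷ʳ_; map; concatMap; mapMaybe; filter; length; allFin; take; cartesianProduct; upTo)
import Data.List.Membership.DecPropositional as DecMembership
open import Data.List.Membership.Propositional using (_∈_; _∉_; lose)
open import Data.List.Membership.Propositional.Properties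
  using (∈-∃++; ∈-++⁻; ∈-++⁺ˡ; ∈-++⁺ʳ; ∈-allFin; ∈-map⁻; ∈-map⁺; ∈-filter⁺; ∈-filter⁻; ∈-concatMap⁺; ∈-cartesianProduct⁺; ∈-cartesianProduct⁻; ∈-upTo⁺; ∈-upTo⁻)
open import Data.List.Properties using (length-++; length-map; length-take; length-tabulate; length-upTo; map-tabulate; map-∘; map-id; map-++; take-all)
open import Data.List.Relation.Unary.All as All using (All; []; _∷_)
import Data.List.Relation.Unary.All.Properties as All
open import Data.List.Relation.Unary.AllPairs using ([]; _∷_)
open import Data.List.Relation.Unary.Any as Any using (Any; here; there)
import Data.List.Relation.Unary.Any.Properties as Any
import Data.List.Relation.Unary.Unique.DecPropositional as DecUnique
open import Data.List.Relation.Unary.Unique.Propositional using (Unique)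
open import Data.List.Relation.Unary.Unique.Propositional.Properties as Unique using (allFin⁺; take⁺; filter⁺; Unique[x∷xs]⇒x∉xs)
open import Data.Maybe.Base using (Maybe; just; nothing)
open import Data.Nat.Base as ℕ hiding (_/_)
open import Data.Nat.Combinatorics using (_C_; nC1≡n; nCk+nC[k+1]≡[n+1]C[k+1])
open import Data.Nat.DivMod using (m≡m%n+[m/n]*n; m%n<n)
open import Data.Nat.Induction using (<-wellFounded)
open import Data.Nat.Properties as ℕ hiding (_≟_)
open import Data.Nat.Solver using (module +-*-Solver)
open import Data.Product.Base using (∃; ∃₂; _×_; _,_; proj₁; proj₂)
open import Data.Rational.Base as ℚ using (ℚ; mkℚ; 0ℚ; 1ℚ; ½)
import Data.Rational.Properties as ℚ
import Data.Rational.Solver as ℚSolver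
open import Data.Rational.Unnormalised.Base as ℚᵘ using (mkℚᵘ; *≡*; *≤*)
import Data.Rational.Unnormalised.Properties as ℚᵘ
open import Data.Sum.Base using (_⊎_; inj₁; inj₂; [_,_]′)
open import Data.Unit.Base using (⊤; tt)
open import Data.Vec.Base as Vec using (tabulate)
open import Data.Vec.Properties using (lookup⇒[]=; []=⇒lookup; lookup∘tabulate)
open import Function.Base using (_∘_; id)
open import Function.Bundles using (Equivalence; mk⇔)
open import Level using (Level; 0ℓ)
open import Relation.Binary.Construct.Closure.ReflexiveTransitive as Star using (_◅_; _◅◅_)
open import Relation.Binary.Core using (Rel)
open import Relation.Binary.Definitions using (tri<; tri≈; tri>)
open import Relation.Binary.PropositionalEquality using (_≡_; _≢_; refl; sym; trans; cong; cong₂; subst; module ≡-Reasoning)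
open import Relation.Nullary.Decidable using (Dec; yes; no; does; map′; _×-dec_; _⊎-dec_; _→-dec_; ¬?; dec-true; decidable-stable; ¬¬-excluded-middle)
open import Relation.Nullary.Negation using (¬_; contradiction)
open import Relation.Unary using (Pred; Decidable)

-- Stiebitz' theorem costs each vertex an additive constant by rounding, and the placement of the
-- low vertices can cost it fewer than `k` further edges. A vertex of small degree cannot afford
-- this when ε is small; this is why the low vertices need an exact half and are placed last. A
-- vertex of degree above `D = suc q * (k + 2)` can afford it once `1 / suc q` is at most ε. A
-- minimum cut alone would be trivial: the high vertices, fixed on both sides beforehand, keep both
-- sides of the giant nonempty.
--
-- In the union bound the factor n^(-k) only cancels the choices of the children, up to a constant.
-- Choices of root and time remain, at most n³ in number; the decay over `m₀` steps reaches order
-- n^(-4) for `k = 8 * 96`, and the spare factor n absorbs every constant. Probabilities are numbers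
-- of edge sequences, with all denominators cleared, so that the estimates take place in ℕ.

private
  variable
    ℓ₁ ℓ₂ ℓ₃ : Level
    α : Set ℓ₁
    β : Set ℓ₂
    φ : Set ℓ₁
    ψ : Set ℓ₂
    χ : Set ℓ₃
    n : ℕ

-- Finite sums and indicators

∑ : List α → (α → ℕ) → ℕ
∑ []       f = 0
∑ (x ∷ xs) f = f x + ∑ xs f

syntax ∑ xs (λ x → e) = ∑[ x ← xs ] e
infixr 8 ∑

⟦_⟧ : Dec φ → ℕ
⟦ yes _ ⟧ = 1
⟦ no  _ ⟧ = 0

⟦⟧≤1 : (P? : Dec φ) → ⟦ P? ⟧ ≤ 1
⟦⟧≤1 (yes _) = ≤-refl
⟦⟧≤1 (no _)  = z≤n

⟦⟧-yes : (P? : Dec φ) → φ → ⟦ P? ⟧ ≡ 1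
⟦⟧-yes (yes _) _ = refl
⟦⟧-yes (no ¬p) p = contradiction p ¬p

⟦⟧-no : (P? : Dec φ) → ¬ φ → ⟦ P? ⟧ ≡ 0
⟦⟧-no (yes p) ¬p = contradiction p ¬p
⟦⟧-no (no _)  _  = refl

⟦⟧>0 : (P? : Dec φ) → 0 < ⟦ P? ⟧ → φ
⟦⟧>0 (yes p) _ = p

⟦⟧-mono : (P? : Dec φ) (Q? : Dec ψ) → (φ → ψ) → ⟦ P? ⟧ ≤ ⟦ Q? ⟧
⟦⟧-mono (yes p) Q? f = ≤-reflexive (sym (⟦⟧-yes Q? (f p)))
⟦⟧-mono (no _)  Q? f = z≤n

⟦⟧-cong : (P? : Dec φ) (Q? : Dec ψ) → (φ → ψ) → (ψ → φ) → ⟦ P? ⟧ ≡ ⟦ Q? ⟧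
⟦⟧-cong P? Q? f g = ≤-antisym (⟦⟧-mono P? Q? f) (⟦⟧-mono Q? P? g)

⟦⟧-cover : (P? : Dec φ) (Q? : Dec ψ) (R? : Dec χ) → (φ → ψ ⊎ χ) → ⟦ P? ⟧ ≤ ⟦ Q? ⟧ + ⟦ R? ⟧
⟦⟧-cover (no _)  Q? R? f = z≤n
⟦⟧-cover (yes p) Q? R? f with f p
... | inj₁ q = ≤-trans (≤-reflexive (sym (⟦⟧-yes Q? q))) (m≤m+n _ _)
... | inj₂ r = ≤-trans (≤-reflexive (sym (⟦⟧-yes R? r))) (m≤n+m _ _)

⟦⟧-disjoint : (P? : Dec φ) (Q? : Dec ψ) (R? : Dec χ) →
  (ψ → φ) → (χ → φ) → ¬ (ψ × χ) → ⟦ Q? ⟧ + ⟦ R? ⟧ ≤ ⟦ P? ⟧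
⟦⟧-disjoint P? (yes q) (yes r) f g ¬qr = contradiction (q , r) ¬qr
⟦⟧-disjoint P? (yes q) (no _)  f g ¬qr = ≤-reflexive (sym (⟦⟧-yes P? (f q)))
⟦⟧-disjoint P? (no _)  R?      f g ¬qr = ⟦⟧-mono R? P? g

∑-mono : ∀ (xs : List α) {f g : α → ℕ} → (∀ x → f x ≤ g x) → ∑ xs f ≤ ∑ xs g
∑-mono []       f≤g = z≤n
∑-mono (x ∷ xs) f≤g = +-mono-≤ (f≤g x) (∑-mono xs f≤g)

∑-mono-All : ∀ {xs : List α} {f g : α → ℕ} → All (λ x → f x ≤ g x) xs → ∑ xs f ≤ ∑ xs g
∑-mono-All []       = z≤n
∑-mono-All (p ∷ ps) = +-mono-≤ p (∑-mono-All ps)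

∑-cong : ∀ (xs : List α) {f g : α → ℕ} → (∀ x → f x ≡ g x) → ∑ xs f ≡ ∑ xs g
∑-cong []       f≡g = refl
∑-cong (x ∷ xs) f≡g = cong₂ _+_ (f≡g x) (∑-cong xs f≡g)

∑-+ : ∀ (xs : List α) (f g : α → ℕ) → ∑[ x ← xs ] (f x + g x) ≡ ∑ xs f + ∑ xs g
∑-+ []       f g = refl
∑-+ (x ∷ xs) f g = trans (cong (f x + g x +_) (∑-+ xs f g)) (interchange (f x) (g x) (∑ xs f) (∑ xs g))
  where
  interchange : ∀ p q r s → p + q + (r + s) ≡ p + r + (q + s)
  interchange = solve 4 (λ p q r s → p :+ q :+ (r :+ s) := p :+ r :+ (q :+ s)) refl
    where open +-*-Solver

∑-*ˡ : ∀ (xs : List α) c (f : α → ℕ) → ∑[ x ← xs ] (c * f x) ≡ c * ∑ xs f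
∑-*ˡ []       c f = sym (*-zeroʳ c)
∑-*ˡ (x ∷ xs) c f = trans (cong (c * f x +_) (∑-*ˡ xs c f)) (sym (*-distribˡ-+ c (f x) (∑ xs f)))

∑-const : ∀ (xs : List α) c → ∑[ _ ← xs ] c ≡ length xs * c
∑-const []       c = refl
∑-const (x ∷ xs) c = cong (c +_) (∑-const xs c)

∑-swap : ∀ (xs : List α) (ys : List β) (f : α → β → ℕ) →
  ∑[ x ← xs ] ∑[ y ← ys ] f x y ≡ ∑[ y ← ys ] ∑[ x ← xs ] f x y
∑-swap []       ys f = sym (trans (∑-const ys 0) (*-zeroʳ (length ys)))
∑-swap (x ∷ xs) ys f = trans (cong (∑ ys (f x) +_) (∑-swap xs ys f)) (sym (∑-+ ys (f x) _))

∑-++ : ∀ (xs ys : List α) (f : α → ℕ) → ∑ (xs ++ ys) f ≡ ∑ xs f + ∑ ys f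
∑-++ []       ys f = refl
∑-++ (x ∷ xs) ys f = trans (cong (f x +_) (∑-++ xs ys f)) (sym (+-assoc (f x) _ _))

∑-map : ∀ (g : α → β) (xs : List α) (f : β → ℕ) → ∑ (map g xs) f ≡ ∑ xs (f ∘ g)
∑-map g []       f = refl
∑-map g (x ∷ xs) f = cong (f (g x) +_) (∑-map g xs f)

∑-concatMap : ∀ (g : α → List β) (xs : List α) (f : β → ℕ) → ∑ (concatMap g xs) f ≡ ∑[ x ← xs ] ∑ (g x) f
∑-concatMap g []       f = refl
∑-concatMap g (x ∷ xs) f = trans (∑-++ (g x) (concatMap g xs) f) (cong (∑ (g x) f +_) (∑-concatMap g xs f))

length-filter : ∀ {φ : Pred α ℓ₁} (P? : Decidable φ) xs → length (filter P? xs) ≡ ∑[ x ← xs ] ⟦ P? x ⟧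
length-filter P? []       = refl
length-filter P? (x ∷ xs) with P? x
... | yes _ = cong suc (length-filter P? xs)
... | no  _ = length-filter P? xs

length-concatMap : ∀ (g : α → List β) xs → length (concatMap g xs) ≡ ∑[ x ← xs ] length (g x)
length-concatMap g []       = refl
length-concatMap g (x ∷ xs) = trans (length-++ (g x)) (cong (length (g x) +_) (length-concatMap g xs))

∑>0 : ∀ (xs : List α) {f : α → ℕ} → 0 < ∑ xs f → ∃ λ x → x ∈ xs × 0 < f x
∑>0 (x ∷ xs) {f} h with f x in eq
... | suc _ = x , here refl , subst (0 <_) (sym eq) (s≤s z≤n)
... | zero  = let y , y∈ , q = ∑>0 xs h in y , there y∈ , q

-- Each side is given the term at `x` that the other one has, which avoids a subtraction in ℕ.
∑-pointwise-except : ∀ {x} {xs : List α} {f g : α → ℕ} → Unique xs → x ∈ xs →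
  (∀ y → y ≢ x → f y ≡ g y) → ∑ xs f + g x ≡ ∑ xs g + f x
∑-pointwise-except {x = x} {_ ∷ xs} {f} {g} u@(_ ∷ _) (here refl) h =
  trans (cong (λ s → f x + s + g x) (tail≡ xs (Unique[x∷xs]⇒x∉xs u))) (rotate (f x) (∑ xs g) (g x))
  where
  tail≡ : ∀ ys → x ∉ ys → ∑ ys f ≡ ∑ ys g
  tail≡ []       _  = refl
  tail≡ (y ∷ ys) x∉ = cong₂ _+_ (h y (λ y≡x → x∉ (here (sym y≡x)))) (tail≡ ys (x∉ ∘ there))
  rotate : ∀ p q r → p + q + r ≡ r + q + p
  rotate = solve 3 (λ p q r → p :+ q :+ r := r :+ q :+ p) refl
    where open +-*-Solver
∑-pointwise-except {x = x} {y ∷ xs} {f} {g} (y∉ ∷ u) (there x∈) h =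
  trans (+-assoc (f y) _ _) (trans (cong₂ _+_ (h y (All.lookup y∉ x∈)) (∑-pointwise-except u x∈ h)) (sym (+-assoc (g y) _ _)))

-- Counting by inclusion

-- Each entry of the duplicate-free list uses up one occurrence in `ys`. Edges and pairs are counted
-- below by exhibiting such inclusions.
length-⊆ : ∀ {xs ys : List α} → Unique xs → (∀ {x} → x ∈ xs → x ∈ ys) → length xs ≤ length ys
length-⊆ {xs = []}     _ _ = z≤n
length-⊆ {xs = x ∷ xs} u@(_ ∷ u′) xs⊆ys with ∈-∃++ (xs⊆ys (here refl))
... | as , bs , refl = begin
  suc (length xs)           ≤⟨ s≤s (length-⊆ u′ rest) ⟩
  suc (length (as ++ bs))   ≡⟨ cong suc (length-++ as) ⟩
  suc (length as + length bs) ≡⟨ sym (+-suc (length as) (length bs)) ⟩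
  length as + suc (length bs) ≡⟨ sym (length-++ as) ⟩
  length (as ++ x ∷ bs)     ∎
  where
  open ≤-Reasoning
  rest : ∀ {z} → z ∈ xs → z ∈ as ++ bs
  rest z∈ with ∈-++⁻ as (xs⊆ys (there z∈))
  ... | inj₁ z∈as         = ∈-++⁺ˡ z∈as
  ... | inj₂ (here refl)  = contradiction z∈ (Unique[x∷xs]⇒x∉xs u)
  ... | inj₂ (there z∈bs) = ∈-++⁺ʳ as z∈bs

∑-unique≤1 : ∀ {φ : Pred α ℓ₁} (P? : Decidable φ) {xs : List α} → Unique xs →
  (∀ {x y} → φ x → φ y → x ≡ y) → ∑[ x ← xs ] ⟦ P? x ⟧ ≤ 1
∑-unique≤1 P? {[]} _ _ = z≤n
∑-unique≤1 P? {x ∷ xs} (x∉ ∷ u) h with P? x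
... | no _  = ∑-unique≤1 P? u h
... | yes p = ≤-reflexive (cong suc (none xs x∉))
  where
  none : ∀ ys → All (x ≢_) ys → ∑[ y ← ys ] ⟦ P? y ⟧ ≡ 0
  none []       _          = refl
  none (y ∷ ys) (x≢y ∷ qs) = cong₂ _+_ (⟦⟧-no (P? y) (λ q → x≢y (h p q))) (none ys qs)

deg≡∑ : ∀ {n} (G : Graph n) v → deg G v ≡ ∑[ u ← allFin n ] ⟦ adj? G v u ⟧
deg≡∑ {n} G v = length-filter (adj? G v) (allFin n)

setOf : {P : Pred (Fin n) 0ℓ} → Decidable P → Subset n
setOf P? = tabulate (does ∘ P?)

∈-setOf⁺ : ∀ {P : Pred (Fin n) 0ℓ} (P? : Decidable P) {v} → P v → v ∈ˢ setOf P?
∈-setOf⁺ P? {v} p = lookup⇒[]= v _ (trans (lookup∘tabulate (does ∘ P?) v) (dec-true (P? v) p))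

∈-setOf⁻ : ∀ {P : Pred (Fin n) 0ℓ} (P? : Decidable P) {v} → v ∈ˢ setOf P? → P v
∈-setOf⁻ P? {v} v∈ with P? v | trans (sym (lookup∘tabulate (does ∘ P?) v)) ([]=⇒lookup v∈)
... | yes p | _  = p
... | no  _ | ()

-- Cuts and flips

Apart : Subset n → Rel (Fin n) 0ℓ
Apart A u v = (u ∈ˢ A × v ∉ˢ A) ⊎ (u ∉ˢ A × v ∈ˢ A)

apart? : ∀ (A : Subset n) u v → Dec (Apart A u v)
apart? A u v = ((u ∈? A) ×-dec ¬? (v ∈? A)) ⊎-dec (¬? (u ∈? A) ×-dec (v ∈? A))

apart-sym : ∀ (A : Subset n) {u v} → Apart A u v → Apart A v u
apart-sym A (inj₁ (p , q)) = inj₂ (q , p)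
apart-sym A (inj₂ (p , q)) = inj₁ (q , p)

crossing : Graph n → Subset n → Fin n → ℕ
crossing {n} G A v = ∑[ u ← allFin n ] ⟦ adj? G v u ×-dec apart? A v u ⟧

-- A sum over ordered pairs, so every edge across the cut counts twice; hence the factors 2 in
-- `cut-flip`.
cut : Graph n → Subset n → ℕ
cut {n} G A = ∑[ v ← allFin n ] crossing G A v

Flipped : Fin n → Subset n → Pred (Fin n) 0ℓ
Flipped x A v = (v ≡ x × v ∉ˢ A) ⊎ (v ≢ x × v ∈ˢ A)

flipped? : ∀ (x : Fin n) A → Decidable (Flipped x A)
flipped? x A v = ((v ≟ x) ×-dec ¬? (v ∈? A)) ⊎-dec (¬? (v ≟ x) ×-dec (v ∈? A))

flip : Fin n → Subset n → Subset n
flip x A = setOf (flipped? x A)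

module _ {x : Fin n} {A : Subset n} where

  flip-other⁺ : ∀ {v} → v ≢ x → v ∈ˢ A → v ∈ˢ flip x A
  flip-other⁺ v≢x v∈A = ∈-setOf⁺ (flipped? x A) (inj₂ (v≢x , v∈A))

  flip-other⁻ : ∀ {v} → v ≢ x → v ∈ˢ flip x A → v ∈ˢ A
  flip-other⁻ v≢x v∈ with ∈-setOf⁻ (flipped? x A) v∈
  ... | inj₁ (v≡x , _) = contradiction v≡x v≢x
  ... | inj₂ (_ , v∈A) = v∈A

  flip-self⁺ : x ∉ˢ A → x ∈ˢ flip x A
  flip-self⁺ x∉A = ∈-setOf⁺ (flipped? x A) (inj₁ (refl , x∉A))

  flip-self⁻ : x ∈ˢ flip x A → x ∉ˢ A
  flip-self⁻ x∈ with ∈-setOf⁻ (flipped? x A) x∈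
  ... | inj₁ (_ , x∉A) = x∉A
  ... | inj₂ (x≢x , _) = contradiction refl x≢x

  apart-flip⁺ : ∀ {u v} → u ≢ x → v ≢ x → Apart A u v → Apart (flip x A) u v
  apart-flip⁺ u≢ v≢ (inj₁ (u∈ , v∉)) = inj₁ (flip-other⁺ u≢ u∈ , v∉ ∘ flip-other⁻ v≢)
  apart-flip⁺ u≢ v≢ (inj₂ (u∉ , v∈)) = inj₂ (u∉ ∘ flip-other⁻ u≢ , flip-other⁺ v≢ v∈)

  apart-flip⁻ : ∀ {u v} → u ≢ x → v ≢ x → Apart (flip x A) u v → Apart A u v
  apart-flip⁻ u≢ v≢ (inj₁ (u∈ , v∉)) = inj₁ (flip-other⁻ u≢ u∈ , v∉ ∘ flip-other⁺ v≢)
  apart-flip⁻ u≢ v≢ (inj₂ (u∉ , v∈)) = inj₂ (u∉ ∘ flip-other⁺ u≢ , flip-other⁻ v≢ v∈)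

  apart-flip-cover : ∀ {u} → u ≢ x → Apart (flip x A) x u ⊎ Apart A x u
  apart-flip-cover {u} u≢ with x ∈? A | u ∈? A
  ... | yes x∈ | yes u∈ = inj₁ (inj₂ ((λ h → flip-self⁻ h x∈) , flip-other⁺ u≢ u∈))
  ... | yes x∈ | no  u∉ = inj₂ (inj₁ (x∈ , u∉))
  ... | no  x∉ | yes u∈ = inj₂ (inj₂ (x∉ , u∈))
  ... | no  x∉ | no  u∉ = inj₁ (inj₁ (flip-self⁺ x∉ , u∉ ∘ flip-other⁻ u≢))

  apart-flip-disjoint : ∀ {u} → u ≢ x → ¬ (Apart (flip x A) x u × Apart A x u)
  apart-flip-disjoint u≢ (inj₁ (x∈′ , _)  , inj₁ (x∈ , _)) = flip-self⁻ x∈′ x∈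
  apart-flip-disjoint u≢ (inj₁ (_ , u∉′)  , inj₂ (_ , u∈)) = u∉′ (flip-other⁺ u≢ u∈)
  apart-flip-disjoint u≢ (inj₂ (_ , u∈′)  , inj₁ (_ , u∉)) = u∉ (flip-other⁻ u≢ u∈′)
  apart-flip-disjoint u≢ (inj₂ (x∉′ , _)  , inj₂ (x∉ , _)) = x∉′ (flip-self⁺ x∉)

adj⇒≢ : ∀ (G : Graph n) {u v} → Adj G u v → v ≢ u
adj⇒≢ G uv refl = adj-irr G uv

crossing-flip : ∀ (G : Graph n) x A → crossing G (flip x A) x + crossing G A x ≡ deg G x
crossing-flip {n} G x A = trans (sym (∑-+ (allFin n) _ _)) (trans (∑-cong (allFin n) (λ u → ≤-antisym
  (⟦⟧-disjoint (adj? G x u) (adj? G x u ×-dec apart? (flip x A) x u) (adj? G x u ×-dec apart? A x u)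
    proj₁ proj₁ (λ ((xu , p) , (_ , q)) → apart-flip-disjoint (adj⇒≢ G xu) (p , q)))
  (⟦⟧-cover (adj? G x u) (adj? G x u ×-dec apart? (flip x A) x u) (adj? G x u ×-dec apart? A x u)
    (λ xu → [ (λ p → inj₁ (xu , p)) , (λ p → inj₂ (xu , p)) ]′ (apart-flip-cover (adj⇒≢ G xu))))))
  (sym (deg≡∑ G x)))

-- In the matrix of crossing pairs only the row and the column of `x` change. `∑-pointwise-except`
-- is applied to each other row, where only the entry at `x` changes, and then to the sum of the
-- rows.
cut-flip : ∀ (G : Graph n) x A →
  cut G (flip x A) + 2 * crossing G A x ≡ cut G A + 2 * crossing G (flip x A) x
cut-flip {n} G x A = begin
  cut G A′ + 2 * crossing G A x
    ≡⟨ arrange (cut G A′) (crossing G A x) ⟩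
  (cut G A′ + crossing G A x) + (crossing G A x + 0)
    ≡⟨ cong₂ (λ c f → (cut G A′ + c) + (crossing G A x + f)) (row≡column A) (sym (diagonal A′)) ⟩
  (cut G A′ + ∑[ v ← allFin n ] f A v x) + (crossing G A x + f A′ x x)
    ≡⟨ cong (_+ (crossing G A x + f A′ x x)) (sym (∑-+ (allFin n) _ _)) ⟩
  ∑[ v ← allFin n ] (crossing G A′ v + f A v x) + (crossing G A x + f A′ x x)
    ≡⟨ ∑-pointwise-except (allFin⁺ n) (∈-allFin x) rows ⟩
  ∑[ v ← allFin n ] (crossing G A v + f A′ v x) + (crossing G A′ x + f A x x)
    ≡⟨ cong (_+ (crossing G A′ x + f A x x)) (∑-+ (allFin n) _ _) ⟩
  (cut G A + ∑[ v ← allFin n ] f A′ v x) + (crossing G A′ x + f A x x)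
    ≡⟨ cong₂ (λ c f → (cut G A + c) + (crossing G A′ x + f)) (sym (row≡column A′)) (diagonal A) ⟩
  (cut G A + crossing G A′ x) + (crossing G A′ x + 0)
    ≡⟨ arrange (cut G A) (crossing G A′ x) ⟨
  cut G A + 2 * crossing G A′ x ∎
  where
  open ≡-Reasoning
  A′ = flip x A
  f = λ S v u → ⟦ adj? G v u ×-dec apart? S v u ⟧
  arrange : ∀ p q → p + 2 * q ≡ (p + q) + (q + 0)
  arrange = solve 2 (λ p q → p :+ con 2 :* q := (p :+ q) :+ (q :+ con 0)) refl
    where open +-*-Solver
  row≡column : ∀ S → crossing G S x ≡ ∑[ v ← allFin n ] f S v x
  row≡column S = ∑-cong (allFin n) (λ v → ⟦⟧-cong (adj? G x v ×-dec apart? S x v) (adj? G v x ×-dec apart? S v x)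
    (λ (p , q) → adj-sym G p , apart-sym S q) (λ (p , q) → adj-sym G p , apart-sym S q))
  diagonal : ∀ S → f S x x ≡ 0
  diagonal S = ⟦⟧-no (adj? G x x ×-dec apart? S x x) (λ (p , _) → adj-irr G p)
  rows : ∀ v → v ≢ x → crossing G A′ v + f A v x ≡ crossing G A v + f A′ v x
  rows v v≢ = ∑-pointwise-except (allFin⁺ n) (∈-allFin x) (λ u u≢ →
    ⟦⟧-cong (adj? G v u ×-dec apart? A′ v u) (adj? G v u ×-dec apart? A v u)
      (λ (p , q) → p , apart-flip⁻ v≢ u≢ q) (λ (p , q) → p , apart-flip⁺ v≢ u≢ q))

cut-flip-< : ∀ (G : Graph n) x A → deg G x < 2 * crossing G A x → cut G (flip x A) < cut G A
cut-flip-< G x A h = +-cancelʳ-< (2 * crossing G A x) _ _ (begin-strict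
  cut G (flip x A) + 2 * crossing G A x ≡⟨ cut-flip G x A ⟩
  cut G A + 2 * crossing G (flip x A) x <⟨ +-monoʳ-< (cut G A) (*-monoʳ-< 2 smaller) ⟩
  cut G A + 2 * crossing G A x          ∎)
  where
  open ≤-Reasoning
  smaller : crossing G (flip x A) x < crossing G A x
  smaller = +-cancelʳ-< (crossing G A x) _ _ (begin-strict
    crossing G (flip x A) x + crossing G A x ≡⟨ crossing-flip G x A ⟩
    deg G x                                  <⟨ h ⟩
    2 * crossing G A x                       ≡⟨ cong (crossing G A x +_) (+-identityʳ _) ⟩
    crossing G A x + crossing G A x          ∎)

-- Each vertex with more than half of its neighbours across the cut is flipped, which decreases the cut.
abstract

  settle : ∀ (G : Graph n) {P : Pred (Fin n) 0ℓ} (P? : Decidable P) A → ∃ λ A′ →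
    (∀ v → ¬ P v → (v ∈ˢ A → v ∈ˢ A′) × (v ∈ˢ A′ → v ∈ˢ A)) ×
    (∀ v → P v → 2 * crossing G A′ v ≤ deg G v)
  settle {n} G {P} P? A₀ = go A₀ (<-wellFounded (cut G A₀))
    where
    go : ∀ A → Acc _<_ (cut G A) → ∃ λ A′ →
      (∀ v → ¬ P v → (v ∈ˢ A → v ∈ˢ A′) × (v ∈ˢ A′ → v ∈ˢ A)) ×
      (∀ v → P v → 2 * crossing G A′ v ≤ deg G v)
    go A (acc rs) with Fin.any? (λ v → P? v ×-dec (deg G v <? 2 * crossing G A v))
    ... | no  none        = A , (λ _ _ → id , id) , λ v p → ≮⇒≥ (λ h → none (v , p , h))
    ... | yes (x , p , h) =
      let A′ , same , good = go (flip x A) (rs (cut-flip-< G x A h))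
      in A′ , (λ v ¬p → let v≢x = λ v≡x → ¬p (subst P (sym v≡x) p) in
           proj₁ (same v ¬p) ∘ flip-other⁺ v≢x , flip-other⁻ v≢x ∘ proj₂ (same v ¬p)) , good

-- Stiebitz’ theorem on decompositions under degree constraints

degIn : Graph n → Subset n → Fin n → ℕ
degIn {n} G S v = ∑[ u ← allFin n ] ⟦ adj? G v u ×-dec (u ∈? S) ⟧

module _ (G : Graph n) where

  degIn-mono : ∀ {S T} → S ⊆ˢ T → ∀ v → degIn G S v ≤ degIn G T v
  degIn-mono {S} {T} S⊆T v = ∑-mono (allFin n) (λ u →
    ⟦⟧-mono (adj? G v u ×-dec (u ∈? S)) (adj? G v u ×-dec (u ∈? T)) (λ (p , q) → p , S⊆T q))

  deg≤degIn+degIn : ∀ {S T} v → (∀ {u} → Adj G v u → u ∈ˢ S ⊎ u ∈ˢ T) → deg G v ≤ degIn G S v + degIn G T v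
  deg≤degIn+degIn {S} {T} v h = ≤-trans (≤-reflexive (deg≡∑ G v)) (≤-trans (∑-mono (allFin n) (λ u →
    ⟦⟧-cover (adj? G v u) (adj? G v u ×-dec (u ∈? S)) (adj? G v u ×-dec (u ∈? T))
      (λ p → [ (λ q → inj₁ (p , q)) , (λ q → inj₂ (p , q)) ]′ (h p))))
    (≤-reflexive (∑-+ (allFin n) _ _)))

  degIn≤1+degIn : ∀ {S T} x v → (∀ {u} → u ∈ˢ S → u ≢ x → u ∈ˢ T) → degIn G S v ≤ suc (degIn G T v)
  degIn≤1+degIn {S} {T} x v h = ≤-trans (∑-mono (allFin n) (λ u →
    ⟦⟧-cover (adj? G v u ×-dec (u ∈? S)) (u ≟ x) (adj? G v u ×-dec (u ∈? T)) (cover u)))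
    (≤-trans (≤-reflexive (∑-+ (allFin n) _ _))
    (+-monoˡ-≤ _ (∑-unique≤1 (_≟ x) (allFin⁺ n) (λ p q → trans p (sym q)))))
    where
    cover : ∀ u → Adj G v u × u ∈ˢ S → u ≡ x ⊎ Adj G v u × u ∈ˢ T
    cover u (p , q) with u ≟ x
    ... | yes u≡x = inj₁ u≡x
    ... | no  u≢x = inj₂ (p , h q u≢x)

  degIn>0 : ∀ {S v} → 0 < degIn G S v → ∃ λ u → Adj G v u × u ∈ˢ S
  degIn>0 {S} {v} h = let u , _ , p = ∑>0 (allFin n) h in u , ⟦⟧>0 (adj? G v u ×-dec (u ∈? S)) p

_∖_ : Subset n → Subset n → Subset n
V ∖ A = setOf (λ v → (v ∈? V) ×-dec ¬? (v ∈? A))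

∈-∖⁺ : ∀ {V A : Subset n} {v} → v ∈ˢ V → v ∉ˢ A → v ∈ˢ V ∖ A
∈-∖⁺ {V = V} {A} v∈ v∉ = ∈-setOf⁺ (λ v → (v ∈? V) ×-dec ¬? (v ∈? A)) (v∈ , v∉)

∈-∖⁻ : ∀ {V A : Subset n} {v} → v ∈ˢ V ∖ A → v ∈ˢ V × v ∉ˢ A
∈-∖⁻ {V = V} {A} = ∈-setOf⁻ (λ v → (v ∈? V) ×-dec ¬? (v ∈? A))

_without_ : Subset n → Fin n → Subset n
S without x = setOf (λ v → (v ∈? S) ×-dec ¬? (v ≟ x))

∈-without⁺ : ∀ {S : Subset n} {x v} → v ∈ˢ S → v ≢ x → v ∈ˢ S without x
∈-without⁺ {S = S} {x} v∈ v≢ = ∈-setOf⁺ (λ v → (v ∈? S) ×-dec ¬? (v ≟ x)) (v∈ , v≢)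

∈-without⁻ : ∀ {S : Subset n} {x v} → v ∈ˢ S without x → v ∈ˢ S × v ≢ x
∈-without⁻ {S = S} {x} = ∈-setOf⁻ (λ v → (v ∈? S) ×-dec ¬? (v ≟ x))

_adjoin_ : Subset n → Fin n → Subset n
S adjoin x = setOf (λ v → (v ∈? S) ⊎-dec (v ≟ x))

∈-adjoin⁺ : ∀ {S : Subset n} {x v} → v ∈ˢ S ⊎ v ≡ x → v ∈ˢ S adjoin x
∈-adjoin⁺ {S = S} {x} = ∈-setOf⁺ (λ v → (v ∈? S) ⊎-dec (v ≟ x))

∈-adjoin⁻ : ∀ {S : Subset n} {x v} → v ∈ˢ S adjoin x → v ∈ˢ S ⊎ v ≡ x
∈-adjoin⁻ {S = S} {x} = ∈-setOf⁻ (λ v → (v ∈? S) ⊎-dec (v ≟ x))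

Nice : Graph n → (Fin n → ℕ) → Subset n → Set
Nice G a S = ∀ v → v ∈ˢ S → a v ≤ degIn G S v

nice? : ∀ (G : Graph n) a → Decidable (Nice G a)
nice? G a S = Fin.all? (λ v → (v ∈? S) →-dec (a v ≤? degIn G S v))

NicePart : Graph n → (Fin n → ℕ) → Subset n → Subset n → Set
NicePart G a S T = Nonempty T × T ⊆ˢ S × Nice G a T

nicePart? : ∀ (G : Graph n) a S → Dec (∃ (NicePart G a S))
nicePart? G a S = anySubset? (λ T → nonempty? T ×-dec (T ⊆? S) ×-dec nice? G a T)

-- Equivalently, every nonempty part of S has a vertex of degree at most a within that part.
Degenerate : Graph n → (Fin n → ℕ) → Subset n → Set
Degenerate G a S = ¬ ∃ (NicePart G (suc ∘ a) S)

module _ (G : Graph n) (a : Fin n → ℕ) where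

  private V = vertices G

  nonNice : ∀ {S} → ¬ Nice G (suc ∘ a) S → ∃ λ x → x ∈ˢ S × degIn G S x ≤ a x
  nonNice {S} ¬nice with Fin.any? (λ x → (x ∈? S) ×-dec (degIn G S x ≤? a x))
  ... | yes found = found
  ... | no  none  = contradiction (λ v v∈ → ≰⇒> (λ h → none (v , v∈ , h))) ¬nice

  -- The loss of one vertex lowers each degree by at most one. If the known member of `S` is the
  -- vertex removed, its positive degree supplies another one.
  nice-without : ∀ {S} x → Nonempty S → Nice G (suc ∘ a) S →
    Nonempty (S without x) × Nice G a (S without x)
  nice-without {S} x (z , z∈) nice = nonempty , λ v v∈ → let v∈S , _ = ∈-without⁻ v∈ in
    s≤s⁻¹ (≤-trans (nice v v∈S) (degIn≤1+degIn G x v ∈-without⁺))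
    where
    nonempty : Nonempty (S without x)
    nonempty with z ≟ x
    ... | no  z≢x = z , ∈-without⁺ z∈ z≢x
    ... | yes z≡x = let y , zy , y∈ = degIn>0 G (≤-trans (s≤s z≤n) (nice z z∈)) in
      y , ∈-without⁺ y∈ (λ y≡x → adj⇒≢ G zy (trans y≡x (sym z≡x)))

  Split : Set
  Split = ∃ λ A → Nonempty A × Nonempty (V ∖ A) × A ⊆ˢ V × Nice G a A × Nice G a (V ∖ A)

  module _ (large : ∀ v → v ∈ˢ V → 2 * a v < deg G v) where

    -- `A` absorbs the vertices outside `B` that have at least `a` neighbours in it. When none is
    -- left, a vertex in neither part has fewer than `a` neighbours in `A`; its degree exceeds
    -- `2 a`, so at least `a` neighbours lie in the complement.
    extend : ∀ {A B} → NicePart G a V A → NicePart G a V B → (∀ {v} → v ∈ˢ A → v ∉ˢ B) → Split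
    extend {A} {B} partA (neB , B⊆ , niceB) = go A (⊃-wellFounded A) partA
      where
      go : ∀ A → Acc _⊃_ A → NicePart G a V A → (∀ {v} → v ∈ˢ A → v ∉ˢ B) → Split
      go A (acc rs) (neA@(w , w∈) , A⊆ , niceA) disj
        with Fin.any? (λ x → (x ∈? V) ×-dec ¬? (x ∈? A) ×-dec ¬? (x ∈? B) ×-dec (a x ≤? degIn G A x))
      ... | yes (x , x∈V , x∉A , x∉B , h) = go (A adjoin x) (rs (∈-adjoin⁺ ∘ inj₁ , x , ∈-adjoin⁺ (inj₂ refl) , x∉A))
        ((w , ∈-adjoin⁺ (inj₁ w∈)) , [ A⊆ , (λ { refl → x∈V }) ]′ ∘ ∈-adjoin⁻ , nice)
        ([ disj , (λ { refl → x∉B }) ]′ ∘ ∈-adjoin⁻)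
        where
        nice : Nice G a (A adjoin x)
        nice v v∈ with ∈-adjoin⁻ v∈
        ... | inj₁ v∈A  = ≤-trans (niceA v v∈A) (degIn-mono G (∈-adjoin⁺ ∘ inj₁) v)
        ... | inj₂ refl = ≤-trans h (degIn-mono G (∈-adjoin⁺ ∘ inj₁) v)
      ... | no none = A , neA , (proj₁ neB , B⊆V∖A (proj₂ neB)) , A⊆ , niceA , nice
        where
        B⊆V∖A : B ⊆ˢ V ∖ A
        B⊆V∖A v∈B = ∈-∖⁺ (B⊆ v∈B) (λ v∈A → disj v∈A v∈B)
        nice : Nice G a (V ∖ A)
        nice v v∈ with v ∈? B
        ... | yes v∈B = ≤-trans (niceB v v∈B) (degIn-mono G B⊆V∖A v)
        ... | no  v∉B = let v∈V , v∉A = ∈-∖⁻ v∈ in +-cancelˡ-≤ (a v) _ _ (begin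
          a v + a v                           ≡⟨ cong (a v +_) (+-identityʳ (a v)) ⟨
          2 * a v                             ≤⟨ <⇒≤ (large v v∈V) ⟩
          deg G v                             ≤⟨ deg≤degIn+degIn G v (λ {u} vu → side u (adj-∈ G (adj-sym G vu))) ⟩
          degIn G A v + degIn G (V ∖ A) v     ≤⟨ +-monoˡ-≤ _ (<⇒≤ (≰⇒> (λ h → none (v , v∈V , v∉A , v∉B , h)))) ⟩
          a v + degIn G (V ∖ A) v             ∎)
          where
          open ≤-Reasoning
          side : ∀ u → u ∈ˢ V → u ∈ˢ A ⊎ u ∈ˢ V ∖ A
          side u u∈V with u ∈? A
          ... | yes u∈A = inj₁ u∈A
          ... | no  u∉A = inj₂ (∈-∖⁺ u∈V u∉A)

    -- A part inside `S` with all degrees above `a` stays nice after losing a vertex and is then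
    -- strictly smaller than `S`; the descent ends at a degenerate part.
    minimalPart : ∀ {S} → NicePart G a V S → ∃ λ T → NicePart G a V T × Degenerate G a T
    minimalPart {S} = go S (⊂-wellFounded S)
      where
      go : ∀ S → Acc _⊂_ S → NicePart G a V S → ∃ λ T → NicePart G a V T × Degenerate G a T
      go S (acc rs) part@(ne , S⊆ , nice) with nicePart? G (suc ∘ a) S
      ... | no  none = S , part , none
      ... | yes (T , (x , x∈T) , T⊆S , niceT) =
        let ne′ , nice′ = nice-without x (x , x∈T) niceT
        in go (T without x) (rs (T⊆S ∘ proj₁ ∘ ∈-without⁻ , x , T⊆S x∈T , λ h → proj₂ (∈-without⁻ h) refl))
             (ne′ , S⊆ ∘ T⊆S ∘ proj₁ ∘ ∈-without⁻ , nice′)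

    private
      nice⁺-V : Nice G (suc ∘ a) V
      nice⁺-V v v∈ = ≤-trans (≤-trans (s≤s (m≤m+n (a v) _)) (large v v∈)) (≤-trans (≤-reflexive (deg≡∑ G v))
        (∑-mono (allFin n) (λ u → ⟦⟧-mono (adj? G v u) (adj? G v u ×-dec (u ∈? V)) (λ vu → vu , adj-∈ G (adj-sym G vu)))))

    module _ (V-nonempty : Nonempty V) where

      private
        -- `V` itself has all degrees above `a`, so no degenerate set contains it. Thus neither of
        -- two complementary degenerate sides is empty.
        proper : ∀ {S} → Degenerate G a S → ∃ λ x → x ∈ˢ V × x ∉ˢ S
        proper {S} degS with Fin.any? (λ x → (x ∈? V) ×-dec ¬? (x ∈? S))
        ... | yes found = found
        ... | no  none  = contradiction (V , V-nonempty , (λ {x} x∈ → decidable-stable (x ∈? S) (λ x∉ → none (x , x∈ , x∉))) , nice⁺-V) degS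

        -- A vertex with few neighbours on its own side of a partition of V has many on the other one.
        unbalanced : ∀ {S A x} → x ∈ˢ V → degIn G S x ≤ a x →
          (∀ {u} → Adj G x u → Apart A x u ⊎ u ∈ˢ S) → deg G x < 2 * crossing G A x
        unbalanced {S} {A} {x} x∈V few h = +-cancelʳ-< (deg G x) _ _ (begin-strict
          deg G x + deg G x                             ≤⟨ +-mono-≤ bound bound ⟩
          (c + a x) + (c + a x)                         ≡⟨ arrange c (a x) ⟩
          2 * c + 2 * a x                               <⟨ +-monoʳ-< (2 * c) (large x x∈V) ⟩
          2 * c + deg G x                               ∎)
          where
          open ≤-Reasoning
          c = crossing G A x
          bound : deg G x ≤ c + a x
          bound = ≤-trans (≤-reflexive (deg≡∑ G x)) (≤-trans (∑-mono (allFin n) (λ u →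
            ⟦⟧-cover (adj? G x u) (adj? G x u ×-dec apart? A x u) (adj? G x u ×-dec (u ∈? S))
              (λ p → [ (λ q → inj₁ (p , q)) , (λ q → inj₂ (p , q)) ]′ (h p))))
            (≤-trans (≤-reflexive (∑-+ (allFin n) _ _)) (+-monoʳ-≤ c few)))
          arrange : ∀ p q → (p + q) + (p + q) ≡ 2 * p + 2 * q
          arrange = solve 2 (λ p q → (p :+ q) :+ (p :+ q) := con 2 :* p :+ con 2 :* q) refl
            where open +-*-Solver

      -- Move vertices between two degenerate sides while both stay degenerate; the cut decreases.
      -- When stuck, each side has, up to one vertex of the other, a part of minimum degree above a.
      balance : ∀ A → Acc _<_ (cut G A) → A ⊆ˢ V → Degenerate G a A → Degenerate G a (V ∖ A) → Split
      balance A (acc rs) A⊆ degA degB = stepA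
        where
        B = V ∖ A

        neA : Nonempty A
        neA = let x , x∈V , x∉B = proper degB in
          x , decidable-stable (x ∈? A) (λ x∉A → x∉B (∈-∖⁺ x∈V x∉A))

        neB : Nonempty B
        neB = let x , x∈V , x∉A = proper degA in x , ∈-∖⁺ x∈V x∉A

        stuck : ∀ x y → x ∈ˢ A → y ∈ˢ B → ∃ (NicePart G (suc ∘ a) (V ∖ flip x A)) →
          ∃ (NicePart G (suc ∘ a) (flip y A)) → Split
        stuck x y x∈A y∈B (T , neT , T⊆ , niceT) (S , neS , S⊆ , niceS) =
          -- `S` lies in `A` with `y` added and `T` in `B` with `x` added. They can meet only in `x`
          -- and `y`; taking `x` from one and `y` from the other makes them disjoint, and the spare
          -- degree pays for it.
          let neS′ , niceS′ = nice-without x neS niceS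
              neT′ , niceT′ = nice-without y neT niceT
          in extend (neS′ , S⊆V ∘ S⊆ ∘ proj₁ ∘ ∈-without⁻ , niceS′)
                    (neT′ , proj₁ ∘ ∈-∖⁻ ∘ T⊆ ∘ proj₁ ∘ ∈-without⁻ , niceT′) disjoint
          where
          S⊆V : flip y A ⊆ˢ V
          S⊆V {v} v∈ with v ≟ y
          ... | yes refl = proj₁ (∈-∖⁻ y∈B)
          ... | no  v≢y  = A⊆ (flip-other⁻ v≢y v∈)
          disjoint : ∀ {v} → v ∈ˢ S without x → v ∉ˢ T without y
          disjoint v∈S v∈T =
            let v∈S , v≢x = ∈-without⁻ v∈S
                v∈T , v≢y = ∈-without⁻ v∈T
                v∈A = flip-other⁻ v≢y (S⊆ v∈S)
            in proj₂ (∈-∖⁻ (T⊆ v∈T)) (flip-other⁺ v≢x v∈A)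

        stepB : ∀ x → x ∈ˢ A → ∃ (NicePart G (suc ∘ a) (V ∖ flip x A)) → Split
        stepB x x∈A part with nonNice (λ nice → degB (B , neB , id , nice))
        ... | y , y∈B , few with nicePart? G (suc ∘ a) (flip y A)
        ...   | yes part′ = stuck x y x∈A y∈B part part′
        ...   | no  none  = balance (flip y A)
          (rs (cut-flip-< G y A (unbalanced (proj₁ (∈-∖⁻ y∈B)) few apart))) flip⊆ none
          (λ (T , ne , T⊆ , nice) → degB (T , ne , shrink ∘ T⊆ , nice))
          where
          y∉A = proj₂ (∈-∖⁻ y∈B)
          apart : ∀ {u} → Adj G y u → Apart A y u ⊎ u ∈ˢ B
          apart {u} yu with u ∈? A
          ... | yes u∈A = inj₁ (inj₂ (y∉A , u∈A))
          ... | no  u∉A = inj₂ (∈-∖⁺ (adj-∈ G (adj-sym G yu)) u∉A)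
          flip⊆ : flip y A ⊆ˢ V
          flip⊆ {v} v∈ with v ≟ y
          ... | yes refl = proj₁ (∈-∖⁻ y∈B)
          ... | no  v≢y  = A⊆ (flip-other⁻ v≢y v∈)
          shrink : V ∖ flip y A ⊆ˢ B
          shrink {v} v∈ with ∈-∖⁻ v∈
          ... | v∈V , v∉ = ∈-∖⁺ v∈V (λ v∈A → v∉ (flip-other⁺ (λ { refl → y∉A v∈A }) v∈A))

        stepA : Split
        stepA with nonNice (λ nice → degA (A , neA , id , nice))
        ... | x , x∈A , few with nicePart? G (suc ∘ a) (V ∖ flip x A)
        ...   | yes part = stepB x x∈A part
        ...   | no  none = balance (flip x A)
          (rs (cut-flip-< G x A (unbalanced (A⊆ x∈A) few apart))) (A⊆ ∘ flip⊆)
          (λ (T , ne , T⊆ , nice) → degA (T , ne , flip⊆ ∘ T⊆ , nice)) none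
          where
          apart : ∀ {u} → Adj G x u → Apart A x u ⊎ u ∈ˢ A
          apart {u} xu with u ∈? A
          ... | yes u∈A = inj₂ u∈A
          ... | no  u∉A = inj₁ (inj₁ (x∈A , u∉A))
          flip⊆ : flip x A ⊆ˢ A
          flip⊆ {v} v∈ = flip-other⁻ (λ { refl → flip-self⁻ v∈ x∈A }) v∈

      abstract

        -- If the complement of a degenerate nice part contains a nice part, the two extend to a
        -- partition. Otherwise it contains none, so it is degenerate as well, and `balance`
        -- applies.
        stiebitz : Split
        stiebitz with minimalPart (V-nonempty , id , λ v v∈ → ≤-trans (n≤1+n (a v)) (nice⁺-V v v∈))
        ... | A , partA@(_ , A⊆ , _) , degA with nicePart? G a (V ∖ A)
        ...   | yes (B , neB , B⊆ , niceB) = extend partA (neB , proj₁ ∘ ∈-∖⁻ ∘ B⊆ , niceB) (λ v∈A v∈B → proj₂ (∈-∖⁻ (B⊆ v∈B)) v∈A)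
        ...   | no none = balance A (<-wellFounded _) A⊆ degA
          (λ (T , ne , T⊆ , nice) → none (T , ne , T⊆ , λ v v∈ → ≤-trans (n≤1+n (a v)) (nice v v∈)))

-- Trees grown from a root, as lists of pairs (parent , child), the last child first

verts : Fin n → List (Fin n × Fin n) → List (Fin n)
verts r t = r ∷ map proj₂ t

Grows : Fin n → List (Fin n × Fin n) → Set
Grows r []            = ⊤
Grows r ((p , x) ∷ t) = p ∈ verts r t × x ∉ verts r t × Grows r t

LowTree : Graph n → ℕ → Fin n → List (Fin n × Fin n) → Set
LowTree G D r t = Grows r t × All (λ (p , x) → Adj G p x × deg G x ≤ D) t

NoLowTree : Graph n → ℕ → ℕ → Set
NoLowTree G D k = ∀ r t → length t ≡ k → ¬ LowTree G D r t

star-lowTree : ∀ (G : Graph n) D v us → Unique us → All (λ u → Adj G v u × deg G u ≤ D) us →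
  LowTree G D v (map (v ,_) us)
star-lowTree G D v []       _          _         = tt , []
star-lowTree G D v (u ∷ us) uniq@(_ ∷ uniq′) (vu ∷ vus) =
  let grows , low = star-lowTree G D v us uniq′ vus in (here refl , u∉ , grows) , vu ∷ low
  where
  children : ∀ us → map proj₂ (map (v ,_) us) ≡ us
  children us = trans (sym (map-∘ us)) (map-id us)
  u∉ : u ∉ verts v (map (v ,_) us)
  u∉ (here u≡v)  = adj-irr G (subst (Adj G v) u≡v (proj₁ vu))
  u∉ (there u∈)  = Unique[x∷xs]⇒x∉xs uniq (subst (u ∈_) (children us) u∈)

lowNeighbours : Graph n → ℕ → Fin n → ℕ
lowNeighbours {n} G D v = ∑[ u ← allFin n ] ⟦ adj? G v u ×-dec (deg G u ≤? D) ⟧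

-- `k` low neighbours would be the children of a star rooted at `v`. This is why `LowTree` puts no
-- condition on the degree of the root.
lowNeighbours< : ∀ {k} (G : Graph n) D → NoLowTree G D k → ∀ v → lowNeighbours G D v < k
lowNeighbours< {n} {k} G D none v = ≰⇒> λ k≤ → none v (map (v ,_) (take k us))
  (trans (length-map (v ,_) (take k us)) (trans (length-take k us) (m≤n⇒m⊓n≡m (≤-trans k≤ (≤-reflexive (sym (length-filter low? (allFin n))))))))
  (star-lowTree G D v (take k us) (take⁺ k (filter⁺ low? (allFin⁺ n))) (All.take⁺ k (All.all-filter low? (allFin n))))
  where
  low? : Decidable (λ u → Adj G v u × deg G u ≤ D)
  low? u = adj? G v u ×-dec (deg G u ≤? D)
  us = filter low? (allFin n)

∣∣≡∑ : ∀ (S : Subset n) → ∣ S ∣ ≡ ∑[ u ← allFin n ] ⟦ u ∈? S ⟧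
∣∣≡∑ Vec.[]      = refl
∣∣≡∑ {suc n} (s Vec.∷ S) = trans (head s) (cong (⟦ Fin.zero ∈? (s Vec.∷ S) ⟧ +_) (trans (∣∣≡∑ S) (sym
  (trans (cong (λ us → ∑ us (λ u → ⟦ u ∈? (s Vec.∷ S) ⟧)) (sym (map-tabulate id Fin.suc)))
  (trans (∑-map Fin.suc (allFin n) _) (∑-cong (allFin n) (λ u → ⟦⟧-cong (Fin.suc u ∈? (s Vec.∷ S)) (u ∈? S)
    (λ { (Vec.there u∈) → u∈ }) Vec.there)))))))
  where
  head : ∀ s → ∣ s Vec.∷ S ∣ ≡ ⟦ Fin.zero ∈? (s Vec.∷ S) ⟧ + ∣ S ∣
  head inside  = refl
  head outside = refl

∣∣≤length : ∀ (S : Subset n) (xs : List (Fin n)) → (∀ {v} → v ∈ˢ S → v ∈ xs) → ∣ S ∣ ≤ length xs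
∣∣≤length {n} S xs S⊆ = ≤-trans (≤-reflexive (trans (∣∣≡∑ S) (sym (length-filter (_∈? S) (allFin n)))))
  (length-⊆ (filter⁺ (_∈? S) (allFin⁺ n)) (S⊆ ∘ proj₂ ∘ ∈-filter⁻ (_∈? S) {xs = allFin n}))

deg≤∣∣ : ∀ (G : Graph n) v S → (∀ {u} → Adj G v u → u ∈ˢ S) → deg G v ≤ ∣ S ∣
deg≤∣∣ {n} G v S N⊆S = ≤-trans (≤-reflexive (deg≡∑ G v)) (≤-trans
  (∑-mono (allFin n) (λ u → ⟦⟧-mono (adj? G v u) (u ∈? S) N⊆S)) (≤-reflexive (sym (∣∣≡∑ S))))

-- The first edge of the path that leaves `xs`. The reachability of its outer end is recorded
-- because `grow` derives from it that this end is low.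
exit : ∀ (G : Graph n) {u z xs} → Reachable G u z → u ∈ xs → z ∉ xs →
  ∃₂ λ p x → p ∈ xs × x ∉ xs × Adj G p x × Reachable G u x
exit G Star.ε u∈ z∉ = contradiction u∈ z∉
exit G {xs = xs} (_◅_ {i = u} {j = w} uw path) u∈ z∉ with DecMembership._∈?_ _≟_ w xs
... | no  w∉ = u , w , u∈ , w∉ , uw , uw ◅ Star.ε
... | yes w∈ = let p , x , p∈ , x∉ , px , reach = exit G path w∈ z∉ in p , x , p∈ , x∉ , px , uw ◅ reach

-- As long as the tree does not exhaust `K`, a path to a missing vertex leaves the tree along an
-- edge, whose outer end becomes the next child.
grow : ∀ (G : Graph n) D K r → (∀ {v} → v ∈ˢ K → Reachable G r v) → (∀ {v} → Reachable G r v → v ∈ˢ K) →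
  (∀ {v} → v ∈ˢ K → deg G v ≤ D) →
  ∀ j → j < ∣ K ∣ → ∃ λ t → length t ≡ j × LowTree G D r t
grow G D K r C⇒ ⇒C low zero    _ = [] , refl , tt , []
grow G D K r C⇒ ⇒C low (suc j) j< with grow G D K r C⇒ ⇒C low j (≤-trans (n≤1+n _) j<)
... | t , len , grows , all with Fin.any? (λ z → (z ∈? K) ×-dec ¬? (DecMembership._∈?_ _≟_ z (verts r t)))
...   | no none = contradiction (≤-trans j< (∣∣≤length K (verts r t) (λ {z} z∈ →
          decidable-stable (DecMembership._∈?_ _≟_ z (verts r t)) (λ z∉ → none (z , z∈ , z∉)))))
          (<⇒≱ (s≤s (≤-reflexive (cong suc (trans (length-map proj₂ t) len)))))
...   | yes (z , z∈C , z∉) =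
        let p , x , p∈ , x∉ , px , reach = exit G (C⇒ z∈C) (here refl) z∉
        in (p , x) ∷ t , cong suc len , (p∈ , x∉ , grows) , (px , low (⇒C reach)) ∷ all

-- To turn a component into a `Subset`, reachability must be decided at every vertex. Under a double
-- negation all these finitely many decisions may be assumed at once, which suffices where the goal
-- is `⊥`.
¬¬-∀ : ∀ {P : Pred (Fin n) 0ℓ} → (∀ i → ¬ ¬ P i) → ¬ ¬ (∀ i → P i)
¬¬-∀ {zero}  h k = k λ ()
¬¬-∀ {suc n} h k = h Fin.zero λ p₀ → ¬¬-∀ (h ∘ Fin.suc) λ ps → k λ { Fin.zero → p₀ ; (Fin.suc i) → ps i }

-- The component of the high vertex `v` contains its more than `D` neighbours, so the giant has more
-- than `k` vertices. If all of them were low, `grow` would find a low tree with `k` children in it.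
giant-high : ∀ {k} (G : Graph n) D K → k ≤ D → (∀ v → v ∈ˢ vertices G) → NoLowTree G D k →
  (∃ λ v → D < deg G v) → IsLargestComponent G K → ∃ λ x → x ∈ˢ K × D < deg G x
giant-high {n} {k} G D K k≤D all∈ none (v , D<) ((r , _ , iff) , largest)
  with Fin.any? (λ x → (x ∈? K) ×-dec (D <? deg G x))
... | yes found = found
... | no  nohigh = ⊥-elim (¬¬-∀ (λ u → ¬¬-excluded-middle {A = Reachable G v u}) λ reach? →
  let S      = setOf reach?
      k<     = ≤-trans (≤-trans (s≤s k≤D) D<) (≤-trans
        (deg≤∣∣ G v S (λ vu → ∈-setOf⁺ reach? (vu ◅ Star.ε)))
        (largest S (v , all∈ v , λ u → mk⇔ (∈-setOf⁻ reach?) (∈-setOf⁺ reach?))))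
      t , len , tree = grow G D K r (Equivalence.to (iff _)) (Equivalence.from (iff _))
        (λ {x} x∈ → ≮⇒≥ (λ h → nohigh (x , x∈ , h))) k k<
  in none r t len tree)

-- A cut of the giant that every vertex can afford

-- For positive `d`, the largest number whose double is below `d`: the most that `stiebitz` can
-- guarantee at a vertex of degree `d`.
halfDown : ℕ → ℕ
halfDown d = ⌊ d ∸ 1 /2⌋

2*⌊n/2⌋≤n : ∀ m → 2 * ⌊ m /2⌋ ≤ m
2*⌊n/2⌋≤n zero          = z≤n
2*⌊n/2⌋≤n (suc zero)    = z≤n
2*⌊n/2⌋≤n (suc (suc m)) = ≤-trans (≤-reflexive (*-suc 2 ⌊ m /2⌋)) (s≤s (s≤s (2*⌊n/2⌋≤n m)))

n≤1+2*⌊n/2⌋ : ∀ m → m ≤ suc (2 * ⌊ m /2⌋)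
n≤1+2*⌊n/2⌋ zero          = z≤n
n≤1+2*⌊n/2⌋ (suc zero)    = s≤s z≤n
n≤1+2*⌊n/2⌋ (suc (suc m)) = ≤-trans (s≤s (s≤s (n≤1+2*⌊n/2⌋ m))) (s≤s (≤-reflexive (sym (*-suc 2 ⌊ m /2⌋))))

2*halfDown< : ∀ {d} → 0 < d → 2 * halfDown d < d
2*halfDown< {suc d} _ = s≤s (2*⌊n/2⌋≤n d)

≤2+2*halfDown : ∀ d → d ≤ 2 + 2 * halfDown d
≤2+2*halfDown zero    = z≤n
≤2+2*halfDown (suc d) = s≤s (n≤1+2*⌊n/2⌋ d)

-- A high vertex keeps `halfDown` of its degree among the high vertices, wherever the low ones go.
-- So twice its crossing edges exceed its degree by at most `k + 2`: `k` for the low neighbours, 2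
-- for the rounding. Since the degree is above `suc q * (k + 2)`, this excess is at most a
-- `suc q`-th of it. For a low vertex `settle` leaves no excess at all, and it never moves a high
-- vertex, so both sides keep one.
affordable-cut : ∀ {k} (G : Graph n) q K → NoLowTree G (suc q * (k + 2)) k →
  (∃ λ x → x ∈ˢ K × suc q * (k + 2) < deg G x) →
  (∀ {u v} → u ∈ˢ K → Adj G u v → v ∈ˢ K) →
  ∃ λ A → (∃ λ x → x ∈ˢ K × x ∈ˢ A) × (∃ λ y → y ∈ˢ K × y ∉ˢ A) ×
    (∀ v → v ∈ˢ K → suc q * (2 * crossing G A v) ≤ suc (suc q) * deg G v)
affordable-cut {n} {k} G q K none (x₀ , x₀∈C , x₀-high) closed =
  A , (proj₁ neA , proj₁ (high (A₀⊆ (proj₂ neA))) , proj₁ (same _ (notLow (A₀⊆ (proj₂ neA)))) (proj₂ neA))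
    , (let y , y∈ = neB ; y∈V , y∉A₀ = ∈-∖⁻ y∈ in
        y , proj₁ (high y∈V) , (λ y∈A → y∉A₀ (proj₂ (same y (notLow y∈V)) y∈A)))
    , λ v v∈C → afford v v∈C (deg G v ≤? D)
  where
  D = suc q * (k + 2)
  high? : Decidable (λ v → v ∈ˢ K × D < deg G v)
  high? v = (v ∈? K) ×-dec (D <? deg G v)
  V = setOf high?
  GV = induced G V
  a = λ v → halfDown (deg GV v)

  high : ∀ {v} → v ∈ˢ V → v ∈ˢ K × D < deg G v
  high = ∈-setOf⁻ high?

  notLow : ∀ {v} → v ∈ˢ V → ¬ deg G v ≤ D
  notLow v∈ = <⇒≱ (proj₂ (high v∈))

  k+2≤D : k + 2 ≤ D
  k+2≤D = m≤m+n (k + 2) (q * (k + 2))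

  deg≤ : ∀ {v} → v ∈ˢ V → deg G v ≤ deg GV v + k
  deg≤ {v} v∈ = begin
    deg G v                                                      ≡⟨ deg≡∑ G v ⟩
    ∑[ u ← allFin n ] ⟦ adj? G v u ⟧                             ≤⟨ ∑-mono (allFin n) (λ u →
      ⟦⟧-cover (adj? G v u) (adj? GV v u) (adj? G v u ×-dec (deg G u ≤? D)) (cover u)) ⟩
    ∑[ u ← allFin n ] (⟦ adj? GV v u ⟧ + ⟦ adj? G v u ×-dec (deg G u ≤? D) ⟧) ≡⟨ ∑-+ (allFin n) _ _ ⟩
    (∑[ u ← allFin n ] ⟦ adj? GV v u ⟧) + lowNeighbours G D v      ≤⟨ +-mono-≤ (≤-reflexive (sym (deg≡∑ GV v))) (<⇒≤ (lowNeighbours< G D none v)) ⟩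
    deg GV v + k ∎
    where
    open ≤-Reasoning
    cover : ∀ u → Adj G v u → Adj GV v u ⊎ (Adj G v u × deg G u ≤ D)
    cover u vu with deg G u ≤? D
    ... | yes low = inj₂ (vu , low)
    ... | no  ¬low = inj₁ (vu , v∈ , ∈-setOf⁺ high? (closed (proj₁ (high v∈)) vu , ≰⇒> ¬low))

  large : ∀ v → v ∈ˢ V → 2 * a v < deg GV v
  large v v∈ = 2*halfDown< (+-cancelʳ-< k 0 (deg GV v) (begin-strict
    k            ≤⟨ m≤m+n k 2 ⟩
    k + 2        ≤⟨ k+2≤D ⟩
    D            <⟨ proj₂ (high v∈) ⟩
    deg G v      ≤⟨ deg≤ v∈ ⟩
    deg GV v + k ∎))
    where open ≤-Reasoning

  split = stiebitz GV a large (x₀ , ∈-setOf⁺ high? (x₀∈C , x₀-high))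
  A₀    = proj₁ split
  neA   = proj₁ (proj₂ split)
  neB   = proj₁ (proj₂ (proj₂ split))
  A₀⊆   = proj₁ (proj₂ (proj₂ (proj₂ split)))
  niceA = proj₁ (proj₂ (proj₂ (proj₂ (proj₂ split))))
  niceB = proj₂ (proj₂ (proj₂ (proj₂ (proj₂ split))))

  settled = settle G (λ v → deg G v ≤? D) A₀
  A       = proj₁ settled
  same    = proj₁ (proj₂ settled)

  crossing+≤deg : ∀ {S v} → (∀ {u} → Adj G v u × u ∈ˢ S → ¬ Apart A v u) → crossing G A v + degIn GV S v ≤ deg G v
  crossing+≤deg {S} {v} h = ≤-trans (≤-reflexive (sym (∑-+ (allFin n) _ _))) (≤-trans (∑-mono (allFin n) (λ u →
    ⟦⟧-disjoint (adj? G v u) (adj? G v u ×-dec apart? A v u) (adj? GV v u ×-dec (u ∈? S)) proj₁ (proj₁ ∘ proj₁)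
      (λ ((vu , ap) , (_ , u∈)) → h (vu , u∈) ap))) (≤-reflexive (sym (deg≡∑ G v))))

  crossing+a≤deg : ∀ {v} → v ∈ˢ V → Dec (v ∈ˢ A₀) → crossing G A v + a v ≤ deg G v
  crossing+a≤deg {v} v∈ (yes v∈A₀) = ≤-trans (+-monoʳ-≤ _ (niceA v v∈A₀)) (crossing+≤deg (λ {u} (_ , u∈) →
      [ (λ (_ , u∉) → u∉ (proj₁ (same u (notLow (A₀⊆ u∈))) u∈))
      , (λ (v∉ , _) → v∉ (proj₁ (same v (notLow v∈)) v∈A₀)) ]′))
  crossing+a≤deg {v} v∈ (no v∉A₀) = ≤-trans (+-monoʳ-≤ _ (niceB v (∈-∖⁺ v∈ v∉A₀))) (crossing+≤deg (λ {u} (_ , u∈) →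
      [ (λ (v∈A , _) → v∉A₀ (proj₂ (same v (notLow v∈)) v∈A))
      , (λ (_ , u∈A) → proj₂ (∈-∖⁻ u∈) (proj₂ (same u (notLow (proj₁ (∈-∖⁻ u∈)))) u∈A)) ]′))

  afford : ∀ v → v ∈ˢ K → Dec (deg G v ≤ D) → suc q * (2 * crossing G A v) ≤ suc (suc q) * deg G v
  afford v v∈C (yes low) = ≤-trans (*-monoʳ-≤ (suc q) (proj₂ (proj₂ settled) v low)) (m≤n+m _ (deg G v))
  afford v v∈C (no ¬low) = ≤-trans (*-monoʳ-≤ (suc q) bound) (≤-trans (≤-reflexive (*-distribˡ-+ (suc q) (k + 2) (deg G v)))
      (+-monoˡ-≤ _ (<⇒≤ (≰⇒> ¬low))))
    where
    v∈V = ∈-setOf⁺ high? (v∈C , ≰⇒> ¬low)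
    c = crossing G A v
    bound : 2 * c ≤ (k + 2) + deg G v
    bound = +-cancelʳ-≤ (deg G v) _ _ (begin
      2 * c + deg G v                      ≤⟨ +-monoʳ-≤ (2 * c) (≤-trans (deg≤ v∈V) (+-monoˡ-≤ k (≤2+2*halfDown (deg GV v)))) ⟩
      2 * c + (2 + 2 * a v + k)            ≡⟨ shape c (a v) k ⟩
      (k + 2) + ((c + a v) + (c + a v))    ≤⟨ +-monoʳ-≤ (k + 2) (+-mono-≤ (crossing+a≤deg v∈V (v ∈? A₀)) (crossing+a≤deg v∈V (v ∈? A₀))) ⟩
      (k + 2) + (deg G v + deg G v)        ≡⟨ +-assoc (k + 2) (deg G v) (deg G v) ⟨
      (k + 2) + deg G v + deg G v          ∎)
      where
      open ≤-Reasoning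
      shape : ∀ c a k → 2 * c + (2 + 2 * a + k) ≡ (k + 2) + ((c + a) + (c + a))
      shape = solve 3 (λ c a k → con 2 :* c :+ (con 2 :+ con 2 :* a :+ k) := (k :+ con 2) :+ ((c :+ a) :+ (c :+ a))) refl
        where open +-*-Solver

between : (G : Graph n) (K A : Subset n) → Graph n
between G K A = record
  { vertices = K
  ; Adj      = λ u v → Adj (induced G K) u v × Apart A u v
  ; adj?     = λ u v → adj? (induced G K) u v ×-dec apart? A u v
  ; adj-sym  = λ (g , ap) → adj-sym (induced G K) g , apart-sym A ap
  ; adj-irr  = adj-irr G ∘ proj₁ ∘ proj₁
  ; adj-∈    = proj₁ ∘ proj₂ ∘ proj₁
  }

separates : ∀ (G : Graph n) K A {x y} → x ∈ˢ K → y ∈ˢ K → x ∈ˢ A → y ∉ˢ A →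
  ¬ Connected (induced G K ─ between G K A)
separates G K A x∈C y∈C x∈A y∉A conn = y∉A (stay (conn x∈C y∈C) x∈A)
  where
  stay : ∀ {u v} → Reachable (induced G K ─ between G K A) u v → u ∈ˢ A → v ∈ˢ A
  stay Star.ε u∈A = u∈A
  stay (_◅_ {j = w} (uw , ¬between) path) u∈A with w ∈? A
  ... | yes w∈A = stay path w∈A
  ... | no  w∉A = contradiction (uw , inj₁ (u∈A , w∉A)) ¬between

giant-cut : ∀ {k} (G : Graph n) q K → (∀ v → v ∈ˢ vertices G) → NoLowTree G (suc q * (k + 2)) k →
  (∃ λ v → suc q * (k + 2) < deg G v) → IsLargestComponent G K →
  ∃ λ H → SpanningSubgraph H (induced G K) ×
    (∀ v → v ∈ˢ K → suc q * (2 * deg H v) ≤ suc (suc q) * deg (induced G K) v) ×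
    ¬ Connected (induced G K ─ H)
giant-cut {n} {k} G q K all∈ none high giant@((r , _ , iff) , _) =
  let A , (x , x∈C , x∈A) , (y , y∈C , y∉A) , afford = affordable-cut G q K none
        (giant-high G _ K (≤-trans (m≤m+n k 2) (m≤m+n (k + 2) (q * (k + 2)))) all∈ none high giant) closed
  in between G K A , (refl , proj₁)
   , (λ v v∈C → ≤-trans (*-monoʳ-≤ (suc q) (*-monoʳ-≤ 2 (≤-trans (≤-reflexive (deg≡∑ (between G K A) v))
        (∑-mono (allFin n) (λ u → ⟦⟧-mono (adj? (between G K A) v u) (adj? G v u ×-dec apart? A v u) (λ ((vu , _) , ap) → vu , ap))))))
      (≤-trans (afford v v∈C) (*-monoʳ-≤ (suc (suc q)) (≤-trans (≤-reflexive (deg≡∑ G v)) (≤-trans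
        (∑-mono (allFin n) (λ u → ⟦⟧-mono (adj? G v u) (adj? (induced G K) v u) (λ vu → vu , v∈C , closed v∈C vu)))
        (≤-reflexive (sym (deg≡∑ (induced G K) v))))))))
   , separates G K A x∈C y∈C x∈A y∉A
  where
  closed : ∀ {u v} → u ∈ˢ K → Adj G u v → v ∈ˢ K
  closed u∈C uv = Equivalence.from (iff _) (Equivalence.to (iff _) u∈C ◅◅ (uv ◅ Star.ε))

-- The list of all edges and its length

ends : Edge n → Fin n × Fin n
ends e = lo e , hi e

ends-injective : ∀ {e f : Edge n} → ends e ≡ ends f → e ≡ f
ends-injective {e = edge _ _ _} {edge _ _ _} refl = refl

joins-ends : ∀ {e f : Edge n} → Joins f (lo e) (hi e) → f ≡ e
joins-ends {e = edge _ _ _} {edge _ _ _} (inj₁ (refl , refl)) = refl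
joins-ends {e = edge _ _ p} {edge _ _ q} (inj₂ (refl , refl)) = ⊥-elim-irr (Fin.<-asym p q)

joins-unique : ∀ {u v} {e f : Edge n} → Joins e u v → Joins f u v → e ≡ f
joins-unique {e = edge _ _ _} {edge _ _ _} (inj₁ (refl , refl)) (inj₁ (refl , refl)) = refl
joins-unique {e = edge _ _ _} {edge _ _ _} (inj₂ (refl , refl)) (inj₂ (refl , refl)) = refl
joins-unique {e = edge _ _ p} {edge _ _ q} (inj₁ (refl , refl)) (inj₂ (refl , refl)) = ⊥-elim-irr (Fin.<-asym p q)
joins-unique {e = edge _ _ p} {edge _ _ q} (inj₂ (refl , refl)) (inj₁ (refl , refl)) = ⊥-elim-irr (Fin.<-asym p q)

-- The function listing the edges is local to allEdges, so it is recovered by unification.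
private
  listing : ∀ n → ∃ λ f → allEdges n ≡ mapMaybe f (cartesianProduct (allFin n) (allFin n))
  listing n = _ , refl

toEdge : Fin n × Fin n → Maybe (Edge n)
toEdge {n} = proj₁ (listing n)

toEdge-just : ∀ {u v : Fin n} .(u<v : u Fin.< v) → toEdge (u , v) ≡ just (edge u v u<v)
toEdge-just {u = u} {v} u<v with u Fin.<? v
... | yes _ = refl
... | no ¬p = ⊥-elim-irr (¬p u<v)

toEdge-nothing : ∀ {u v : Fin n} → ¬ u Fin.< v → toEdge (u , v) ≡ nothing
toEdge-nothing {u = u} {v} u≮v with u Fin.<? v
... | yes u<v = contradiction u<v u≮v
... | no _    = refl

toEdge-ends : ∀ (uv : Fin n × Fin n) {e} → toEdge uv ≡ just e → ends e ≡ uv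
toEdge-ends (u , v) eq with u Fin.<? v
toEdge-ends (u , v) refl | yes _ = refl
toEdge-ends (u , v) ()   | no _

∈-mapMaybe⁺ : ∀ (f : α → Maybe β) {x y xs} → x ∈ xs → f x ≡ just y → y ∈ mapMaybe f xs
∈-mapMaybe⁺ f {xs = x ∷ xs} (here refl) eq rewrite eq = here refl
∈-mapMaybe⁺ f {xs = z ∷ xs} (there x∈) eq with f z
... | just _  = there (∈-mapMaybe⁺ f x∈ eq)
... | nothing = ∈-mapMaybe⁺ f x∈ eq

∈-mapMaybe⁻ : ∀ (f : α → Maybe β) {y} xs → y ∈ mapMaybe f xs → ∃ λ x → x ∈ xs × f x ≡ just y
∈-mapMaybe⁻ f (x ∷ xs) y∈ with f x in eq
∈-mapMaybe⁻ f (x ∷ xs) (here refl) | just _  = x , here refl , eq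
∈-mapMaybe⁻ f (x ∷ xs) (there y∈)  | just _  = let z , z∈ , p = ∈-mapMaybe⁻ f xs y∈ in z , there z∈ , p
∈-mapMaybe⁻ f (x ∷ xs) y∈          | nothing = let z , z∈ , p = ∈-mapMaybe⁻ f xs y∈ in z , there z∈ , p

mapMaybe-unique : ∀ (f : α → Maybe β) → (∀ {x y z} → f x ≡ just z → f y ≡ just z → x ≡ y) →
  ∀ {xs} → Unique xs → Unique (mapMaybe f xs)
mapMaybe-unique f inj [] = []
mapMaybe-unique f inj {x ∷ xs} (x∉ ∷ u) with f x in eq
... | nothing = mapMaybe-unique f inj u
... | just y  = All.tabulate (λ {w} w∈ y≡w → let z , z∈ , fz = ∈-mapMaybe⁻ f xs w∈ in
    All.lookup x∉ z∈ (inj eq (trans fz (cong just (sym y≡w))))) ∷ mapMaybe-unique f inj u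

allEdges-unique : ∀ n → Unique (allEdges n)
allEdges-unique n = mapMaybe-unique toEdge
  (λ {x} {y} p q → trans (sym (toEdge-ends x p)) (toEdge-ends y q))
  (Unique.cartesianProduct⁺ (Unique.allFin⁺ n) (Unique.allFin⁺ n))

∈-allEdges : ∀ (e : Edge n) → e ∈ allEdges n
∈-allEdges (edge u v u<v) = ∈-mapMaybe⁺ toEdge (∈-cartesianProduct⁺ (∈-allFin u) (∈-allFin v))
  (toEdge-just u<v)

length-mapMaybe : ∀ (f : α → Maybe β) {P : Pred α 0ℓ} (P? : Decidable P) →
  (∀ {x} → P x → ∃ λ y → f x ≡ just y) → (∀ {x} → ¬ P x → f x ≡ nothing) →
  ∀ xs → length (mapMaybe f xs) ≡ ∑[ x ← xs ] ⟦ P? x ⟧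
length-mapMaybe f P? h k []       = refl
length-mapMaybe f P? h k (x ∷ xs) with P? x
... | yes p rewrite proj₂ (h p) = cong suc (length-mapMaybe f P? h k xs)
... | no ¬p rewrite k ¬p        = length-mapMaybe f P? h k xs

∑-cartesianProduct : ∀ (xs : List α) (ys : List β) (f : α × β → ℕ) →
  ∑ (cartesianProduct xs ys) f ≡ ∑[ x ← xs ] ∑[ y ← ys ] f (x , y)
∑-cartesianProduct []       ys f = refl
∑-cartesianProduct (x ∷ xs) ys f = trans (∑-++ (map (x ,_) ys) _ f) (cong₂ _+_ (∑-map (x ,_) ys f) (∑-cartesianProduct xs ys f))

∑-allFin-suc : ∀ n (f : Fin (suc n) → ℕ) → ∑ (allFin (suc n)) f ≡ f Fin.zero + ∑ (allFin n) (f ∘ Fin.suc)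
∑-allFin-suc n f = cong (f Fin.zero +_) (trans (cong (λ xs → ∑ xs f) (sym (map-tabulate id Fin.suc))) (∑-map Fin.suc (allFin n) f))

pairs-C : ∀ n → ∑[ u ← allFin n ] ∑[ v ← allFin n ] ⟦ u Fin.<? v ⟧ ≡ n C 2
pairs-C zero    = refl
pairs-C (suc n) = trans (∑-allFin-suc n (λ u → ∑[ v ← allFin (suc n) ] ⟦ u Fin.<? v ⟧)) (trans (cong₂ _+_ row₀ rows) (nCk+nC[k+1]≡[n+1]C[k+1] n 1))
  where
  row₀ : ∑[ v ← allFin (suc n) ] ⟦ Fin.zero {n} Fin.<? v ⟧ ≡ n C 1
  row₀ = trans (∑-allFin-suc n (λ v → ⟦ Fin.zero {n} Fin.<? v ⟧)) (trans (∑-cong (allFin n) (λ v → ⟦⟧-yes (Fin.zero {n} Fin.<? Fin.suc v) (s≤s z≤n)))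
    (trans (∑-const (allFin n) 1) (trans (*-identityʳ (length (allFin n))) (trans (length-allFin n) (sym (nC1≡n n))))))
    where
    length-allFin : ∀ n → length (allFin n) ≡ n
    length-allFin n = length-tabulate id
  rows : ∑[ u ← allFin n ] ∑[ v ← allFin (suc n) ] ⟦ Fin.suc u Fin.<? v ⟧ ≡ n C 2
  rows = trans (∑-cong (allFin n) (λ u → trans (∑-allFin-suc n (λ v → ⟦ Fin.suc u Fin.<? v ⟧))
    (cong₂ _+_ (⟦⟧-no (Fin.suc u Fin.<? Fin.zero {n}) λ ()) (∑-cong (allFin n) (λ v →
      ⟦⟧-cong (Fin.suc u Fin.<? Fin.suc v) (u Fin.<? v) s≤s⁻¹ s≤s))))) (pairs-C n)

length-allEdges : ∀ n → length (allEdges n) ≡ n C 2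
length-allEdges n = trans (length-mapMaybe toEdge (λ (u , v) → u Fin.<? v)
  (λ u<v → _ , toEdge-just u<v) toEdge-nothing (cartesianProduct (allFin n) (allFin n)))
  (trans (∑-cartesianProduct (allFin n) (allFin n) _) (pairs-C n))

n+2*nC2≡n*n : ∀ n → n + 2 * (n C 2) ≡ n * n
n+2*nC2≡n*n zero    = refl
n+2*nC2≡n*n (suc n) = trans (cong (λ c → suc n + 2 * c) (trans (sym (nCk+nC[k+1]≡[n+1]C[k+1] n 1)) (cong (_+ n C 2) (nC1≡n n))))
  (trans (regroup n (n C 2)) (trans (cong (λ s → suc (2 * n + s)) (n+2*nC2≡n*n n)) (square n)))
  where
  open +-*-Solver
  regroup : ∀ n c → suc n + 2 * (n + c) ≡ suc (2 * n + (n + 2 * c))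
  regroup = solve 2 (λ n c → (con 1 :+ n) :+ con 2 :* (n :+ c) := con 1 :+ (con 2 :* n :+ (n :+ con 2 :* c))) refl
  square : ∀ n → suc (2 * n + n * n) ≡ suc n * suc n
  square = solve 1 (λ n → con 1 :+ (con 2 :* n :+ n :* n) := (con 1 :+ n) :* (con 1 :+ n)) refl

-- The process as a uniform choice among edge sequences

present? : ∀ (es : List (Edge n)) (e : Edge n) → Dec (Adj (graphOf es) (lo e) (hi e))
present? es e = adj? (graphOf es) (lo e) (hi e)

∈⇒present : ∀ {es : List (Edge n)} {e} → e ∈ es → Adj (graphOf es) (lo e) (hi e)
∈⇒present e∈ = lose e∈ (inj₁ (refl , refl))

present⇒∈ : ∀ {es : List (Edge n)} {e} → Adj (graphOf es) (lo e) (hi e) → e ∈ es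
present⇒∈ = Any.map (λ {f} j → sym (joins-ends {f = f} j))

missing⇒∉ : ∀ {es : List (Edge n)} {e} → e ∈ missing es → e ∉ es
missing⇒∉ {n} {es} e∈ e∈es = proj₂ (∈-filter⁻ (λ e → ¬? (present? es e)) {xs = allEdges n} e∈) (∈⇒present e∈es)

missing-unique : ∀ (es : List (Edge n)) → Unique (missing es)
missing-unique es = Unique.filter⁺ (λ e → ¬? (present? es e)) (allEdges-unique _)

length-missing : ∀ {es : List (Edge n)} → Unique es → length (missing es) + length es ≡ n C 2
length-missing {n} {es} u = trans (cong₂ _+_ (length-filter (λ e → ¬? (present? es e)) (allEdges n))
  (≤-antisym (length-⊆ u (λ {e} e∈ → ∈-filter⁺ (present? es) (∈-allEdges e) (∈⇒present e∈)))
    (length-⊆ (Unique.filter⁺ (present? es) (allEdges-unique n)) (present⇒∈ ∘ proj₂ ∘ ∈-filter⁻ (present? es) {xs = allEdges n}))))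
  (trans (cong (∑ (allEdges n) (λ e → ⟦ ¬? (present? es e) ⟧) +_) (length-filter (present? es) (allEdges n)))
  (trans (sym (∑-+ (allEdges n) _ _)) (trans (∑-cong (allEdges n) (λ e → complement (present? es e)))
  (trans (∑-const (allEdges n) 1) (trans (*-identityʳ _) (length-allEdges n))))))
  where
  complement : ∀ {P : Set} (P? : Dec P) → ⟦ ¬? P? ⟧ + ⟦ P? ⟧ ≡ 1
  complement (yes _) = refl
  complement (no _)  = refl

seqs : ∀ n → ℕ → List (List (Edge n))
seqs n zero    = [] ∷ []
seqs n (suc i) = concatMap (λ es → map (es ∷ʳ_) (missing es)) (seqs n i)

IsSeq : ℕ → List (Edge n) → Set
IsSeq i es = Unique es × length es ≡ i

∷ʳ-isSeq : ∀ {i} {es : List (Edge n)} {e} → IsSeq i es → e ∉ es → IsSeq (suc i) (es ∷ʳ e)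
∷ʳ-isSeq {es = es} (u , len) e∉ =
  Unique.++⁺ u ([] ∷ []) (λ { (x∈ , here refl) → e∉ x∈ })
  , trans (length-++ es) (trans (+-comm (length es) 1) (cong suc len))

seqs-isSeq : ∀ n i → All (IsSeq i) (seqs n i)
seqs-isSeq n zero    = ([] , refl) ∷ []
seqs-isSeq n (suc i) = All.concat⁺ (All.map⁺ (All.map (λ isSeq →
  All.map⁺ (All.tabulate (λ e∈ → ∷ʳ-isSeq isSeq (missing⇒∉ e∈)))) (seqs-isSeq n i)))

length-missing-seq : ∀ {i} {es : List (Edge n)} → IsSeq i es → length (missing es) ≡ (n C 2) ∸ i
length-missing-seq {es = es} (u , refl) = trans (sym (m+n∸n≡m (length (missing es)) (length es))) (cong (_∸ length es) (length-missing u))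

-- The probability of any one sequence of `i` edges. For `i < N`, `suc (N ∸ suc i)` is the number
-- `N ∸ i` of missing edges in a form that is visibly nonzero.
weight : ℕ → ℕ → ℚ
weight N zero    = 1ℚ
weight N (suc i) = weight N i ℚ.* (ℤ.+ 1 ℚ./ suc (N ∸ suc i))

step-uniform : ∀ (g : α → β) w xs →
  concatMap (λ (x , p) → map (λ (y , q) → y , p ℚ.* q) (always (g x))) (map (λ x → x , w) xs) ≡ map (λ x → g x , w) xs
step-uniform g w []       = refl
step-uniform g w (x ∷ xs) = cong₂ _∷_ (cong (g x ,_) (ℚ.*-identityʳ w)) (step-uniform g w xs)

scale : ∀ (g : α → β) p w xs → map (λ (y , q) → y , p ℚ.* q) (map (λ x → g x , w) xs) ≡ map (_, p ℚ.* w) (map g xs)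
scale g p w []       = refl
scale g p w (x ∷ xs) = cong (_ ∷_) (scale g p w xs)

uniform≡ : ∀ {j} (xs : List α) → length xs ≡ suc j → uniform xs ≡ map (λ x → x , ℤ.+ 1 ℚ./ suc j) xs
uniform≡ (x ∷ xs) refl = refl

-- The number of missing edges depends on `i` alone, so all sequences get the same weight. Both
-- lists are built in the same order, hence are equal and not just equal in distribution.
process-uniform : ∀ n i → i ≤ n C 2 → processUpTo n i ≡ map (_, weight (n C 2) i) (seqs n i)
process-uniform n zero    _  = refl
process-uniform n (suc i) i< = trans (cong (_>>= next) (process-uniform n i (<⇒≤ i<))) (go (seqs n i) (seqs-isSeq n i))
  where
  next : List (Edge n) → Dist (List (Edge n))
  next es = uniform (missing es) >>= λ e → always (es ∷ʳ e)
  c = weight (n C 2) i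
  c′ = weight (n C 2) (suc i)
  go : ∀ ess → All (IsSeq i) ess →
    (map (_, c) ess >>= next) ≡ map (_, c′) (concatMap (λ es → map (es ∷ʳ_) (missing es)) ess)
  go []         _          = refl
  go (es ∷ ess) (isSeq ∷ h) = trans (cong₂ _++_
    (trans (cong (λ d → map (λ (y , q) → y , c ℚ.* q) (d >>= λ e → always (es ∷ʳ e)))
        (uniform≡ (missing es) (trans (length-missing-seq isSeq) (+-∸-assoc 1 i<))))
      (trans (cong (map _) (step-uniform (es ∷ʳ_) _ (missing es))) (scale (es ∷ʳ_) c _ (missing es))))
    (go ess h)) (sym (map-++ (_, c′) (map (es ∷ʳ_) (missing es)) _))

-- From counts of edge sequences to probabilities

fromNat : ℕ → ℚ
fromNat m = ℤ.+ m ℚ./ 1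

fromNat-≃ : ∀ m → ℚ.toℚᵘ (fromNat m) ℚᵘ.≃ mkℚᵘ (ℤ.+ m) 0
fromNat-≃ m = ℚ.toℚᵘ-fromℚᵘ (mkℚᵘ (ℤ.+ m) 0)

fromNat-+ : ∀ l m → fromNat (l + m) ≡ fromNat l ℚ.+ fromNat m
fromNat-+ l m = ℚ.toℚᵘ-injective (ℚᵘ.≃-trans (fromNat-≃ (l + m)) (ℚᵘ.≃-sym
  (ℚᵘ.≃-trans (ℚ.toℚᵘ-homo-+ (fromNat l) (fromNat m)) (ℚᵘ.≃-trans (ℚᵘ.+-cong (fromNat-≃ l) (fromNat-≃ m))
    (*≡* (cong (ℤ._* ℤ.+ 1) (cong₂ ℤ._+_ (ℤ.*-identityʳ (ℤ.+ l)) (ℤ.*-identityʳ (ℤ.+ m)))))))))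

fromNat-* : ∀ l m → fromNat (l * m) ≡ fromNat l ℚ.* fromNat m
fromNat-* l m = ℚ.toℚᵘ-injective (ℚᵘ.≃-trans (fromNat-≃ (l * m)) (ℚᵘ.≃-sym
  (ℚᵘ.≃-trans (ℚ.toℚᵘ-homo-* (fromNat l) (fromNat m)) (ℚᵘ.≃-trans (ℚᵘ.*-cong (fromNat-≃ l) (fromNat-≃ m))
    (*≡* (cong (ℤ._* ℤ.+ 1) (sym (ℤ.pos-* l m))))))))

fromNat-mono : ∀ {l m} → l ≤ m → fromNat l ℚ.≤ fromNat m
fromNat-mono {l} {m} l≤m = ℚ.toℚᵘ-cancel-≤ (ℚᵘ.≤-trans (ℚᵘ.≤-reflexive (fromNat-≃ l))
  (ℚᵘ.≤-trans (*≤* (ℤ.*-monoʳ-≤-nonNeg (ℤ.+ 1) (ℤ.+≤+ l≤m))) (ℚᵘ.≤-reflexive (ℚᵘ.≃-sym (fromNat-≃ m)))))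

fromNat≥0 : ∀ m → ℚ.NonNegative (fromNat m)
fromNat≥0 m = ℚ.normalize-nonNeg m 1

inverse : ℕ → ℚ
inverse m = ℤ.+ 1 ℚ./ suc m

fromNat*inverse : ∀ m → fromNat (suc m) ℚ.* inverse m ≡ 1ℚ
fromNat*inverse m = ℚ.toℚᵘ-injective
  (ℚᵘ.≃-trans (ℚ.toℚᵘ-homo-* (fromNat (suc m)) (inverse m))
  (ℚᵘ.≃-trans (ℚᵘ.*-cong (fromNat-≃ (suc m)) (ℚ.toℚᵘ-fromℚᵘ (mkℚᵘ (ℤ.+ 1) m)))
  (*≡* (trans (ℤ.*-identityʳ (ℤ.+ (suc m * 1))) (trans (cong ℤ.+_ (cong suc (trans (*-identityʳ m) (sym (+-identityʳ m))))) (sym (ℤ.*-identityˡ (ℤ.+ (1 * suc m)))))))))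

fromNat-cancel : ∀ {l m} → fromNat l ℚ.≤ fromNat m → l ≤ m
fromNat-cancel {l} {m} h with l ≤? m
... | yes l≤m = l≤m
... | no  l≰m = contradiction (ℚ.<-≤-trans (strict (≰⇒> l≰m)) h) (ℚ.<-irrefl refl)
  where
  strict : m < l → fromNat m ℚ.< fromNat l
  strict m<l = ℚ.<-≤-trans (subst (ℚ._< fromNat (suc m)) (ℚ.+-identityˡ (fromNat m))
    (subst (0ℚ ℚ.+ fromNat m ℚ.<_) (sym (fromNat-+ 1 m)) (ℚ.+-monoˡ-< (fromNat m) (ℚ.positive⁻¹ 1ℚ)))) (fromNat-mono m<l)

Pr-map : ∀ {α : Set} {E : Pred α 0ℓ} (E? : Decidable E) w xs →
  Pr (map (_, w) xs) E? ≡ fromNat (∑[ x ← xs ] ⟦ E? x ⟧) ℚ.* w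
Pr-map E? w []       = sym (ℚ.*-zeroˡ w)
Pr-map E? w (x ∷ xs) with E? x
... | no _  = Pr-map E? w xs
... | yes _ = trans (cong (w ℚ.+_) (Pr-map E? w xs)) (trans (cong (ℚ._+ fromNat s ℚ.* w) (sym (ℚ.*-identityˡ w)))
    (trans (sym (ℚ.*-distribʳ-+ w 1ℚ (fromNat s))) (cong (ℚ._* w) (sym (fromNat-+ 1 s)))))
  where s = ∑[ x ← xs ] ⟦ E? x ⟧

length-seqs : ∀ n i → length (seqs n (suc i)) ≡ length (seqs n i) * ((n C 2) ∸ i)
length-seqs n i = trans (length-concatMap _ (seqs n i)) (go (seqs n i) (seqs-isSeq n i))
  where
  go : ∀ ess → All (IsSeq i) ess → ∑[ es ← ess ] length (map (es ∷ʳ_) (missing es)) ≡ length ess * ((n C 2) ∸ i)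
  go []         _           = refl
  go (es ∷ ess) (isSeq ∷ h) = cong₂ _+_ (trans (length-map (es ∷ʳ_) (missing es)) (length-missing-seq isSeq)) (go ess h)

total-weight : ∀ n i → i ≤ n C 2 → fromNat (length (seqs n i)) ℚ.* weight (n C 2) i ≡ 1ℚ
total-weight n zero    _  = refl
total-weight n (suc i) i< = trans
  (cong (λ s → fromNat s ℚ.* weight (n C 2) (suc i)) (trans (length-seqs n i) (cong (length (seqs n i) *_) (+-∸-assoc 1 i<))))
  (trans (cong (ℚ._* weight (n C 2) (suc i)) (fromNat-* (length (seqs n i)) (suc j)))
  (trans (interchange (fromNat (length (seqs n i))) (fromNat (suc j)) (weight (n C 2) i) (inverse j))
  (trans (cong₂ ℚ._*_ (total-weight n i (<⇒≤ i<)) (fromNat*inverse j)) (ℚ.*-identityˡ 1ℚ))))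
  where
  j = (n C 2) ∸ suc i
  interchange : ∀ a b c d → (a ℚ.* b) ℚ.* (c ℚ.* d) ≡ (a ℚ.* c) ℚ.* (b ℚ.* d)
  interchange = solve 4 (λ a b c d → (a :* b) :* (c :* d) := (a :* c) :* (b :* d)) refl
    where open ℚSolver.+-*-Solver

weight≥0 : ∀ N i → ℚ.NonNegative (weight N i)
weight≥0 N zero    = _
weight≥0 N (suc i) = ℚ.nonNeg*nonNeg⇒nonNeg (weight N i) {{weight≥0 N i}} (inverse (N ∸ suc i)) {{ℚ.normalize-nonNeg 1 (suc (N ∸ suc i))}}

-- The passage from probabilities to counting: as all complete sequences weigh the same and the
-- total weight is 1, the failures weigh at most `inverse q`, that is 1/(q + 1).
Pr-bound : ∀ n {E : Pred (List (Edge n)) 0ℓ} (E? : Decidable E) q →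
  (∑[ ω ← seqs n (n C 2) ] ⟦ ¬? (E? ω) ⟧) * suc q ≤ length (seqs n (n C 2)) →
  1ℚ ℚ.- inverse q ℚ.≤ Pr (randomGraphProcess n) E?
Pr-bound n E? q h = begin
  1ℚ ℚ.- inverse q                                     ≤⟨ ℚ.+-monoʳ-≤ 1ℚ (ℚ.neg-antimono-≤ bad≤) ⟩
  1ℚ ℚ.- fromNat bad ℚ.* w                             ≡⟨ cong (ℚ._- fromNat bad ℚ.* w) (sym total) ⟩
  (fromNat good ℚ.* w ℚ.+ fromNat bad ℚ.* w) ℚ.- fromNat bad ℚ.* w ≡⟨ cancel (fromNat good ℚ.* w) (fromNat bad ℚ.* w) ⟩
  fromNat good ℚ.* w                                   ≡⟨ Pr-map E? w (seqs n N) ⟨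
  Pr (map (_, w) (seqs n N)) E?                        ≡⟨ cong (λ d → Pr d E?) (process-uniform n N ≤-refl) ⟨
  Pr (randomGraphProcess n) E?                         ∎
  where
  open ℚ.≤-Reasoning
  N = n C 2
  w = weight N N
  good = ∑[ ω ← seqs n N ] ⟦ E? ω ⟧
  bad  = ∑[ ω ← seqs n N ] ⟦ ¬? (E? ω) ⟧
  one : ∀ {P : Set} (P? : Dec P) → ⟦ P? ⟧ + ⟦ ¬? P? ⟧ ≡ 1
  one (yes _) = refl
  one (no _)  = refl
  good+bad : good + bad ≡ length (seqs n N)
  good+bad = trans (sym (∑-+ (seqs n N) _ _)) (trans (∑-cong (seqs n N) (λ ω → one (E? ω)))
    (trans (∑-const (seqs n N) 1) (*-identityʳ (length (seqs n N)))))
  total : fromNat good ℚ.* w ℚ.+ fromNat bad ℚ.* w ≡ 1ℚ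
  total = trans (sym (ℚ.*-distribʳ-+ w (fromNat good) (fromNat bad))) (trans
    (cong (ℚ._* w) (trans (sym (fromNat-+ good bad)) (cong fromNat good+bad))) (total-weight n N ≤-refl))
  cancel : ∀ a b → (a ℚ.+ b) ℚ.- b ≡ a
  cancel = solve 2 (λ a b → (a :+ b) :- b := a) refl
    where open ℚSolver.+-*-Solver
  bad≤ : fromNat bad ℚ.* w ℚ.≤ inverse q
  bad≤ = begin
    fromNat bad ℚ.* w                                     ≡⟨ ℚ.*-identityʳ (fromNat bad ℚ.* w) ⟨
    fromNat bad ℚ.* w ℚ.* 1ℚ                              ≡⟨ cong (fromNat bad ℚ.* w ℚ.*_) (fromNat*inverse q) ⟨
    fromNat bad ℚ.* w ℚ.* (fromNat (suc q) ℚ.* inverse q) ≡⟨ shuffle (fromNat bad) w (fromNat (suc q)) (inverse q) ⟩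
    (fromNat bad ℚ.* fromNat (suc q)) ℚ.* w ℚ.* inverse q ≡⟨ cong (λ s → s ℚ.* w ℚ.* inverse q) (fromNat-* bad (suc q)) ⟨
    fromNat (bad * suc q) ℚ.* w ℚ.* inverse q             ≤⟨ ℚ.*-monoʳ-≤-nonNeg (inverse q) {{ℚ.normalize-nonNeg 1 (suc q)}}
                                                              (ℚ.*-monoʳ-≤-nonNeg w {{weight≥0 N N}} (fromNat-mono {bad * suc q} {length (seqs n N)} h)) ⟩
    fromNat (length (seqs n N)) ℚ.* w ℚ.* inverse q       ≡⟨ cong (ℚ._* inverse q) (total-weight n N ≤-refl) ⟩
    1ℚ ℚ.* inverse q                                      ≡⟨ ℚ.*-identityˡ (inverse q) ⟩
    inverse q ∎
    where
    shuffle : ∀ a b c d → a ℚ.* b ℚ.* (c ℚ.* d) ≡ (a ℚ.* c) ℚ.* b ℚ.* d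
    shuffle = solve 4 (λ a b c d → a :* b :* (c :* d) := (a :* c) :* b :* d) refl
      where open ℚSolver.+-*-Solver

-- A lower bound for the logarithm

inverse-≃ : ∀ a → ℚ.toℚᵘ (inverse a) ℚᵘ.≃ mkℚᵘ (ℤ.+ 1) a
inverse-≃ a = ℚ.toℚᵘ-fromℚᵘ (mkℚᵘ (ℤ.+ 1) a)

inverse≥0 : ∀ a → ℚ.NonNegative (inverse a)
inverse≥0 a = ℚ.normalize-nonNeg 1 (suc a)

inverse-antimono : ∀ {a b} → a ≤ b → inverse b ℚ.≤ inverse a
inverse-antimono {a} {b} a≤b = ℚ.toℚᵘ-cancel-≤
  (ℚᵘ.≤-trans (ℚᵘ.≤-reflexive (inverse-≃ b))
  (ℚᵘ.≤-trans (*≤* (ℤ.*-monoˡ-≤-nonNeg (ℤ.+ 1) (ℤ.+≤+ (s≤s a≤b))))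
  (ℚᵘ.≤-reflexive (ℚᵘ.≃-sym (inverse-≃ a)))))

inverse-small : ∀ δ → 0ℚ ℚ.< δ → ∃ λ q → inverse q ℚ.≤ δ
inverse-small (mkℚ ℤ.+[1+ n ] d c) _ = d , ℚ.toℚᵘ-cancel-≤ (ℚᵘ.≤-trans (ℚᵘ.≤-reflexive (inverse-≃ d))
  (*≤* (ℤ.*-monoʳ-≤-nonNeg (ℤ.+ suc d) {ℤ.+ 1} {ℤ.+ suc n} (ℤ.+≤+ (s≤s z≤n)))))
inverse-small (mkℚ (ℤ.+ 0) d c) (ℚ.*<* (ℤ.+<+ ()))
inverse-small (mkℚ (ℤ.-[1+ n ]) d c) (ℚ.*<* ())

reciprocals-≥ : ∀ a c b → c + a ≤ suc b → fromNat c ℚ.* inverse b ℚ.≤ reciprocals a c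
reciprocals-≥ a zero    b _ = ℚ.≤-reflexive (ℚ.*-zeroˡ (inverse b))
reciprocals-≥ a (suc c) b h = begin
  fromNat (suc c) ℚ.* inverse b                  ≡⟨ cong (ℚ._* inverse b) (fromNat-+ 1 c) ⟩
  (1ℚ ℚ.+ fromNat c) ℚ.* inverse b               ≡⟨ ℚ.*-distribʳ-+ (inverse b) 1ℚ (fromNat c) ⟩
  1ℚ ℚ.* inverse b ℚ.+ fromNat c ℚ.* inverse b   ≡⟨ cong (ℚ._+ fromNat c ℚ.* inverse b) (ℚ.*-identityˡ (inverse b)) ⟩
  inverse b ℚ.+ fromNat c ℚ.* inverse b          ≤⟨ ℚ.+-mono-≤ (inverse-antimono (≤-trans (m≤n+m a c) (s≤s⁻¹ h)))
                                                      (reciprocals-≥ (suc a) c b (≤-trans (≤-reflexive (+-suc c a)) h)) ⟩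
  inverse a ℚ.+ reciprocals (suc a) c            ∎
  where open ℚ.≤-Reasoning

reciprocals-++ : ∀ a l m → reciprocals a (l + m) ≡ reciprocals a l ℚ.+ reciprocals (l + a) m
reciprocals-++ a zero    m = sym (ℚ.+-identityˡ (reciprocals a m))
reciprocals-++ a (suc l) m = trans
  (cong (inverse a ℚ.+_) (trans (reciprocals-++ (suc a) l m)
    (cong (λ z → reciprocals (suc a) l ℚ.+ reciprocals z m) (+-suc l a))))
  (sym (ℚ.+-assoc (inverse a) (reciprocals (suc a) l) (reciprocals (suc l + a) m)))

reciprocals≥0 : ∀ a l → 0ℚ ℚ.≤ reciprocals a l
reciprocals≥0 a zero    = ℚ.≤-refl
reciprocals≥0 a (suc l) = ℚ.+-mono-≤ (ℚ.nonNegative⁻¹ (inverse a) {{inverse≥0 a}}) (reciprocals≥0 (suc a) l)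

-- The `suc a` terms end with 1/(2a + 1), so each is at least 1/(2a + 2).
half-block : ∀ a → ½ ℚ.≤ reciprocals a (suc a)
half-block a = ℚ.≤-trans (ℚ.≤-reflexive (ℚ.toℚᵘ-injective (ℚᵘ.≃-sym
  (ℚᵘ.≃-trans (ℚ.toℚᵘ-homo-* (fromNat (suc a)) (inverse (suc (a + a))))
  (ℚᵘ.≃-trans (ℚᵘ.*-cong (fromNat-≃ (suc a)) (inverse-≃ (suc (a + a))))
  (*≡* (cong ℤ.+_ (double a))))))))
  (reciprocals-≥ a (suc a) (suc (a + a)) (n≤1+n _))
  where
  double : ∀ a → suc a * 1 * 2 ≡ 1 * (1 * suc (suc (a + a)))
  double = solve 1 (λ a → (con 1 :+ a) :* con 1 :* con 2 := con 1 :* (con 1 :* (con 2 :+ (a :+ a)))) refl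
    where open +-*-Solver using (solve; _:=_; _:*_; _:+_; con)

-- The sum of 1/j over 2^l c ≤ j < 2^(l+1) c is at least 1/2, for c = a + 1 and each l < L.
reciprocals-dyadic : ∀ L a e → fromNat L ℚ.* ½ ℚ.≤ reciprocals a (pred (2 ^ L) * suc a + e)
reciprocals-dyadic zero    a e = ℚ.≤-trans (ℚ.≤-reflexive (ℚ.*-zeroˡ ½)) (reciprocals≥0 a e)
reciprocals-dyadic (suc L) a e = begin
  fromNat (suc L) ℚ.* ½                      ≡⟨ cong (ℚ._* ½) (fromNat-+ 1 L) ⟩
  (1ℚ ℚ.+ fromNat L) ℚ.* ½                   ≡⟨ ℚ.*-distribʳ-+ ½ 1ℚ (fromNat L) ⟩
  1ℚ ℚ.* ½ ℚ.+ fromNat L ℚ.* ½               ≤⟨ ℚ.+-mono-≤ (half-block a) (reciprocals-dyadic L (suc a + a) e) ⟩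
  reciprocals a (suc a) ℚ.+ reciprocals (suc a + a) (pred (2 ^ L) * suc (suc a + a) + e) ≡⟨ reciprocals-++ a (suc a) _ ⟨
  reciprocals a (suc a + (pred (2 ^ L) * suc (suc a + a) + e)) ≡⟨ cong (reciprocals a) (steps (2 ^ L) (m^n>0 2 L)) ⟩
  reciprocals a (pred (2 ^ suc L) * suc a + e) ∎
  where
  open ℚ.≤-Reasoning
  steps : ∀ p → 0 < p → suc a + (pred p * suc (suc a + a) + e) ≡ pred (2 * p) * suc a + e
  steps (suc p) _ = trans (arrange a p e) (cong (λ z → z * suc a + e) (sym (+-suc p (p + 0))))
    where
    arrange : ∀ a p e → suc a + (p * suc (suc a + a) + e) ≡ (suc (p + (p + 0))) * suc a + e
    arrange = solve 3 (λ a p e → (con 1 :+ a) :+ (p :* (con 1 :+ (con 1 :+ a :+ a)) :+ e)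
      := (con 1 :+ (p :+ (p :+ con 0))) :* (con 1 :+ a) :+ e) refl
      where open +-*-Solver using (solve; _:=_; _:*_; _:+_; con)

-- Each of the `L` dyadic blocks contributes at least 1/2. This is weaker than log 2 but holds for
-- every Riemann sum, so no limit has to be taken.
logApprox≥ : ∀ n L i → 2 ^ L ≤ n → fromNat L ℚ.* ½ ℚ.≤ logApprox n i
logApprox≥ n L i h = ℚ.≤-trans (reciprocals-dyadic L i ((n ∸ 1 ∸ pred (2 ^ L)) * suc i))
  (ℚ.≤-reflexive (cong (reciprocals i) (trans (sym (*-distribʳ-+ (suc i) (pred (2 ^ L)) _))
    (cong (_* suc i) (m+[n∸m]≡n (pred-mono-≤ h))))))

-- Since log n ≥ L/2 and ε > 0, the hypothesis gives `m₀` at least nL/12 up to the slack in `_≤ᴿ_`.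
-- That slack is taken to be 1, which turns `m₀` into `suc m₀`.
many-edges : ∀ (ε : ℝ) → fromℚ 0ℚ <ᴿ ε → ∀ n m₀ L → 2 ^ L ≤ n →
  ((fromℚ 1ℚ +ᴿ ε) *ᴿ fromℚ (ℤ.+ 1 ℚ./ 6)) *ᴿ fromℕ n *ᴿ log n ≤ᴿ fromℕ m₀ → n * L ≤ 12 * suc m₀
many-edges ε (e , 0<e , I , ε≥) n m₀ L h hyp = fromNat-cancel (begin
  fromNat (n * L)                                   ≡⟨ fromNat-* n L ⟩
  fromNat n ℚ.* fromNat L                           ≡⟨ arrange (fromNat n) (fromNat L) ⟩
  twelve ℚ.* (sixth ℚ.* fromNat n ℚ.* (fromNat L ℚ.* ½)) ≤⟨ ℚ.*-monoˡ-≤-nonNeg twelve step ⟩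
  twelve ℚ.* (fromNat m₀ ℚ.+ 1ℚ)                    ≡⟨ cong (twelve ℚ.*_) (trans (ℚ.+-comm (fromNat m₀) 1ℚ) (sym (fromNat-+ 1 m₀))) ⟩
  fromNat 12 ℚ.* fromNat (suc m₀)                   ≡⟨ fromNat-* 12 (suc m₀) ⟨
  fromNat (12 * suc m₀)                             ∎)
  where
  open ℚ.≤-Reasoning
  twelve = fromNat 12
  sixth = ℤ.+ 1 ℚ./ 6
  J = proj₁ (hyp 1ℚ (ℚ.positive⁻¹ 1ℚ))
  i = I ⊔ J
  ε′ = approx ε i
  arrange : ∀ a b → a ℚ.* b ≡ twelve ℚ.* (sixth ℚ.* a ℚ.* (b ℚ.* ½))
  arrange = solve 2 (λ a b → a :* b := con twelve :* (con sixth :* a :* (b :* con ½))) refl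
    where open ℚSolver.+-*-Solver using (solve; _:=_; _:*_; _:+_; con)
  ε′≥0 : 0ℚ ℚ.≤ ε′
  ε′≥0 = ℚ.≤-trans (ℚ.<⇒≤ 0<e) (ℚ.≤-trans (ℚ.≤-reflexive (sym (ℚ.+-identityˡ e))) (ε≥ i (m≤m⊔n I J)))
  instance
    n≥0 = fromNat≥0 n
    L≥0 : ℚ.NonNegative (fromNat L ℚ.* ½)
    L≥0 = ℚ.nonNeg*nonNeg⇒nonNeg (fromNat L) {{fromNat≥0 L}} ½
  coefficient : sixth ℚ.* fromNat n ℚ.≤ (1ℚ ℚ.+ ε′) ℚ.* sixth ℚ.* fromNat n
  coefficient = ℚ.*-monoʳ-≤-nonNeg (fromNat n) (begin
    sixth                  ≡⟨ ℚ.*-identityˡ sixth ⟨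
    1ℚ ℚ.* sixth           ≤⟨ ℚ.*-monoʳ-≤-nonNeg sixth (ℚ.+-monoʳ-≤ 1ℚ ε′≥0) ⟩
    (1ℚ ℚ.+ ε′) ℚ.* sixth  ∎)
  step : sixth ℚ.* fromNat n ℚ.* (fromNat L ℚ.* ½) ℚ.≤ fromNat m₀ ℚ.+ 1ℚ
  step = begin
    sixth ℚ.* fromNat n ℚ.* (fromNat L ℚ.* ½)                    ≤⟨ ℚ.*-monoʳ-≤-nonNeg (fromNat L ℚ.* ½) coefficient ⟩
    (1ℚ ℚ.+ ε′) ℚ.* sixth ℚ.* fromNat n ℚ.* (fromNat L ℚ.* ½)    ≤⟨ ℚ.*-monoˡ-≤-nonNeg ((1ℚ ℚ.+ ε′) ℚ.* sixth ℚ.* fromNat n) {{front}} (logApprox≥ n L i h) ⟩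
    (1ℚ ℚ.+ ε′) ℚ.* sixth ℚ.* fromNat n ℚ.* logApprox n i        ≤⟨ proj₂ (hyp 1ℚ (ℚ.positive⁻¹ 1ℚ)) i (m≤n⊔m I J) ⟩
    fromNat m₀ ℚ.+ 1ℚ                                            ∎
    where
    front : ℚ.NonNegative ((1ℚ ℚ.+ ε′) ℚ.* sixth ℚ.* fromNat n)
    front = ℚ.nonNegative (ℚ.≤-trans (ℚ.nonNegative⁻¹ (sixth ℚ.* fromNat n) {{ℚ.nonNeg*nonNeg⇒nonNeg sixth (fromNat n)}}) coefficient)

-- Division turns the hypothesis into d ≤ ½ (1 + r) d′ with r = 1/(q + 1). From the index `I` on,
-- every approximation of ε is at least r, so the bound holds term by term.
affordable-real : ∀ (ε : ℝ) {e q} → Eventually (λ i → 0ℚ ℚ.+ e ℚ.≤ approx ε i) → inverse q ℚ.≤ e → ∀ d d′ →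
  suc q * (2 * d) ≤ suc (suc q) * d′ → fromℕ d ≤ᴿ (fromℚ ½ +ᴿ ε) *ᴿ fromℕ d′
affordable-real ε {e} {q} (I , ε≥) small d d′ h δ 0<δ = I , λ i I≤i → begin
  fromNat d                                            ≡⟨ expand (fromNat d) ⟩
  ½ ℚ.* (1ℚ ℚ.* (two ℚ.* fromNat d))                   ≡⟨ cong (λ u → ½ ℚ.* (u ℚ.* (two ℚ.* fromNat d))) (fromNat*inverse q) ⟨
  ½ ℚ.* (fromNat (suc q) ℚ.* r ℚ.* (two ℚ.* fromNat d)) ≡⟨ swap (fromNat (suc q)) r (two ℚ.* fromNat d) ⟩
  (½ ℚ.* r) ℚ.* (fromNat (suc q) ℚ.* (two ℚ.* fromNat d)) ≡⟨ cong ((½ ℚ.* r) ℚ.*_) (trans (cong (fromNat (suc q) ℚ.*_) (sym (fromNat-* 2 d))) (sym (fromNat-* (suc q) (2 * d)))) ⟩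
  (½ ℚ.* r) ℚ.* fromNat (suc q * (2 * d))              ≤⟨ ℚ.*-monoˡ-≤-nonNeg (½ ℚ.* r) (fromNat-mono {suc q * (2 * d)} {suc (suc q) * d′} h) ⟩
  (½ ℚ.* r) ℚ.* fromNat (suc (suc q) * d′)             ≡⟨ cong ((½ ℚ.* r) ℚ.*_) (trans (fromNat-* (suc (suc q)) d′) (cong (ℚ._* fromNat d′) (fromNat-+ 1 (suc q)))) ⟩
  (½ ℚ.* r) ℚ.* ((1ℚ ℚ.+ fromNat (suc q)) ℚ.* fromNat d′) ≡⟨ regroup r (fromNat (suc q)) (fromNat d′) ⟩
  (½ ℚ.* (fromNat (suc q) ℚ.* r) ℚ.+ ½ ℚ.* r) ℚ.* fromNat d′ ≡⟨ cong (λ u → (½ ℚ.* u ℚ.+ ½ ℚ.* r) ℚ.* fromNat d′) (fromNat*inverse q) ⟩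
  (½ ℚ.* 1ℚ ℚ.+ ½ ℚ.* r) ℚ.* fromNat d′                ≤⟨ ℚ.*-monoʳ-≤-nonNeg (fromNat d′) (ℚ.+-mono-≤ (ℚ.≤-reflexive (ℚ.*-identityʳ ½)) (half≤ i I≤i)) ⟩
  (½ ℚ.+ approx ε i) ℚ.* fromNat d′                    ≡⟨ ℚ.+-identityʳ ((½ ℚ.+ approx ε i) ℚ.* fromNat d′) ⟨
  (½ ℚ.+ approx ε i) ℚ.* fromNat d′ ℚ.+ 0ℚ             ≤⟨ ℚ.+-monoʳ-≤ ((½ ℚ.+ approx ε i) ℚ.* fromNat d′) (ℚ.<⇒≤ 0<δ) ⟩
  (½ ℚ.+ approx ε i) ℚ.* fromNat d′ ℚ.+ δ              ∎
  where
  open ℚ.≤-Reasoning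
  two = fromNat 2
  r = inverse q
  instance
    r≥0 = inverse≥0 q
    ½r≥0 : ℚ.NonNegative (½ ℚ.* r)
    ½r≥0 = ℚ.nonNeg*nonNeg⇒nonNeg ½ r
    d′≥0 = fromNat≥0 d′
  open ℚSolver.+-*-Solver using (solve; _:=_; _:*_; _:+_; con)
  expand : ∀ a → a ≡ ½ ℚ.* (1ℚ ℚ.* (two ℚ.* a))
  expand = solve 1 (λ a → a := con ½ :* (con 1ℚ :* (con two :* a))) refl
  swap : ∀ a b c → ½ ℚ.* (a ℚ.* b ℚ.* c) ≡ (½ ℚ.* b) ℚ.* (a ℚ.* c)
  swap = solve 3 (λ a b c → con ½ :* (a :* b :* c) := (con ½ :* b) :* (a :* c)) refl
  regroup : ∀ r a b → (½ ℚ.* r) ℚ.* ((1ℚ ℚ.+ a) ℚ.* b) ≡ (½ ℚ.* (a ℚ.* r) ℚ.+ ½ ℚ.* r) ℚ.* b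
  regroup = solve 3 (λ r a b → (con ½ :* r) :* ((con 1ℚ :+ a) :* b) := (con ½ :* (a :* r) :+ con ½ :* r) :* b) refl
  half≤ : ∀ i → I ≤ i → ½ ℚ.* r ℚ.≤ approx ε i
  half≤ i I≤i = begin
    ½ ℚ.* r     ≤⟨ ℚ.*-monoʳ-≤-nonNeg r (ℚ.≤ᵇ⇒≤ {½} {1ℚ} _) ⟩
    1ℚ ℚ.* r    ≡⟨ ℚ.*-identityˡ r ⟩
    r           ≤⟨ small ⟩
    e           ≡⟨ ℚ.+-identityˡ e ⟨
    0ℚ ℚ.+ e    ≤⟨ ε≥ i I≤i ⟩
    approx ε i  ∎

open +-*-Solver using (solve; _:=_; _:*_; _:+_; con)

-- Edges of a tree and edges at its children

InTree : List (Fin n × Fin n) → Edge n → Set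
InTree t e = Any (λ (p , x) → Joins e p x) t

inTree? : ∀ (t : List (Fin n × Fin n)) → Decidable (InTree t)
inTree? t e = Any.any? (λ (p , x) → joins? e p x) t

Touches : List (Fin n) → Edge n → Set
Touches xs e = lo e ∈ xs ⊎ hi e ∈ xs

touches? : ∀ (xs : List (Fin n)) → Decidable (Touches xs)
touches? xs e = DecMembership._∈?_ Fin._≟_ (lo e) xs ⊎-dec DecMembership._∈?_ Fin._≟_ (hi e) xs

grows? : ∀ (r : Fin n) t → Dec (Grows r t)
grows? r []            = yes tt
grows? r ((p , x) ∷ t) = DecMembership._∈?_ Fin._≟_ p (verts r t) ×-dec ¬? (DecMembership._∈?_ Fin._≟_ x (verts r t)) ×-dec grows? r t

lowTree? : ∀ (G : Graph n) D r t → Dec (LowTree G D r t)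
lowTree? G D r t = grows? r t ×-dec All.all? (λ (p , x) → adj? G p x ×-dec (deg G x ≤? D)) t

children-unique : ∀ (r : Fin n) t → Grows r t → Unique (map proj₂ t)
children-unique r []            _              = []
children-unique r ((p , x) ∷ t) (_ , x∉ , g) =
  All.tabulate (λ y∈ x≡y → x∉ (there (subst (_∈ map proj₂ t) (sym x≡y) y∈))) ∷ children-unique r t g

tree-verts : ∀ (r : Fin n) t → Grows r t → All (λ (p , x) → p ∈ verts r t × x ∈ verts r t) t
tree-verts r []            _            = []
tree-verts r ((p , x) ∷ t) (p∈ , _ , g) =
  (weaken p∈ , there (here refl)) ∷ All.map (λ (p∈ , x∈) → weaken p∈ , weaken x∈) (tree-verts r t g)
  where
  weaken : ∀ {v} → v ∈ verts r t → v ∈ verts r ((p , x) ∷ t)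
  weaken (here eq)  = here eq
  weaken (there v∈) = there (there v∈)

∑-inTree≤ : ∀ (t : List (Fin n × Fin n)) {es} → Unique es → ∑[ e ← es ] ⟦ inTree? t e ⟧ ≤ length t
∑-inTree≤ []            {es} u = ≤-trans (∑-mono es (λ e → ≤-reflexive (⟦⟧-no (inTree? [] e) λ ())))
  (≤-reflexive (trans (∑-const es 0) (*-zeroʳ (length es))))
∑-inTree≤ ((p , x) ∷ t) {es} u = ≤-trans (∑-mono es (λ e →
    ⟦⟧-cover (inTree? ((p , x) ∷ t) e) (joins? e p x) (inTree? t e) (λ { (here j) → inj₁ j ; (there i) → inj₂ i })))
  (≤-trans (≤-reflexive (∑-+ es _ _)) (+-mono-≤ (∑-unique≤1 (λ e → joins? e p x) u joins-unique) (∑-inTree≤ t u)))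

-- Different pairs of `t` give different edges: the edge of the last child ends in a vertex that is
-- new, whereas both ends of an older tree edge lie in `verts r t`.
∑-inTree≥ : ∀ (r : Fin n) t → Grows r t → ∀ {es} → All (λ (p , x) → Adj (graphOf es) p x) t →
  length t ≤ ∑[ e ← es ] ⟦ inTree? t e ⟧
∑-inTree≥ r []            _             []        = z≤n
∑-inTree≥ r ((p , x) ∷ t) (p∈ , x∉ , g) {es} (px ∷ pxs) = ≤-trans (+-mono-≤ joined (∑-inTree≥ r t g pxs))
  (≤-trans (≤-reflexive (sym (∑-+ es _ _))) (∑-mono es (λ e →
    ⟦⟧-disjoint (inTree? ((p , x) ∷ t) e) (joins? e p x) (inTree? t e) here there (disjoint e))))
  where
  joined : 1 ≤ ∑[ e ← es ] ⟦ joins? e p x ⟧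
  joined = go es px
    where
    go : ∀ es → Any (λ e → Joins e p x) es → 1 ≤ ∑[ e ← es ] ⟦ joins? e p x ⟧
    go (e ∷ es) (here j)  = ≤-trans (≤-reflexive (sym (⟦⟧-yes (joins? e p x) j))) (m≤m+n _ _)
    go (e ∷ es) (there i) = ≤-trans (go es i) (m≤n+m _ _)
  end : ∀ e {p′ x′} → Joins e p x → Joins e p′ x′ → x ≡ p′ ⊎ x ≡ x′
  end e (inj₁ (refl , refl)) (inj₁ (refl , refl)) = inj₂ refl
  end e (inj₁ (refl , refl)) (inj₂ (refl , refl)) = inj₁ refl
  end e (inj₂ (refl , refl)) (inj₁ (refl , refl)) = inj₁ refl
  end e (inj₂ (refl , refl)) (inj₂ (refl , refl)) = inj₂ refl
  disjoint : ∀ e → ¬ (Joins e p x × InTree t e)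
  disjoint e (j , i) = go (tree-verts r t g) i
    where
    go : ∀ {t′} → All (λ (p , x) → p ∈ verts r t × x ∈ verts r t) t′ → InTree t′ e → ⊥
    go ((p′∈ , x′∈) ∷ _) (here j′) = [ (λ { refl → x∉ p′∈ }) , (λ { refl → x∉ x′∈ }) ]′ (end e j j′)
    go (_ ∷ h) (there i)           = go h i

Alive : ℕ → List (Fin n) → List (Edge n) → Set
Alive D xs es = All (λ x → deg (graphOf es) x ≤ D) xs

alive? : ∀ D (xs : List (Fin n)) → Decidable (Alive D xs)
alive? D xs es = All.all? (λ x → deg (graphOf es) x ≤? D) xs

deg-∷ʳ : ∀ (es : List (Edge n)) e v → deg (graphOf es) v ≤ deg (graphOf (es ∷ʳ e)) v
deg-∷ʳ {n} es e v = ≤-trans (≤-reflexive (deg≡∑ (graphOf es) v)) (≤-trans (∑-mono (allFin n) (λ u →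
  ⟦⟧-mono (adj? (graphOf es) v u) (adj? (graphOf (es ∷ʳ e)) v u) Any.++⁺ˡ)) (≤-reflexive (sym (deg≡∑ (graphOf (es ∷ʳ e)) v))))

neighbours : Graph n → Fin n → List (Fin n)
neighbours {n} G v = filter (adj? G v) (allFin n)

-- The two ends of an edge at `x`, in increasing order, form a pair with `x` as its first or its
-- second entry. Listing both orders for each neighbour costs a factor 2, which only affects a
-- constant.
∑-touches≤ : ∀ D (xs : List (Fin n)) {es} → Unique es → Alive D xs es →
  ∑[ e ← es ] ⟦ touches? xs e ⟧ ≤ length xs * (2 * D)
∑-touches≤ {n} D xs {es} u alive = begin
  ∑[ e ← es ] ⟦ touches? xs e ⟧              ≡⟨ length-filter (touches? xs) es ⟨
  length (filter (touches? xs) es)           ≡⟨ length-map ends (filter (touches? xs) es) ⟨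
  length (map ends (filter (touches? xs) es)) ≤⟨ length-⊆ (Unique.map⁺ ends-injective (Unique.filter⁺ (touches? xs) u)) covered ⟩
  length (concatMap around xs)               ≡⟨ length-concatMap around xs ⟩
  ∑[ x ← xs ] length (around x)              ≤⟨ ∑-mono-All (All.map bound alive) ⟩
  ∑[ _ ← xs ] (2 * D)                        ≡⟨ ∑-const xs (2 * D) ⟩
  length xs * (2 * D)                        ∎
  where
  open ≤-Reasoning
  G = graphOf es
  around : Fin n → List (Fin n × Fin n)
  around x = map (x ,_) (neighbours G x) ++ map (_, x) (neighbours G x)
  bound : ∀ {x} → deg G x ≤ D → length (around x) ≤ 2 * D
  bound {x} h = ≤-trans (≤-reflexive (trans (length-++ (map (x ,_) (neighbours G x)))
    (cong₂ _+_ (length-map (x ,_) (neighbours G x)) (length-map (_, x) (neighbours G x)))))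
    (≤-trans (+-mono-≤ h h) (≤-reflexive (cong (D +_) (sym (+-identityʳ D)))))
  neighbour : ∀ {u v} → Adj G u v → v ∈ neighbours G u
  neighbour {u} {v} uv = ∈-filter⁺ (adj? G u) (∈-allFin v) uv
  covered : ∀ {uv} → uv ∈ map ends (filter (touches? xs) es) → uv ∈ concatMap around xs
  covered uv∈ with ∈-map⁻ ends uv∈
  ... | e , e∈ , refl with ∈-filter⁻ (touches? xs) {xs = es} e∈
  ...   | e∈es , inj₁ lo∈ = ∈-concatMap⁺ around (lose lo∈ (∈-++⁺ˡ (∈-map⁺ (lo e ,_) (neighbour (∈⇒present e∈es)))))
  ...   | e∈es , inj₂ hi∈ = ∈-concatMap⁺ around (lose hi∈ (∈-++⁺ʳ (map (hi e ,_) (neighbours G (hi e)))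
            (∈-map⁺ (_, hi e) (neighbour (adj-sym G (∈⇒present e∈es))))))

-- A low `x` is nonadjacent to at least n - 1 - D other vertices. Each such pair is a missing edge
-- at `x`, and an edge arises from at most two pairs, one for each end.
∑-touches-missing : ∀ D (xs : List (Fin n)) es → Unique xs → Alive D xs es →
  length xs * n ≤ 2 * ∑ (missing es) (λ e → ⟦ touches? xs e ⟧) + length xs * suc D
∑-touches-missing {n} D xs es u alive = begin
  length xs * n                                         ≡⟨ ∑-const xs n ⟨
  ∑[ _ ← xs ] n                                         ≤⟨ ∑-mono-All (All.map row alive) ⟩
  ∑[ x ← xs ] (∑ (allFin n) (λ z → ⟦ free? (x , z) ⟧) + suc D) ≡⟨ ∑-+ xs _ _ ⟩
  (∑[ x ← xs ] ∑[ z ← allFin n ] ⟦ free? (x , z) ⟧) + ∑ xs (λ _ → suc D)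
    ≡⟨ cong₂ _+_ (sym (∑-cartesianProduct xs (allFin n) (λ q → ⟦ free? q ⟧))) (∑-const xs (suc D)) ⟩
  (∑[ q ← cartesianProduct xs (allFin n) ] ⟦ free? q ⟧) + length xs * suc D
    ≡⟨ cong (_+ length xs * suc D) (length-filter free? (cartesianProduct xs (allFin n))) ⟨
  length pairs + length xs * suc D                      ≤⟨ +-monoˡ-≤ _ (length-⊆ pairs-unique covered) ⟩
  length (concatMap both touching) + length xs * suc D  ≡⟨ cong (_+ length xs * suc D) twice ⟩
  2 * ∑ (missing es) (λ e → ⟦ touches? xs e ⟧) + length xs * suc D ∎
  where
  open ≤-Reasoning
  G = graphOf es
  free? : Decidable (λ (x , z) → z ≢ x × ¬ Adj G x z)
  free? (x , z) = ¬? (z Fin.≟ x) ×-dec ¬? (adj? G x z)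
  pairs = filter free? (cartesianProduct xs (allFin n))
  pairs-unique : Unique pairs
  pairs-unique = Unique.filter⁺ free? (Unique.cartesianProduct⁺ u (Unique.allFin⁺ n))
  touching = filter (touches? xs) (missing es)
  both : Edge n → List (Fin n × Fin n)
  both e = (lo e , hi e) ∷ (hi e , lo e) ∷ []
  twice : length (concatMap both touching) ≡ 2 * ∑ (missing es) (λ e → ⟦ touches? xs e ⟧)
  twice = trans (length-concatMap both touching) (trans (∑-const touching 2)
    (trans (*-comm (length touching) 2) (cong (2 *_) (length-filter (touches? xs) (missing es)))))
  row : ∀ {x} → deg G x ≤ D → n ≤ ∑ (allFin n) (λ z → ⟦ free? (x , z) ⟧) + suc D
  row {x} low = begin
    n                                                   ≡⟨ trans (∑-const (allFin n) 1) (trans (*-identityʳ _) (length-tabulate id)) ⟨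
    ∑[ _ ← allFin n ] 1                                 ≤⟨ ∑-mono (allFin n) (λ z → cover z (z Fin.≟ x) (adj? G x z)) ⟩
    ∑[ z ← allFin n ] (⟦ free? (x , z) ⟧ + (⟦ z Fin.≟ x ⟧ + ⟦ adj? G x z ⟧)) ≡⟨ ∑-+ (allFin n) _ _ ⟩
    ∑ (allFin n) (λ z → ⟦ free? (x , z) ⟧) + ∑ (allFin n) (λ z → ⟦ z Fin.≟ x ⟧ + ⟦ adj? G x z ⟧)
      ≡⟨ cong (∑ (allFin n) (λ z → ⟦ free? (x , z) ⟧) +_) (∑-+ (allFin n) _ _) ⟩
    ∑ (allFin n) (λ z → ⟦ free? (x , z) ⟧) + (∑ (allFin n) (λ z → ⟦ z Fin.≟ x ⟧) + ∑ (allFin n) (λ z → ⟦ adj? G x z ⟧))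
      ≤⟨ +-monoʳ-≤ _ (+-mono-≤ (∑-unique≤1 (Fin._≟ x) (Unique.allFin⁺ n) (λ p q → trans p (sym q)))
           (≤-trans (≤-reflexive (sym (deg≡∑ G x))) low)) ⟩
    ∑ (allFin n) (λ z → ⟦ free? (x , z) ⟧) + suc D      ∎
    where
    cover : ∀ z (d : Dec (z ≡ x)) (a : Dec (Adj G x z)) → 1 ≤ ⟦ ¬? d ×-dec ¬? a ⟧ + (⟦ d ⟧ + ⟦ a ⟧)
    cover z (yes _) a       = s≤s z≤n
    cover z (no _)  (yes _) = s≤s z≤n
    cover z (no _)  (no _)  = s≤s z≤n
  missing-touching : ∀ e → ¬ Adj G (lo e) (hi e) → Touches xs e → e ∈ touching
  missing-touching e ¬adj = ∈-filter⁺ (touches? xs) (∈-filter⁺ (λ e → ¬? (present? es e)) (∈-allEdges e) ¬adj)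
  covered : ∀ {q} → q ∈ pairs → q ∈ concatMap both touching
  covered {x , z} q∈ with ∈-filter⁻ free? {xs = cartesianProduct xs (allFin n)} q∈
  ... | q∈× , z≢x , ¬xz with Fin.<-cmp x z
  ...   | tri< x<z _ _ = ∈-concatMap⁺ both (lose
            (missing-touching (edge x z x<z) ¬xz (inj₁ (proj₁ (∈-cartesianProduct⁻ xs (allFin n) q∈×)))) (here refl))
  ...   | tri≈ _ x≡z _ = contradiction (sym x≡z) z≢x
  ...   | tri> _ _ z<x = ∈-concatMap⁺ both (lose
            (missing-touching (edge z x z<x) (¬xz ∘ adj-sym G) (inj₂ (proj₁ (∈-cartesianProduct⁻ xs (allFin n) q∈×)))) (there (here refl)))

-- Edge weights tilting the process

∏ : ∀ {A : Set} → List A → (A → ℕ) → ℕ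
∏ []       f = 1
∏ (x ∷ xs) f = f x * ∏ xs f

∏-∷ʳ : ∀ {A : Set} (xs : List A) x (f : A → ℕ) → ∏ (xs ∷ʳ x) f ≡ ∏ xs f * f x
∏-∷ʳ []       x f = *-comm (f x) 1
∏-∷ʳ (y ∷ xs) x f = trans (cong (f y *_) (∏-∷ʳ xs x f)) (sym (*-assoc (f y) (∏ xs f) (f x)))

-- Doubled so as to stay in ℕ: relative to the default 2, a tree edge is favoured by the factor `a`
-- and any other edge at a child is halved. A tree edge also touches its child, so the first case
-- must take precedence.
tilt : ∀ {P Q : Set} → ℕ → Dec P → Dec Q → ℕ
tilt a (yes _) _       = 2 * a
tilt a (no _)  (yes _) = 1
tilt a (no _)  (no _)  = 2

-- The product of these weights over the edges drawn so far, killed when a child of t stops being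
-- low, is a supermartingale up to a constant factor per step: the missing edges at the children
-- lower the mean weight, and the |t| tree edges are too few to make up for it if a is at most n / 16.
edgeWeight : ℕ → List (Fin n × Fin n) → Edge n → ℕ
edgeWeight a t e = tilt a (inTree? t e) (touches? (map proj₂ t) e)

-- Bounds the weight from above linearly, so that the mean weight can be computed from the numbers
-- of touching edges and of tree edges.
tilt-sum : ∀ {P Q : Set} a (P? : Dec P) (Q? : Dec Q) → tilt a P? Q? + ⟦ Q? ⟧ ≤ 2 + (1 + 2 * a) * ⟦ P? ⟧
tilt-sum a (yes _) Q?      = ≤-trans (+-monoʳ-≤ (2 * a) (⟦⟧≤1 Q?)) (≤-trans (≤-reflexive (trans (+-comm (2 * a) 1) (sym (*-identityʳ _)))) (m≤n+m _ 2))
tilt-sum a (no _)  (yes _) = m≤m+n 2 _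
tilt-sum a (no _)  (no _)  = m≤m+n 2 _

-- The converse estimate, in multiplicative form: it serves to show that the product of the weights
-- is large when a low tree is present.
tilt-product : ∀ {P Q : Set} a → 1 ≤ a → (P? : Dec P) (Q? : Dec Q) → a ^ ⟦ P? ⟧ * 2 ≤ tilt a P? Q? * 2 ^ ⟦ Q? ⟧
tilt-product a 1≤a (yes _) Q?      = ≤-trans (≤-reflexive (trans (cong (_* 2) (*-identityʳ a)) (trans (*-comm a 2) (sym (*-identityʳ (2 * a))))))
  (*-monoʳ-≤ (2 * a) (m^n>0 2 ⟦ Q? ⟧))
tilt-product a 1≤a (no _)  (yes _) = ≤-refl
tilt-product a 1≤a (no _)  (no _)  = ≤-refl

∏-tilt : ∀ {A : Set} {P Q : A → Set} a → 1 ≤ a → (P? : ∀ x → Dec (P x)) (Q? : ∀ x → Dec (Q x)) → ∀ xs →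
  a ^ ∑ xs (λ x → ⟦ P? x ⟧) * 2 ^ length xs ≤ ∏ xs (λ x → tilt a (P? x) (Q? x)) * 2 ^ ∑ xs (λ x → ⟦ Q? x ⟧)
∏-tilt a 1≤a P? Q? []       = ≤-refl
∏-tilt a 1≤a P? Q? (x ∷ xs) = begin
  a ^ (p + ps) * (2 * 2 ^ length xs)       ≡⟨ cong (_* (2 * 2 ^ length xs)) (^-distribˡ-+-* a p ps) ⟩
  (a ^ p * a ^ ps) * (2 * 2 ^ length xs)   ≡⟨ interchange (a ^ p) (a ^ ps) 2 (2 ^ length xs) ⟩
  (a ^ p * 2) * (a ^ ps * 2 ^ length xs)   ≤⟨ *-mono-≤ (tilt-product a 1≤a (P? x) (Q? x)) (∏-tilt a 1≤a P? Q? xs) ⟩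
  (w * 2 ^ q) * (ws * 2 ^ qs)              ≡⟨ interchange w (2 ^ q) ws (2 ^ qs) ⟩
  (w * ws) * (2 ^ q * 2 ^ qs)              ≡⟨ cong (w * ws *_) (^-distribˡ-+-* 2 q qs) ⟨
  (w * ws) * 2 ^ (q + qs)                  ∎
  where
  open ≤-Reasoning
  p  = ⟦ P? x ⟧
  ps = ∑ xs (λ x → ⟦ P? x ⟧)
  q  = ⟦ Q? x ⟧
  qs = ∑ xs (λ x → ⟦ Q? x ⟧)
  w  = tilt a (P? x) (Q? x)
  ws = ∏ xs (λ x → tilt a (P? x) (Q? x))
  interchange : ∀ a b c d → (a * b) * (c * d) ≡ (a * c) * (b * d)
  interchange = solve 4 (λ a b c d → (a :* b) :* (c :* d) := (a :* c) :* (b :* d)) refl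

*-^ : ∀ a b m → (a * b) ^ m ≡ a ^ m * b ^ m
*-^ a b zero    = refl
*-^ a b (suc m) = trans (cong (a * b *_) (*-^ a b m)) (interchange a b (a ^ m) (b ^ m))
  where
  interchange : ∀ a b c d → (a * b) * (c * d) ≡ (a * c) * (b * d)
  interchange = solve 4 (λ a b c d → (a :* b) :* (c :* d) := (a :* c) :* (b :* d)) refl

lowTree⇒alive : ∀ {es : List (Edge n)} D {t} → All (λ (p , x) → Adj (graphOf es) p x × deg (graphOf es) x ≤ D) t →
  Alive D (map proj₂ t) es
lowTree⇒alive D = All.map⁺ ∘ All.map proj₂

-- All tree edges are present and contribute `a` each. As the children are low, only boundedly many
-- edges are halved, which costs a constant factor.
lowTree-weight : ∀ a → 1 ≤ a → ∀ D (r : Fin n) t {es m} → IsSeq m es → LowTree (graphOf es) D r t →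
  a ^ length t * 2 ^ m ≤ ∏ es (edgeWeight a t) * 2 ^ (length t * (2 * D))
lowTree-weight a 1≤a D r t {es} (u , refl) (grows , all) = begin
  a ^ length t * 2 ^ length es                            ≤⟨ *-monoˡ-≤ _ (^-monoʳ-≤ a {{>-nonZero 1≤a}} (∑-inTree≥ r t grows (All.map proj₁ all))) ⟩
  a ^ ∑ es (λ e → ⟦ inTree? t e ⟧) * 2 ^ length es         ≤⟨ ∏-tilt a 1≤a (inTree? t) (touches? xs) es ⟩
  ∏ es (edgeWeight a t) * 2 ^ ∑ es (λ e → ⟦ touches? xs e ⟧)
    ≤⟨ *-monoʳ-≤ (∏ es (edgeWeight a t)) (^-monoʳ-≤ 2 (≤-trans (∑-touches≤ D xs u (lowTree⇒alive D all))
         (≤-reflexive (cong (_* (2 * D)) (length-map proj₂ t))))) ⟩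
  ∏ es (edgeWeight a t) * 2 ^ (length t * (2 * D))         ∎
  where
  open ≤-Reasoning
  xs = map proj₂ t

-- Here x measures the drift, and y / 2N bounds the mean weight relative to its default value 2.
module _ (a D : ℕ) (r : Fin n) (t : List (Fin n × Fin n)) (grows : Grows r t)
  (x y : ℕ) (x+y : y + x ≡ 2 * (n C 2))
  (room : 2 * x + 2 * ((1 + 2 * a) * length t) + length t * suc D ≤ length t * n) where

  private
    N  = n C 2
    k  = length t
    xs = map proj₂ t
    w  = edgeWeight a t

  -- The hypothesis `room` is what makes the sum of the `M` weights at most 2M - x. The same loss
  -- `x` is shared by `M ≤ N` edges, so the mean weight is at most 2 - x/N = y/N, uniformly in `i`.
  missing-weight : ∀ {i es} → IsSeq i es → Alive D xs es → N * ∑ (missing es) w ≤ (N ∸ i) * y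
  missing-weight {i} {es} isSeq alive = +-cancelʳ-≤ (N * x) _ _ (begin
    N * W + N * x           ≡⟨ *-distribˡ-+ N W x ⟨
    N * (W + x)             ≤⟨ *-monoʳ-≤ N W+x≤ ⟩
    N * (2 * M)             ≡⟨ shuffle N M ⟩
    M * (2 * N)             ≡⟨ cong (M *_) x+y ⟨
    M * (y + x)             ≡⟨ *-distribˡ-+ M y x ⟩
    M * y + M * x           ≤⟨ +-mono-≤ (≤-reflexive (cong (_* y) M≡)) (*-monoˡ-≤ x (≤-trans (≤-reflexive M≡) (m∸n≤m N i))) ⟩
    (N ∸ i) * y + N * x     ∎)
    where
    open ≤-Reasoning
    W = ∑ (missing es) w
    M = length (missing es)
    M≡ : M ≡ N ∸ i
    M≡ = length-missing-seq isSeq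
    shuffle : ∀ N M → N * (2 * M) ≡ M * (2 * N)
    shuffle = solve 2 (λ N M → N :* (con 2 :* M) := M :* (con 2 :* N)) refl
    Q = ∑ (missing es) (λ e → ⟦ touches? xs e ⟧)
    F = ∑ (missing es) (λ e → ⟦ inTree? t e ⟧)
    c = 1 + 2 * a
    W+Q≤ : W + Q ≤ M * 2 + c * k
    W+Q≤ = begin
      W + Q                                                    ≡⟨ ∑-+ (missing es) _ _ ⟨
      ∑ (missing es) (λ e → w e + ⟦ touches? xs e ⟧)           ≤⟨ ∑-mono (missing es) (λ e → tilt-sum a (inTree? t e) (touches? xs e)) ⟩
      ∑ (missing es) (λ e → 2 + c * ⟦ inTree? t e ⟧)           ≡⟨ ∑-+ (missing es) _ _ ⟩
      ∑ (missing es) (λ _ → 2) + ∑ (missing es) (λ e → c * ⟦ inTree? t e ⟧) ≡⟨ cong₂ _+_ (∑-const (missing es) 2) (∑-*ˡ (missing es) c _) ⟩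
      M * 2 + c * F                                            ≤⟨ +-monoʳ-≤ (M * 2) (*-monoʳ-≤ c (∑-inTree≤ t (missing-unique es))) ⟩
      M * 2 + c * k                                            ∎
    kn≤ : k * n ≤ 2 * Q + k * suc D
    kn≤ = subst (λ l → l * n ≤ 2 * Q + l * suc D) (length-map proj₂ t)
      (∑-touches-missing D xs es (children-unique r t grows) alive)
    W+x≤ : W + x ≤ 2 * M
    W+x≤ = *-cancelˡ-≤ 2 (+-cancelʳ-≤ (2 * Q + 2 * (c * k) + k * suc D) _ _ (begin
      2 * (W + x) + (2 * Q + 2 * (c * k) + k * suc D)          ≡⟨ arrange W x Q (c * k) (k * suc D) ⟩
      2 * (W + Q) + (2 * x + 2 * (c * k) + k * suc D)          ≤⟨ +-mono-≤ (*-monoʳ-≤ 2 W+Q≤) (≤-trans room kn≤) ⟩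
      2 * (M * 2 + c * k) + (2 * Q + k * suc D)                ≡⟨ arrange′ M Q (c * k) (k * suc D) ⟩
      2 * (2 * M) + (2 * Q + 2 * (c * k) + k * suc D)          ∎))
      where
      arrange : ∀ W x Q p q → 2 * (W + x) + (2 * Q + 2 * p + q) ≡ 2 * (W + Q) + (2 * x + 2 * p + q)
      arrange = solve 5 (λ W x Q p q → con 2 :* (W :+ x) :+ (con 2 :* Q :+ con 2 :* p :+ q)
        := con 2 :* (W :+ Q) :+ (con 2 :* x :+ con 2 :* p :+ q)) refl
      arrange′ : ∀ M Q p q → 2 * (M * 2 + p) + (2 * Q + q) ≡ 2 * (2 * M) + (2 * Q + 2 * p + q)
      arrange′ = solve 4 (λ M Q p q → con 2 :* (M :* con 2 :+ p) :+ (con 2 :* Q :+ q)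
        := con 2 :* (con 2 :* M) :+ (con 2 :* Q :+ con 2 :* p :+ q)) refl

  potential : List (Edge n) → ℕ
  potential es = ⟦ alive? D xs es ⟧ * ∏ es w

  potential-step : ∀ {i es} → IsSeq i es →
    N * ∑ (missing es) (λ e → potential (es ∷ʳ e)) ≤ ((N ∸ i) * y) * potential es
  potential-step {i} {es} isSeq = ≤-trans (*-monoʳ-≤ N (≤-trans (∑-mono (missing es) one)
      (≤-reflexive (∑-*ˡ (missing es) (potential es) w)))) (finish (alive? D xs es))
    where
    one : ∀ e → potential (es ∷ʳ e) ≤ potential es * w e
    one e = ≤-trans (*-mono-≤ (⟦⟧-mono (alive? D xs (es ∷ʳ e)) (alive? D xs es)
        (All.map (λ {v} → ≤-trans (deg-∷ʳ es e v)))) (≤-reflexive (∏-∷ʳ es e w)))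
      (≤-reflexive (sym (*-assoc ⟦ alive? D xs es ⟧ (∏ es w) (w e))))
    finish : (alive : Dec (Alive D xs es)) →
      N * ((⟦ alive ⟧ * ∏ es w) * ∑ (missing es) w) ≤ ((N ∸ i) * y) * (⟦ alive ⟧ * ∏ es w)
    finish (no _)  = ≤-trans (≤-reflexive (*-zeroʳ N)) z≤n
    finish (yes p) = ≤-trans (≤-reflexive (shuffle N (1 * ∏ es w) (∑ (missing es) w)))
      (*-monoˡ-≤ (1 * ∏ es w) (missing-weight isSeq p))
      where
      shuffle : ∀ a b c → a * (b * c) ≡ (a * c) * b
      shuffle = solve 3 (λ a b c → a :* (b :* c) := (a :* c) :* b) refl

  -- The mean of the potential after `i` steps is at most (y/N)^i, with denominators cleared.
  potential-sum : ∀ i → N ^ i * ∑ (seqs n i) potential ≤ y ^ i * length (seqs n i)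
  potential-sum zero    = ≤-trans (≤-reflexive (trans (+-identityʳ _) (+-identityʳ _)))
    (≤-trans (≤-reflexive (*-identityʳ ⟦ alive? D xs [] ⟧)) (⟦⟧≤1 (alive? D xs [])))
  potential-sum (suc i) = begin
    (N * N ^ i) * ∑ (seqs n (suc i)) potential
      ≡⟨ cong ((N * N ^ i) *_) (trans (∑-concatMap _ (seqs n i) potential) (∑-cong (seqs n i) (λ es → ∑-map (es ∷ʳ_) (missing es) potential))) ⟩
    (N * N ^ i) * ∑ (seqs n i) (λ es → ∑ (missing es) (λ e → potential (es ∷ʳ e)))
      ≡⟨ shuffle₁ N (N ^ i) _ ⟩
    N ^ i * (N * ∑ (seqs n i) (λ es → ∑ (missing es) (λ e → potential (es ∷ʳ e))))
      ≡⟨ cong (N ^ i *_) (∑-*ˡ (seqs n i) N _) ⟨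
    N ^ i * ∑ (seqs n i) (λ es → N * ∑ (missing es) (λ e → potential (es ∷ʳ e)))
      ≤⟨ *-monoʳ-≤ (N ^ i) (∑-mono-All (All.map potential-step (seqs-isSeq n i))) ⟩
    N ^ i * ∑ (seqs n i) (λ es → ((N ∸ i) * y) * potential es)
      ≡⟨ cong (N ^ i *_) (∑-*ˡ (seqs n i) ((N ∸ i) * y) potential) ⟩
    N ^ i * (((N ∸ i) * y) * ∑ (seqs n i) potential)
      ≡⟨ shuffle₂ (N ^ i) ((N ∸ i) * y) _ ⟩
    ((N ∸ i) * y) * (N ^ i * ∑ (seqs n i) potential)
      ≤⟨ *-monoʳ-≤ ((N ∸ i) * y) (potential-sum i) ⟩
    ((N ∸ i) * y) * (y ^ i * length (seqs n i))
      ≡⟨ shuffle₃ (N ∸ i) y (y ^ i) (length (seqs n i)) ⟩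
    (y * y ^ i) * (length (seqs n i) * (N ∸ i))
      ≡⟨ cong ((y * y ^ i) *_) (length-seqs n i) ⟨
    (y * y ^ i) * length (seqs n (suc i)) ∎
    where
    open ≤-Reasoning
    shuffle₁ : ∀ a b c → (a * b) * c ≡ b * (a * c)
    shuffle₁ = solve 3 (λ a b c → (a :* b) :* c := b :* (a :* c)) refl
    shuffle₂ : ∀ a b c → a * (b * c) ≡ b * (a * c)
    shuffle₂ = solve 3 (λ a b c → a :* (b :* c) := b :* (a :* c)) refl
    shuffle₃ : ∀ a b c d → (a * b) * (c * d) ≡ (b * c) * (d * a)
    shuffle₃ = solve 4 (λ a b c d → (a :* b) :* (c :* d) := (b :* c) :* (d :* a)) refl

  -- Markov's inequality for the potential, which is at least a^k 2^m / 2^(2Dk) on the event: the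
  -- probability is at most 2^(2Dk) a^(-k) (y/2N)^m.
  lowTree-count-at : 1 ≤ a → ∀ m →
    (∑[ es ← seqs n m ] ⟦ lowTree? (graphOf es) D r t ⟧) * (a ^ k * (2 * N) ^ m)
      ≤ 2 ^ (k * (2 * D)) * (y ^ m * length (seqs n m))
  lowTree-count-at 1≤a m = begin
    count * (a ^ k * (2 * N) ^ m)                  ≡⟨ cong (λ p → count * (a ^ k * p)) (*-^ 2 N m) ⟩
    count * (a ^ k * (2 ^ m * N ^ m))              ≡⟨ shuffle count (a ^ k) (2 ^ m) (N ^ m) ⟩
    N ^ m * ((a ^ k * 2 ^ m) * count)              ≡⟨ cong (N ^ m *_) (∑-*ˡ (seqs n m) (a ^ k * 2 ^ m) _) ⟨
    N ^ m * ∑ (seqs n m) (λ es → (a ^ k * 2 ^ m) * ⟦ lowTree? (graphOf es) D r t ⟧)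
      ≤⟨ *-monoʳ-≤ (N ^ m) (∑-mono-All (All.map (λ {es} isSeq → one isSeq (lowTree? (graphOf es) D r t)) (seqs-isSeq n m))) ⟩
    N ^ m * ∑ (seqs n m) (λ es → 2 ^ T * potential es) ≡⟨ cong (N ^ m *_) (∑-*ˡ (seqs n m) (2 ^ T) potential) ⟩
    N ^ m * (2 ^ T * ∑ (seqs n m) potential)       ≡⟨ shuffle′ (N ^ m) (2 ^ T) _ ⟩
    2 ^ T * (N ^ m * ∑ (seqs n m) potential)       ≤⟨ *-monoʳ-≤ (2 ^ T) (potential-sum m) ⟩
    2 ^ T * (y ^ m * length (seqs n m))            ∎
    where
    open ≤-Reasoning
    T = k * (2 * D)
    count = ∑[ es ← seqs n m ] ⟦ lowTree? (graphOf es) D r t ⟧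
    shuffle : ∀ c a p q → c * (a * (p * q)) ≡ q * ((a * p) * c)
    shuffle = solve 4 (λ c a p q → c :* (a :* (p :* q)) := q :* ((a :* p) :* c)) refl
    shuffle′ : ∀ a b c → a * (b * c) ≡ b * (a * c)
    shuffle′ = solve 3 (λ a b c → a :* (b :* c) := b :* (a :* c)) refl
    one : ∀ {es} → IsSeq m es → (d : Dec (LowTree (graphOf es) D r t)) → (a ^ k * 2 ^ m) * ⟦ d ⟧ ≤ 2 ^ T * potential es
    one isSeq (no _)  = ≤-trans (≤-reflexive (*-zeroʳ (a ^ k * 2 ^ m))) z≤n
    one {es} isSeq (yes low) = begin
      (a ^ k * 2 ^ m) * 1      ≡⟨ *-identityʳ (a ^ k * 2 ^ m) ⟩
      a ^ k * 2 ^ m            ≤⟨ lowTree-weight a 1≤a D r t isSeq low ⟩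
      ∏ es w * 2 ^ T           ≡⟨ *-comm (∏ es w) (2 ^ T) ⟩
      2 ^ T * ∏ es w           ≡⟨ cong (2 ^ T *_) (trans (sym (*-identityˡ (∏ es w)))
                                    (cong (_* ∏ es w) (sym (⟦⟧-yes (alive? D xs es) (lowTree⇒alive D (proj₂ low)))))) ⟩
      2 ^ T * potential es     ∎

-- Continuing the process beyond step m

take-∷ʳ : ∀ {A : Set} m (xs : List A) x → m ≤ length xs → take m (xs ∷ʳ x) ≡ take m xs
take-∷ʳ zero    xs       x _         = refl
take-∷ʳ (suc m) (y ∷ xs) x (s≤s m≤) = cong (y ∷_) (take-∷ʳ m xs x m≤)

-- All sequences of `m` edges have the same number of continuations, so the average of `f` over
-- prefixes is its average over the sequences of length `m`. Cross-multiplication avoids fractions.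
count-prefix : ∀ (n m j : ℕ) (f : List (Edge n) → ℕ) →
  (∑[ ω ← seqs n (j + m) ] f (take m ω)) * length (seqs n m) ≡ ∑ (seqs n m) f * length (seqs n (j + m))
count-prefix n m zero    f = cong (_* length (seqs n m)) (go (seqs-isSeq n m))
  where
  go : ∀ {ess} → All (IsSeq m) ess → ∑ ess (f ∘ take m) ≡ ∑ ess f
  go []                  = refl
  go {es ∷ _} ((_ , len) ∷ h) = cong₂ _+_ (cong f (take-all m es (≤-reflexive len))) (go h)
count-prefix n m (suc j) f = begin
  ∑ (seqs n (suc j + m)) (f ∘ take m) * length (seqs n m)
    ≡⟨ cong (_* length (seqs n m)) (trans (∑-concatMap _ (seqs n (j + m)) _) (go (seqs-isSeq n (j + m)))) ⟩
  (R * ∑ (seqs n (j + m)) (f ∘ take m)) * length (seqs n m)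
    ≡⟨ *-assoc R _ _ ⟩
  R * (∑ (seqs n (j + m)) (f ∘ take m) * length (seqs n m))
    ≡⟨ cong (R *_) (count-prefix n m j f) ⟩
  R * (∑ (seqs n m) f * length (seqs n (j + m)))
    ≡⟨ shuffle R (∑ (seqs n m) f) (length (seqs n (j + m))) ⟩
  ∑ (seqs n m) f * (length (seqs n (j + m)) * R)
    ≡⟨ cong (∑ (seqs n m) f *_) (length-seqs n (j + m)) ⟨
  ∑ (seqs n m) f * length (seqs n (suc j + m)) ∎
  where
  open ≡-Reasoning
  R = (n C 2) ∸ (j + m)
  shuffle : ∀ a b c → a * (b * c) ≡ b * (c * a)
  shuffle = solve 3 (λ a b c → a :* (b :* c) := b :* (c :* a)) refl
  go : ∀ {ess} → All (IsSeq (j + m)) ess →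
    ∑[ es ← ess ] ∑ (map (es ∷ʳ_) (missing es)) (f ∘ take m) ≡ R * ∑ ess (f ∘ take m)
  go [] = sym (*-zeroʳ R)
  go {es ∷ ess} (isSeq ∷ h) = trans (cong₂ _+_ (trans (∑-map (es ∷ʳ_) (missing es) _) (trans
      (∑-cong (missing es) (λ e → cong f (take-∷ʳ m es e (≤-trans (m≤n+m m j) (≤-reflexive (sym (proj₂ isSeq)))))))
      (trans (∑-const (missing es) (f (take m es))) (cong (_* f (take m es)) (length-missing-seq isSeq))))) (go h))
    (sym (*-distribˡ-+ R (f (take m es)) _))

seqs-nonempty : ∀ n i → i ≤ n C 2 → 0 < length (seqs n i)
seqs-nonempty n zero    _  = s≤s z≤n
seqs-nonempty n (suc i) i< = subst (0 <_) (sym (length-seqs n i))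
  (*-mono-≤ (seqs-nonempty n i (<⇒≤ i<)) (m<n⇒0<n∸m i<))

lowTree-count : ∀ a → 1 ≤ a → ∀ D (r : Fin n) t x y → y + x ≡ 2 * (n C 2) →
  2 * x + 2 * ((1 + 2 * a) * length t) + length t * suc D ≤ length t * n → ∀ m → m ≤ n C 2 →
  (∑[ ω ← seqs n (n C 2) ] ⟦ lowTree? (graphAt ω m) D r t ⟧) * (a ^ length t * (2 * (n C 2)) ^ m)
    ≤ 2 ^ (length t * (2 * D)) * (y ^ m * length (seqs n (n C 2)))
lowTree-count {n} a 1≤a D r t x y x+y room m m≤N = cases (grows? r t)
  where
  open ≤-Reasoning
  N = n C 2
  total = ∑[ ω ← seqs n N ] ⟦ lowTree? (graphAt ω m) D r t ⟧
  now  = ∑[ es ← seqs n m ] ⟦ lowTree? (graphOf es) D r t ⟧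
  b = a ^ length t * (2 * N) ^ m
  p = 2 ^ (length t * (2 * D))
  ℓ = length (seqs n m)
  L = length (seqs n N)
  prefix : total * ℓ ≡ now * L
  prefix = subst (λ M → (∑[ ω ← seqs n M ] ⟦ lowTree? (graphAt ω m) D r t ⟧) * ℓ ≡ now * length (seqs n M))
    (m∸n+n≡m m≤N) (count-prefix n m (N ∸ m) (λ es → ⟦ lowTree? (graphOf es) D r t ⟧))
  shuffle₁ : ∀ a b c → (a * b) * c ≡ (a * c) * b
  shuffle₁ = solve 3 (λ a b c → (a :* b) :* c := (a :* c) :* b) refl
  shuffle₂ : ∀ a b c d → (a * (b * c)) * d ≡ (a * (b * d)) * c
  shuffle₂ = solve 4 (λ a b c d → (a :* (b :* c)) :* d := (a :* (b :* d)) :* c) refl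
  cases : Dec (Grows r t) → total * b ≤ p * (y ^ m * L)
  cases (no ¬grows) = ≤-trans (≤-reflexive (cong (_* b) (trans (∑-cong (seqs n N)
    (λ ω → ⟦⟧-no (lowTree? (graphAt ω m) D r t) (¬grows ∘ proj₁))) (trans (∑-const (seqs n N) 0) (*-zeroʳ L))))) z≤n
  cases (yes grows) = *-cancelʳ-≤ _ _ ℓ {{>-nonZero (seqs-nonempty n m m≤N)}} (begin
    (total * b) * ℓ           ≡⟨ shuffle₁ total b ℓ ⟩
    (total * ℓ) * b           ≡⟨ cong (_* b) prefix ⟩
    (now * L) * b            ≡⟨ shuffle₁ now L b ⟩
    (now * b) * L            ≤⟨ *-monoˡ-≤ L (lowTree-count-at a D r t grows x y x+y room 1≤a m) ⟩
    (p * (y ^ m * ℓ)) * L     ≡⟨ shuffle₂ p (y ^ m) ℓ L ⟩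
    (p * (y ^ m * L)) * ℓ     ∎)

-- Enumerating the trees

treesFrom : Fin n → ℕ → List (List (Fin n × Fin n))
treesFrom         r zero    = [] ∷ []
treesFrom {n = n} r (suc j) = concatMap (λ t → map (_∷ t) (cartesianProduct (verts r t) (allFin n))) (treesFrom r j)

treesFrom-complete : ∀ (r : Fin n) t → Grows r t → t ∈ treesFrom r (length t)
treesFrom-complete     r []            _            = here refl
treesFrom-complete {n} r ((p , x) ∷ t) (p∈ , _ , g) =
  ∈-concatMap⁺ (λ t → map (_∷ t) (cartesianProduct (verts r t) (allFin n)))
    (lose (treesFrom-complete r t g) (∈-map⁺ (_∷ t) (∈-cartesianProduct⁺ p∈ (∈-allFin x))))

treesFrom-length : ∀ (r : Fin n) j → All (λ t → length t ≡ j) (treesFrom r j)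
treesFrom-length r zero    = refl ∷ []
treesFrom-length r (suc j) = All.concat⁺ (All.map⁺ (All.map (λ len →
  All.map⁺ (All.tabulate (λ _ → cong suc len))) (treesFrom-length r j)))

length-cartesianProduct : ∀ {A B : Set} (xs : List A) (ys : List B) → length (cartesianProduct xs ys) ≡ length xs * length ys
length-cartesianProduct xs ys = trans (length≡∑ (cartesianProduct xs ys)) (trans (∑-cartesianProduct xs ys (λ _ → 1))
  (trans (∑-cong xs (λ _ → sym (length≡∑ ys))) (∑-const xs (length ys))))
  where
  length≡∑ : ∀ {A : Set} (xs : List A) → length xs ≡ ∑[ _ ← xs ] 1
  length≡∑ xs = trans (sym (*-identityʳ (length xs))) (sym (∑-const xs 1))

-- Each child picks its parent among the at most `k` vertices present and itself among all `n`
-- vertices.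
length-treesFrom : ∀ (r : Fin n) {k} j → j ≤ k → length (treesFrom r j) ≤ (k * n) ^ j
length-treesFrom         r     zero    _   = ≤-refl
length-treesFrom {n = n} r {k} (suc j) j<k = begin
  length (treesFrom r (suc j))                         ≡⟨ length-concatMap _ (treesFrom r j) ⟩
  ∑ (treesFrom r j) (λ t → length (map (_∷ t) (cartesianProduct (verts r t) (allFin n))))
    ≤⟨ ∑-mono-All (All.map (λ {t} → one {t}) (treesFrom-length r j)) ⟩
  ∑ (treesFrom r j) (λ _ → k * n)                      ≡⟨ ∑-const (treesFrom r j) (k * n) ⟩
  length (treesFrom r j) * (k * n)                     ≤⟨ *-monoˡ-≤ (k * n) (length-treesFrom r j (<⇒≤ j<k)) ⟩
  (k * n) ^ j * (k * n)                                ≡⟨ *-comm ((k * n) ^ j) (k * n) ⟩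
  (k * n) ^ suc j                                      ∎
  where
  open ≤-Reasoning
  one : ∀ {t} → length t ≡ j → length (map (_∷ t) (cartesianProduct (verts r t) (allFin n))) ≤ k * n
  one {t} refl = ≤-trans (≤-reflexive (trans (length-map (_∷ t) (cartesianProduct (verts r t) (allFin n)))
    (trans (length-cartesianProduct (verts r t) (allFin n)) (cong₂ _*_ (cong suc (length-map proj₂ t)) (length-tabulate id)))))
    (*-monoˡ-≤ n j<k)

-- The bad event

times : ∀ n → ℕ → List ℕ
times n m₀ = filter (m₀ ≤?_) (upTo (suc (n C 2)))

module _ (D k m₀ : ℕ) where

  HasLowTree : ℕ → List (Edge n) → Set
  HasLowTree m ω = Any (λ r → Any (LowTree (graphAt ω m) D r) (treesFrom r k)) (allFin _)

  hasLowTree? : ∀ m → Decidable (HasLowTree {n} m)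
  hasLowTree? m ω = Any.any? (λ r → Any.any? (lowTree? (graphAt ω m) D r) (treesFrom r k)) (allFin _)

  Bad : List (Edge n) → Set
  Bad {n} ω = Any (λ m → HasLowTree m ω) (times n m₀)

  bad? : Decidable (Bad {n})
  bad? {n} ω = Any.any? (λ m → hasLowTree? m ω) (times n m₀)

  ¬bad⇒noLowTree : ∀ {ω : List (Edge n)} {m} → m₀ ≤ m → m ≤ n C 2 → ¬ Bad ω → NoLowTree (graphAt ω m) D k
  ¬bad⇒noLowTree {n} {ω} {m} m₀≤m m≤N ¬bad r t refl low = ¬bad
    (lose (∈-filter⁺ (m₀ ≤?_) (∈-upTo⁺ (s≤s m≤N)) m₀≤m) (lose (∈-allFin r) (lose (treesFrom-complete r t (proj₁ low)) low)))

⟦any⟧≤∑ : ∀ {A : Set} {P : A → Set} (P? : Decidable P) xs → ⟦ Any.any? P? xs ⟧ ≤ ∑[ x ← xs ] ⟦ P? x ⟧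
⟦any⟧≤∑ P? []       = z≤n
⟦any⟧≤∑ {P = P} P? (x ∷ xs) = ≤-trans (⟦⟧-cover (Any.any? P? (x ∷ xs)) (P? x) (Any.any? P? xs) Any.toSum)
  (+-monoʳ-≤ ⟦ P? x ⟧ (⟦any⟧≤∑ P? xs))

union-bound : ∀ {A Ω : Set} (Ωs : List Ω) {P : Ω → A → Set} (P? : ∀ ω → Decidable (P ω)) B c {xs} →
  All (λ x → (∑[ ω ← Ωs ] ⟦ P? ω x ⟧) * B ≤ c) xs → (∑[ ω ← Ωs ] ⟦ Any.any? (P? ω) xs ⟧) * B ≤ length xs * c
union-bound Ωs P? B c {xs} h = begin
  (∑[ ω ← Ωs ] ⟦ Any.any? (P? ω) xs ⟧) * B          ≤⟨ *-monoˡ-≤ B (∑-mono Ωs (λ ω → ⟦any⟧≤∑ (P? ω) xs)) ⟩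
  (∑[ ω ← Ωs ] ∑[ x ← xs ] ⟦ P? ω x ⟧) * B          ≡⟨ cong (_* B) (∑-swap Ωs xs _) ⟩
  (∑[ x ← xs ] ∑[ ω ← Ωs ] ⟦ P? ω x ⟧) * B          ≡⟨ *-comm _ B ⟩
  B * ∑[ x ← xs ] ∑[ ω ← Ωs ] ⟦ P? ω x ⟧            ≡⟨ ∑-*ˡ xs B _ ⟨
  ∑[ x ← xs ] (B * ∑[ ω ← Ωs ] ⟦ P? ω x ⟧)          ≤⟨ ∑-mono-All (All.map (λ {x} → ≤-trans (≤-reflexive (*-comm B (∑[ ω ← Ωs ] ⟦ P? ω x ⟧)))) h) ⟩
  ∑[ _ ← xs ] c                                     ≡⟨ ∑-const xs c ⟩
  length xs * c                                     ∎
  where open ≤-Reasoning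

bad-count : ∀ n D k m₀ B c →
  (∀ r (t : List (Fin n × Fin n)) m → length t ≡ k → m₀ ≤ m → m ≤ n C 2 →
    (∑[ ω ← seqs n (n C 2) ] ⟦ lowTree? (graphAt ω m) D r t ⟧) * B ≤ c) →
  (∑[ ω ← seqs n (n C 2) ] ⟦ bad? D k m₀ ω ⟧) * B ≤ suc (n C 2) * (n * ((k * n) ^ k * c))
bad-count n D k m₀ B c h = ≤-trans
  (union-bound Ωs (λ ω m → hasLowTree? D k m₀ m ω) B _ (All.tabulate (λ {m} m∈ → ≤-trans
    (union-bound Ωs (λ ω r → Any.any? (lowTree? (graphAt ω m) D r) (treesFrom r k)) B _ (All.tabulate (λ {r} _ → ≤-trans
      (union-bound Ωs (λ ω → lowTree? (graphAt ω m) D r) B c (All.map (λ {t} len → atTime m∈ r t len) (treesFrom-length r k)))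
      (*-monoˡ-≤ c (length-treesFrom r k ≤-refl)))))
    (≤-reflexive (cong (_* ((k * n) ^ k * c)) (length-tabulate {n = n} id))))))
  (*-monoˡ-≤ (n * ((k * n) ^ k * c)) (≤-trans (length-⊆ (Unique.filter⁺ (m₀ ≤?_) (Unique.upTo⁺ (suc (n C 2)))) (proj₁ ∘ ∈-filter⁻ (m₀ ≤?_) {xs = upTo (suc (n C 2))}))
    (≤-reflexive (length-upTo (suc (n C 2))))))
  where
  Ωs = seqs n (n C 2)
  atTime : ∀ {m} → m ∈ times n m₀ → ∀ r t → length t ≡ k → (∑[ ω ← Ωs ] ⟦ lowTree? (graphAt ω m) D r t ⟧) * B ≤ c
  atTime m∈ r t len = let m∈upTo , m₀≤m = ∈-filter⁻ (m₀ ≤?_) {xs = upTo (suc (n C 2))} m∈ in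
    h r t _ len m₀≤m (s≤s⁻¹ (∈-upTo⁻ m∈upTo))

-- Numerical estimates

-- Bernoulli's inequality (1 + x/y)^b ≥ 1 + b x/y, multiplied by y^(b + 1).
bernoulli : ∀ x y b → y ^ b * (y + b * x) ≤ (y + x) ^ b * y
bernoulli x y zero    = ≤-reflexive (cong (_+ 0) (+-identityʳ y))
bernoulli x y (suc b) = begin
  (y * y ^ b) * (y + (x + b * x))                      ≤⟨ m≤m+n _ (y ^ b * (x * (b * x))) ⟩
  (y * y ^ b) * (y + (x + b * x)) + y ^ b * (x * (b * x)) ≡⟨ expand y (y ^ b) x (b * x) ⟩
  (y + x) * (y ^ b * (y + b * x))                      ≤⟨ *-monoʳ-≤ (y + x) (bernoulli x y b) ⟩
  (y + x) * ((y + x) ^ b * y)                          ≡⟨ *-assoc (y + x) ((y + x) ^ b) y ⟨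
  (y + x) ^ suc b * y                                  ∎
  where
  open ≤-Reasoning
  expand : ∀ y p x z → (y * p) * (y + (x + z)) + p * (x * z) ≡ (y + x) * (p * (y + z))
  expand = solve 4 (λ y p x z → (y :* p) :* (y :+ (x :+ z)) :+ p :* (x :* z) := (y :+ x) :* (p :* (y :+ z))) refl

doubling : ∀ x y b → 0 < y → y ≤ b * x → 2 * y ^ b ≤ (y + x) ^ b
doubling x y b 0<y y≤bx = *-cancelʳ-≤ _ _ y {{>-nonZero 0<y}} (begin
  (2 * y ^ b) * y        ≡⟨ rearrange (y ^ b) y ⟩
  y ^ b * (y + y)        ≤⟨ *-monoʳ-≤ (y ^ b) (+-monoʳ-≤ y y≤bx) ⟩
  y ^ b * (y + b * x)    ≤⟨ bernoulli x y b ⟩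
  (y + x) ^ b * y        ∎)
  where
  open ≤-Reasoning
  rearrange : ∀ p y → (2 * p) * y ≡ p * (y + y)
  rearrange = solve 2 (λ p y → (con 2 :* p) :* y := p :* (y :+ y)) refl

-- An exponential estimate without exponentials: the ratio of the powers of y + x and y doubles at
-- least once in every `b` steps.
repeated-doubling : ∀ x y b j m → 0 < y → y ≤ b * x → b * j ≤ m → 2 ^ j * y ^ m ≤ (y + x) ^ m
repeated-doubling x y b j m 0<y y≤bx bj≤m = begin
  2 ^ j * y ^ m                          ≡⟨ cong (λ l → 2 ^ j * y ^ l) (sym (m+[n∸m]≡n bj≤m)) ⟩
  2 ^ j * y ^ (b * j + rest)             ≡⟨ cong (2 ^ j *_) (^-distribˡ-+-* y (b * j) rest) ⟩
  2 ^ j * (y ^ (b * j) * y ^ rest)       ≡⟨ *-assoc (2 ^ j) (y ^ (b * j)) (y ^ rest) ⟨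
  (2 ^ j * y ^ (b * j)) * y ^ rest       ≡⟨ cong (λ p → (2 ^ j * p) * y ^ rest) (^-*-assoc y b j) ⟨
  (2 ^ j * (y ^ b) ^ j) * y ^ rest       ≡⟨ cong (_* y ^ rest) (*-^ 2 (y ^ b) j) ⟨
  (2 * y ^ b) ^ j * y ^ rest             ≤⟨ *-mono-≤ (^-monoˡ-≤ j (doubling x y b 0<y y≤bx)) (^-monoˡ-≤ rest (m≤m+n y x)) ⟩
  ((y + x) ^ b) ^ j * (y + x) ^ rest     ≡⟨ cong (_* (y + x) ^ rest) (^-*-assoc (y + x) b j) ⟩
  (y + x) ^ (b * j) * (y + x) ^ rest     ≡⟨ ^-distribˡ-+-* (y + x) (b * j) rest ⟨
  (y + x) ^ (b * j + rest)               ≡⟨ cong ((y + x) ^_) (m+[n∸m]≡n bj≤m) ⟩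
  (y + x) ^ m                            ∎
  where
  open ≤-Reasoning
  rest = m ∸ b * j

log₂ : ∀ n → 0 < n → ∃ λ L → 2 ^ L ≤ n × n < 2 ^ suc L
log₂ (suc zero)    _ = 0 , ≤-refl , ≤-refl
log₂ (suc (suc n)) _ with log₂ (suc n) (s≤s z≤n)
... | L , lower , upper with suc (suc n) <? 2 ^ suc L
...   | yes below = L , m≤n⇒m≤1+n lower , below
...   | no  above = suc L , ≮⇒≥ above , ≤-trans (s≤s upper)
          (≤-trans (+-monoˡ-≤ (2 ^ suc L) (m^n>0 2 (suc L))) (≤-reflexive (cong (2 ^ suc L +_) (sym (+-identityʳ (2 ^ suc L))))))

quotient-bounds : ∀ n c .{{_ : NonZero c}} → c ≤ n → ∃ λ a → 1 ≤ a × c * a ≤ n × n ≤ c * a + c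
quotient-bounds n c c≤n = a , positive , c*a≤n , n≤
  where
  open ≤-Reasoning
  a = n ℕ./ c
  r = n % c
  n≡ : n ≡ r + c * a
  n≡ = trans (m≡m%n+[m/n]*n n c) (cong (r +_) (*-comm a c))
  r<c : r < c
  r<c = m%n<n n c
  c*a≤n : c * a ≤ n
  c*a≤n = ≤-trans (m≤n+m (c * a) r) (≤-reflexive (sym n≡))
  n≤ : n ≤ c * a + c
  n≤ = ≤-trans (≤-reflexive (trans n≡ (+-comm r (c * a)))) (+-monoʳ-≤ (c * a) (<⇒≤ r<c))
  positive : 1 ≤ a
  positive = ≮⇒≥ λ { (s≤s a≤0) → <-irrefl refl (begin-strict
    c          ≤⟨ c≤n ⟩
    n          ≡⟨ n≡ ⟩
    r + c * a  ≡⟨ cong (λ z → r + c * z) (n≤0⇒n≡0 a≤0) ⟩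
    r + c * 0  ≡⟨ cong (r +_) (*-zeroʳ c) ⟩
    r + 0      ≡⟨ +-identityʳ r ⟩
    r          <⟨ r<c ⟩
    c          ∎) }

-- The constants in the union bound

treeConstant : ℕ → ℕ → ℕ
treeConstant k D = (32 * k) ^ k * 2 ^ (k * (2 * D))

module _ (n κ D q m₀ L : ℕ) (96≤κ : 96 ≤ κ)
  (2^L≤n : 2 ^ L ≤ n) (n<2^L+1 : n < 2 ^ suc L) (many : n * L ≤ 12 * suc m₀) (1≤L : 1 ≤ L)
  (D≤ : 2 * D + 6 ≤ n) (κ≤ : κ + 2 ≤ n) (120≤n : 120 ≤ n)
  (C≤ : 8 * (treeConstant (8 * κ) D * suc q) ≤ 2 ^ L) where

  private
    open ≤-Reasoning
    N = n C 2
    k = 8 * κ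
    -- This collects what does not depend on `n`: the factor 32k for each child, from kn ≤ 32ka once
    -- a^k is cancelled, and 2^T for the halved edges at low children.
    C′ = treeConstant k D
    T = k * (2 * D)
    x = κ * n
    y = 2 * N ∸ x
    all = length (seqs n N)
    big = 2 ^ (L * 4)

    n>0 : 0 < n
    n>0 = ≤-trans (s≤s z≤n) 120≤n

    x<2N : x < 2 * N
    x<2N = +-cancelˡ-≤ n _ _ (begin
      n + suc x           ≡⟨ +-suc n x ⟩
      1 + (n + x)         ≤⟨ +-monoˡ-≤ (n + x) n>0 ⟩
      n + (n + κ * n)     ≡⟨ cong (_* n) (+-comm 2 κ) ⟩
      (κ + 2) * n         ≤⟨ *-monoˡ-≤ n κ≤ ⟩
      n * n               ≡⟨ n+2*nC2≡n*n n ⟨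
      n + 2 * N           ∎)

    y+x : y + x ≡ 2 * N
    y+x = m∸n+n≡m (<⇒≤ x<2N)

    y>0 : 0 < y
    y>0 = m<n⇒0<n∸m x<2N

    -- `a` should be linear in `n` for a^k to cancel n^k, yet small enough that the favoured tree
    -- edges do not eat up the drift.
    a-spec = quotient-bounds n 16 (≤-trans (m≤m+n 16 104) 120≤n)
    a = proj₁ a-spec
    1≤a : 1 ≤ a
    1≤a = proj₁ (proj₂ a-spec)
    16a≤n : 16 * a ≤ n
    16a≤n = proj₁ (proj₂ (proj₂ a-spec))
    n≤32a : n ≤ 32 * a
    n≤32a = begin
      n                 ≤⟨ proj₂ (proj₂ (proj₂ a-spec)) ⟩
      16 * a + 16       ≤⟨ +-monoʳ-≤ (16 * a) (*-monoʳ-≤ 16 1≤a) ⟩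
      16 * a + 16 * a   ≡⟨ *-distribʳ-+ a 16 16 ⟨
      32 * a            ∎

    b-spec = quotient-bounds n 96 (≤-trans (m≤m+n 96 24) 120≤n)
    b : ℕ
    b = suc (proj₁ b-spec)
    96b≤n+96 : 96 * b ≤ n + 96
    96b≤n+96 = begin
      96 * b                 ≡⟨ *-suc 96 (proj₁ b-spec) ⟩
      96 + 96 * proj₁ b-spec ≤⟨ +-monoʳ-≤ 96 (proj₁ (proj₂ (proj₂ b-spec))) ⟩
      96 + n                 ≡⟨ +-comm 96 n ⟩
      n + 96                 ∎
    n≤96b : n ≤ 96 * b
    n≤96b = begin
      n                      ≤⟨ proj₂ (proj₂ (proj₂ b-spec)) ⟩
      96 * proj₁ b-spec + 96 ≡⟨ +-comm (96 * proj₁ b-spec) 96 ⟩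
      96 + 96 * proj₁ b-spec ≡⟨ *-suc 96 (proj₁ b-spec) ⟨
      96 * b                 ∎

    -- With `b` about n/96 and κ at least 96, `b` steps of drift κn amount to at least n², which
    -- exceeds 2N.
    y≤bx : y ≤ b * x
    y≤bx = begin
      y              ≤⟨ m∸n≤m (2 * N) x ⟩
      2 * N          ≤⟨ m≤n+m (2 * N) n ⟩
      n + 2 * N      ≡⟨ n+2*nC2≡n*n n ⟩
      n * n          ≤⟨ *-monoˡ-≤ n (≤-trans n≤96b (*-monoˡ-≤ b 96≤κ)) ⟩
      (κ * b) * n    ≡⟨ shuffle κ b n ⟩
      b * x          ∎
      where
      shuffle : ∀ κ b n → (κ * b) * n ≡ b * (κ * n)
      shuffle = solve 3 (λ κ b n → (κ :* b) :* n := b :* (κ :* n)) refl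

    -- 4L doublings take about nL/24 steps, half of what `many` provides. The other half absorbs the
    -- rounding: 120 is 96 for rounding `b` up plus 24 for the successor in `suc m₀`.
    enough : b * (L * 4) ≤ m₀
    enough = *-cancelˡ-≤ 24 (+-cancelʳ-≤ 24 _ _ (begin
      24 * (b * (L * 4)) + 24      ≡⟨ cong (_+ 24) (shuffle b L) ⟩
      (96 * b) * L + 24            ≤⟨ +-mono-≤ (*-monoˡ-≤ L 96b≤n+96) (*-monoʳ-≤ 24 1≤L) ⟩
      (n + 96) * L + 24 * L        ≡⟨ collect n L ⟩
      n * L + 120 * L              ≤⟨ +-monoʳ-≤ (n * L) (*-monoˡ-≤ L 120≤n) ⟩
      n * L + n * L                ≤⟨ +-mono-≤ many many ⟩
      12 * suc m₀ + 12 * suc m₀    ≡⟨ last m₀ ⟩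
      24 * m₀ + 24                 ∎))
      where
      shuffle : ∀ b L → 24 * (b * (L * 4)) ≡ (96 * b) * L
      shuffle = solve 2 (λ b L → con 24 :* (b :* (L :* con 4)) := (con 96 :* b) :* L) refl
      collect : ∀ n L → (n + 96) * L + 24 * L ≡ n * L + 120 * L
      collect = solve 2 (λ n L → (n :+ con 96) :* L :+ con 24 :* L := n :* L :+ con 120 :* L) refl
      last : ∀ m → 12 * suc m + 12 * suc m ≡ 24 * m + 24
      last = solve 1 (λ m → con 12 :* (con 1 :+ m) :+ con 12 :* (con 1 :+ m) := con 24 :* m :+ con 24) refl

    -- Of 8κn, a quarter goes to the drift 2x, a quarter to the tilted tree edges by 16a ≤ n, and
    -- half to the bounded terms by 2D + 6 ≤ n.
    room : 2 * x + 2 * ((1 + 2 * a) * k) + k * suc D ≤ k * n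
    room = begin
      2 * (κ * n) + 2 * ((1 + 2 * a) * (8 * κ)) + (8 * κ) * suc D ≡⟨ expand κ n a D ⟩
      κ * (2 * n + 2 * (16 * a) + 4 * (2 * D + 6))        ≤⟨ *-monoʳ-≤ κ (+-mono-≤ (+-monoʳ-≤ (2 * n) (*-monoʳ-≤ 2 16a≤n)) (*-monoʳ-≤ 4 D≤)) ⟩
      κ * (2 * n + 2 * n + 4 * n)                          ≡⟨ collect κ n ⟩
      (8 * κ) * n                                          ∎
      where
      expand : ∀ κ n a D → 2 * (κ * n) + 2 * ((1 + 2 * a) * (8 * κ)) + (8 * κ) * suc D ≡ κ * (2 * n + 2 * (16 * a) + 4 * (2 * D + 6))
      expand = solve 4 (λ κ n a D → con 2 :* (κ :* n) :+ con 2 :* ((con 1 :+ con 2 :* a) :* (con 8 :* κ)) :+ (con 8 :* κ) :* (con 1 :+ D)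
        := κ :* (con 2 :* n :+ con 2 :* (con 16 :* a) :+ con 4 :* (con 2 :* D :+ con 6))) refl
      collect : ∀ κ n → κ * (2 * n + 2 * n + 4 * n) ≡ (8 * κ) * n
      collect = solve 2 (λ κ n → κ :* (con 2 :* n :+ con 2 :* n :+ con 4 :* n) := (con 8 :* κ) :* n) refl

    one-tree : ∀ r (t : List (Fin n × Fin n)) m → length t ≡ k → m₀ ≤ m → m ≤ N →
      (∑[ ω ← seqs n N ] ⟦ lowTree? (graphAt ω m) D r t ⟧) * (a ^ k * big) ≤ 2 ^ T * all
    one-tree r t m len m₀≤m m≤N = *-cancelʳ-≤ _ _ (y ^ m) {{m^n≢0 y m {{>-nonZero y>0}}}} (begin
      (count * (a ^ k * big)) * y ^ m       ≡⟨ shuffle count (a ^ k) big (y ^ m) ⟩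
      count * (a ^ k * (big * y ^ m))       ≤⟨ *-monoʳ-≤ count (*-monoʳ-≤ (a ^ k) (subst (λ z → big * y ^ m ≤ z ^ m) y+x
                                                 (repeated-doubling x y b (L * 4) m y>0 y≤bx (≤-trans enough m₀≤m)))) ⟩
      count * (a ^ k * (2 * N) ^ m)         ≤⟨ subst (λ l → count * (a ^ l * (2 * N) ^ m) ≤ 2 ^ (l * (2 * D)) * (y ^ m * all)) len
                                                 (lowTree-count a 1≤a D r t x y y+x (subst (λ l → 2 * x + 2 * ((1 + 2 * a) * l) + l * suc D ≤ l * n) (sym len) room) m m≤N) ⟩
      2 ^ T * (y ^ m * all)                 ≡⟨ shuffle′ (2 ^ T) (y ^ m) all ⟩
      (2 ^ T * all) * y ^ m                 ∎)
      where
      count = ∑[ ω ← seqs n N ] ⟦ lowTree? (graphAt ω m) D r t ⟧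
      shuffle : ∀ c p q z → (c * (p * q)) * z ≡ c * (p * (q * z))
      shuffle = solve 4 (λ c p q z → (c :* (p :* q)) :* z := c :* (p :* (q :* z))) refl
      shuffle′ : ∀ p q z → p * (q * z) ≡ (p * z) * q
      shuffle′ = solve 3 (λ p q z → p :* (q :* z) := (p :* z) :* q) refl

    bad = ∑[ ω ← seqs n N ] ⟦ bad? D k m₀ ω ⟧

    sucN≤ : suc N ≤ n * n
    sucN≤ = begin
      1 + N         ≤⟨ +-mono-≤ n>0 (m≤m+n N (N + 0)) ⟩
      n + 2 * N     ≡⟨ n+2*nC2≡n*n n ⟩
      n * n         ∎

    trees≤ : (k * n) ^ k ≤ (32 * k) ^ k * a ^ k
    trees≤ = begin
      (k * n) ^ k              ≤⟨ ^-monoˡ-≤ k (*-monoʳ-≤ k n≤32a) ⟩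
      (k * (32 * a)) ^ k       ≡⟨ cong (_^ k) (shuffle k a) ⟩
      ((32 * k) * a) ^ k       ≡⟨ *-^ (32 * k) a k ⟩
      (32 * k) ^ k * a ^ k     ∎
      where
      shuffle : ∀ k a → k * (32 * a) ≡ (32 * k) * a
      shuffle = solve 2 (λ k a → k :* (con 32 :* a) := (con 32 :* k) :* a) refl

    all-trees : bad * big ≤ (n * (n * n)) * (C′ * all)
    all-trees = *-cancelʳ-≤ _ _ (a ^ k) {{m^n≢0 a k {{>-nonZero 1≤a}}}} (begin
      (bad * big) * a ^ k                                        ≡⟨ shuffle bad big (a ^ k) ⟩
      bad * (a ^ k * big)                                        ≤⟨ bad-count n D k m₀ (a ^ k * big) (2 ^ T * all) one-tree ⟩
      suc N * (n * ((k * n) ^ k * (2 ^ T * all)))                ≤⟨ *-mono-≤ sucN≤ (*-monoʳ-≤ n (*-monoˡ-≤ (2 ^ T * all) trees≤)) ⟩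
      (n * n) * (n * (((32 * k) ^ k * a ^ k) * (2 ^ T * all)))   ≡⟨ shuffle′ n ((32 * k) ^ k) (a ^ k) (2 ^ T) all ⟩
      ((n * (n * n)) * (C′ * all)) * a ^ k                       ∎)
      where
      shuffle : ∀ p q z → (p * q) * z ≡ p * (z * q)
      shuffle = solve 3 (λ p q z → (p :* q) :* z := p :* (z :* q)) refl
      shuffle′ : ∀ n c p q z → (n * n) * (n * ((c * p) * (q * z))) ≡ ((n * (n * n)) * ((c * q) * z)) * p
      shuffle′ = solve 5 (λ n c p q z → (n :* n) :* (n :* ((c :* p) :* (q :* z))) := ((n :* (n :* n)) :* ((c :* q) :* z)) :* p) refl

    -- Three of the four factors 2^L pay for n³, at the price of 8 since n < 2 * 2^L; the fourth
    -- pays for the constants.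
    big≥ : (n * (n * n)) * (C′ * suc q) ≤ big
    big≥ = begin
      (n * (n * n)) * (C′ * suc q)                   ≤⟨ *-monoˡ-≤ (C′ * suc q) (*-mono-≤ n≤ (*-mono-≤ n≤ n≤)) ⟩
      ((2 * p) * ((2 * p) * (2 * p))) * (C′ * suc q) ≡⟨ shuffle p (C′ * suc q) ⟩
      (8 * (C′ * suc q)) * (p * (p * (p * 1)))       ≤⟨ *-monoˡ-≤ (p * (p * (p * 1))) C≤ ⟩
      p ^ 4                                          ≡⟨ ^-*-assoc 2 L 4 ⟩
      big                                            ∎
      where
      p = 2 ^ L
      n≤ : n ≤ 2 * p
      n≤ = <⇒≤ n<2^L+1
      shuffle : ∀ p c → ((2 * p) * ((2 * p) * (2 * p))) * c ≡ (8 * c) * (p * (p * (p * 1)))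
      shuffle = solve 2 (λ p c → ((con 2 :* p) :* ((con 2 :* p) :* (con 2 :* p))) :* c := (con 8 :* c) :* (p :* (p :* (p :* con 1)))) refl

  rare-at : bad * suc q ≤ all
  rare-at = *-cancelʳ-≤ _ _ big {{m^n≢0 2 (L * 4)}} (begin
    (bad * suc q) * big                        ≡⟨ shuffle bad (suc q) big ⟩
    (bad * big) * suc q                        ≤⟨ *-monoˡ-≤ (suc q) all-trees ⟩
    ((n * (n * n)) * (C′ * all)) * suc q       ≡⟨ shuffle′ (n * (n * n)) C′ all (suc q) ⟩
    all * ((n * (n * n)) * (C′ * suc q))       ≤⟨ *-monoʳ-≤ all big≥ ⟩
    all * big                                  ∎)
    where
    shuffle : ∀ p q z → (p * q) * z ≡ (p * z) * q
    shuffle = solve 3 (λ p q z → (p :* q) :* z := (p :* z) :* q) refl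
    shuffle′ : ∀ c p q z → (c * (p * q)) * z ≡ q * (c * (p * z))
    shuffle′ = solve 4 (λ c p q z → (c :* (p :* q)) :* z := q :* (c :* (p :* z))) refl

rare : ∀ κ D q → 96 ≤ κ → ∃ λ n₁ → ∀ n m₀ → n₁ ≤ n → (∀ L → 2 ^ L ≤ n → n * L ≤ 12 * suc m₀) →
  (∑[ ω ← seqs n (n C 2) ] ⟦ bad? D (8 * κ) m₀ ω ⟧) * suc q ≤ length (seqs n (n C 2)) × n * D < m₀
rare κ D q 96≤κ = n₁ , λ n m₀ n₁≤n many →
  let 120≤n            = ≤-trans 120≤n₁ n₁≤n
      1≤n              = ≤-trans (s≤s z≤n) 120≤n
      L , lower , upper = log₂ n 1≤n
      M<L              = exponent< (≤-trans 2^M≤n₁ n₁≤n) upper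
  in rare-at n κ D q m₀ L 96≤κ lower upper (many L lower) (≤-trans (s≤s z≤n) M<L)
       (≤-trans D≤n₁ n₁≤n) (≤-trans κ≤n₁ n₁≤n) 120≤n
       (<⇒≤ (*-cancelˡ-< 2 X (2 ^ L) (≤-trans (s≤s (≤-trans X≤n₁ n₁≤n)) upper)))
     , degree n m₀ L 1≤n (<⇒≤ M<L) (many L lower)
  where
  open ≤-Reasoning
  X = 8 * (treeConstant (8 * κ) D * suc q)
  -- Makes nL at least 12 (nD + 2), whence nD + 2 ≤ m₀ + 1; this is the edge count that
  -- `high-vertex` needs.
  M = 12 * D + 24
  -- A sum of all the lower bounds wanted for `n`, each of which is then one of its summands.
  n₁ = (2 * D + 6) + ((κ + 2) + (120 + (2 * X + 2 ^ suc M)))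

  D≤n₁ : 2 * D + 6 ≤ n₁
  D≤n₁ = m≤m+n (2 * D + 6) _
  κ≤n₁ : κ + 2 ≤ n₁
  κ≤n₁ = ≤-trans (m≤m+n (κ + 2) (120 + (2 * X + 2 ^ suc M))) (m≤n+m _ (2 * D + 6))
  tail≤n₁ : 120 + (2 * X + 2 ^ suc M) ≤ n₁
  tail≤n₁ = ≤-trans (m≤n+m _ (κ + 2)) (m≤n+m _ (2 * D + 6))
  120≤n₁ : 120 ≤ n₁
  120≤n₁ = ≤-trans (m≤m+n 120 (2 * X + 2 ^ suc M)) tail≤n₁
  X≤n₁ : 2 * X ≤ n₁
  X≤n₁ = ≤-trans (m≤m+n (2 * X) (2 ^ suc M)) (≤-trans (m≤n+m _ 120) tail≤n₁)
  2^M≤n₁ : 2 ^ suc M ≤ n₁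
  2^M≤n₁ = ≤-trans (m≤n+m _ (2 * X)) (≤-trans (m≤n+m _ 120) tail≤n₁)

  exponent< : ∀ {n L} → 2 ^ suc M ≤ n → n < 2 ^ suc L → M < L
  exponent< {n} {L} h h′ = ≰⇒> λ L≤M → <-irrefl refl (begin-strict
    n            <⟨ h′ ⟩
    2 ^ suc L    ≤⟨ ^-monoʳ-≤ 2 (s≤s L≤M) ⟩
    2 ^ suc M    ≤⟨ h ⟩
    n            ∎)

  degree : ∀ n m₀ L → 1 ≤ n → M ≤ L → n * L ≤ 12 * suc m₀ → n * D < m₀
  degree n m₀ L 1≤n M≤L many = s≤s⁻¹ (*-cancelˡ-≤ 12 (begin
    12 * suc (suc (n * D))        ≡⟨ expand (n * D) ⟩
    12 * (n * D) + 24 * 1         ≤⟨ +-monoʳ-≤ (12 * (n * D)) (*-monoʳ-≤ 24 1≤n) ⟩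
    12 * (n * D) + 24 * n         ≡⟨ collect n D ⟩
    n * M                         ≤⟨ *-monoʳ-≤ n M≤L ⟩
    n * L                         ≤⟨ many ⟩
    12 * suc m₀                   ∎))
    where
    expand : ∀ z → 12 * suc (suc z) ≡ 12 * z + 24 * 1
    expand = solve 1 (λ z → con 12 :* (con 2 :+ z) := con 12 :* z :+ con 24 :* con 1) refl
    collect : ∀ n D → 12 * (n * D) + 24 * n ≡ n * (12 * D + 24)
    collect = solve 2 (λ n D → con 12 :* (n :* D) :+ con 24 :* n := n :* (con 12 :* D :+ con 24)) refl

-- Vertices of large degree

_≟ᴱ_ : ∀ (e f : Edge n) → Dec (e ≡ f)
e ≟ᴱ f = map′ (λ (p , q) → ends-injective (cong₂ _,_ p q)) (λ { refl → refl , refl }) ((lo e Fin.≟ lo f) ×-dec (hi e Fin.≟ hi f))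

isSeq? : ∀ m (es : List (Edge n)) → Dec (IsSeq m es)
isSeq? m es = DecUnique.unique? _≟ᴱ_ es ×-dec (length es ℕ.≟ m)

-- Every edge appears in the star of its lower end. If all degrees were at most `D`, there would be
-- at most nD edges.
high-vertex : ∀ {m D} {es : List (Edge n)} → IsSeq m es → n * D < m → ∃ λ v → D < deg (graphOf es) v
high-vertex {n} {m} {D} {es} (u , refl) big with Fin.any? (λ v → D <? deg (graphOf es) v)
... | yes found = found
... | no  none  = contradiction big (≤⇒≯ (begin
  length es                              ≡⟨ length-map ends es ⟨
  length (map ends es)                   ≤⟨ length-⊆ (Unique.map⁺ ends-injective u) covered ⟩
  length (concatMap star (allFin n))     ≡⟨ length-concatMap star (allFin n) ⟩
  ∑[ v ← allFin n ] length (star v)      ≤⟨ ∑-mono (allFin n) (λ v → ≤-trans (≤-reflexive (length-map (v ,_) (neighbours G v)))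
                                              (≮⇒≥ (λ h → none (v , h)))) ⟩
  ∑[ _ ← allFin n ] D                    ≡⟨ ∑-const (allFin n) D ⟩
  length (allFin n) * D                  ≡⟨ cong (_* D) (length-tabulate {n = n} id) ⟩
  n * D                                  ∎))
  where
  open ≤-Reasoning
  G = graphOf es
  star : Fin n → List (Fin n × Fin n)
  star v = map (v ,_) (neighbours G v)
  covered : ∀ {uv} → uv ∈ map ends es → uv ∈ concatMap star (allFin n)
  covered uv∈ with ∈-map⁻ ends uv∈
  ... | e , e∈ , refl = ∈-concatMap⁺ star (lose (∈-allFin (lo e)) (∈-map⁺ (lo e ,_) (∈-filter⁺ (adj? G (lo e)) (∈-allFin (hi e)) (∈⇒present e∈))))

-- Failure of resilience with high probability

giant-not-resilient : ∀ (ε : ℝ) {e q k m₀} → Eventually (λ i → 0ℚ ℚ.+ e ℚ.≤ approx ε i) → inverse q ℚ.≤ e →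
  n * (suc q * (k + 2)) < m₀ → ∀ {ω : List (Edge n)} → ¬ Bad (suc q * (k + 2)) k m₀ ω → IsSeq (n C 2) ω →
  ∀ m → m₀ ≤ m → m ≤ n C 2 → ∀ giant → IsLargestComponent (graphAt ω m) giant →
  ¬ Resilient (fromℚ ½ +ᴿ ε) connectivity (induced (graphAt ω m) giant)
giant-not-resilient {n} ε {q = q} {k} {m₀} ε≥ small m₀-large {ω} ¬bad (u , len) m m₀≤m m≤N giant isGiant resilient =
  let isSeq = Unique.take⁺ m u , trans (length-take m ω) (m≤n⇒m⊓n≡m (≤-trans m≤N (≤-reflexive (sym len))))
      H , spanning , afford , disconnected = giant-cut (graphAt ω m) q giant (λ _ → ∈⊤)
        (¬bad⇒noLowTree _ k m₀ m₀≤m m≤N ¬bad) (high-vertex isSeq (<-≤-trans m₀-large m₀≤m)) isGiant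
  in disconnected (resilient H spanning (λ v v∈ → affordable-real ε {q = q} ε≥ small (deg H v) (deg (induced (graphAt ω m) giant) v) (afford v v∈)))

not-resilient-whp : ∀ κ → 96 ≤ κ →
  (ε : ℝ) → fromℚ 0ℚ <ᴿ ε → (m₀ : ℕ → ℕ) →
  Eventually (λ n →
    ((fromℚ 1ℚ +ᴿ ε) *ᴿ fromℚ (ℤ.+ 1 ℚ./ 6)) *ᴿ fromℕ n *ᴿ log n ≤ᴿ fromℕ (m₀ n) × m₀ n ≤ n C 2) →
  WithHighProbability randomGraphProcess (λ n ω →
    ∀ m → m₀ n ≤ m → m ≤ n C 2 →
    ∀ giant → IsLargestComponent (graphAt ω m) giant →
    ¬ Resilient (fromℚ ½ +ᴿ ε) connectivity (induced (graphAt ω m) giant))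
not-resilient-whp κ 96≤κ ε ε>0@(e , 0<e , ε≥) m₀ (n₀ , hyp) δ 0<δ =
  let q  , small  = inverse-small e 0<e
      q′ , small′ = inverse-small δ 0<δ
      D           = suc q * (8 * κ + 2)
      n₁ , rarely = rare κ D q′ 96≤κ
  in n₀ ⊔ n₁ , λ n n≥ →
    let few , m₀-large = rarely n (m₀ n) (≤-trans (m≤n⊔m n₀ n₁) n≥)
          (λ L h → many-edges ε ε>0 n (m₀ n) L h (proj₁ (hyp n (≤-trans (m≤m⊔n n₀ n₁) n≥))))
        good? = λ ω → ¬? (bad? D (8 * κ) (m₀ n) ω) ×-dec isSeq? (n C 2) ω
    -- The event must imply the property for arbitrary lists of edges, not only those the process
    -- produces; `IsSeq` excludes lists with repetitions or of the wrong length and costs no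
    -- probability.
    in (λ ω → ¬ Bad D (8 * κ) (m₀ n) ω × IsSeq (n C 2) ω) , good?
       , (λ ω (¬bad , isSeq) → giant-not-resilient ε {q = q} {8 * κ} ε≥ small m₀-large ¬bad isSeq)
       , ℚ.≤-trans (ℚ.+-monoʳ-≤ 1ℚ (ℚ.neg-antimono-≤ small′))
           (Pr-bound n good? q′ (≤-trans (*-monoˡ-≤ (suc q′) (∑-mono-All (All.map (λ {ω} isSeq →
             ⟦⟧-mono (¬? (good? ω)) (bad? D (8 * κ) (m₀ n) ω) (bad-or-good isSeq (bad? D (8 * κ) (m₀ n) ω)))
             (seqs-isSeq n (n C 2))))) few))
  where
  bad-or-good : ∀ {P Q : Set} → Q → Dec P → ¬ (¬ P × Q) → P
  bad-or-good q (yes p) _ = p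
  bad-or-good q (no ¬p) h = contradiction (¬p , q) h

open import Data.Integer.Base using (+_)
open import Data.Rational.Base using (_/_)

proposition3p4 : (ε : ℝ) → fromℚ 0ℚ <ᴿ ε →
    (m₀ : ℕ → ℕ) →
    Eventually (λ n →
    ((fromℚ 1ℚ +ᴿ ε) *ᴿ fromℚ (+ 1 / 6)) *ᴿ fromℕ n *ᴿ log n ≤ᴿ fromℕ (m₀ n)
    × m₀ n ≤ n C 2) →
    WithHighProbability randomGraphProcess (λ n ω →
    ∀ m → m₀ n ≤ m → m ≤ n C 2 →
    fromℕ m ≤ᴿ (fromℚ 1ℚ +ᴿ ε *ᴿ fromℚ (+ 1 / 6)) *ᴿ fromℕ (m₀ n) →
    ∀ giant → IsLargestComponent (graphAt ω m) giant →
    ¬ Resilient (fromℚ ½ +ᴿ ε) connectivity (induced (graphAt ω m) giant))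
proposition3p4 ε ε>0 m₀ m₀-bounds δ 0<δ =
  -- With κ = 96 the forbidden low trees have 768 children.
  let n₀ , whp = not-resilient-whp 96 ≤-refl ε ε>0 m₀ m₀-bounds δ 0<δ
  in n₀ , λ n n≥ →
    let E , E? , implies , likely = whp n n≥
    in E , E? , (λ ω ω∈E m m₀≤m m≤N _ → implies ω ω∈E m m₀≤m m≤N) , likely
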